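{- Let $p > 3$ be a prime. For every $\epsilon > 0$ there is a constant $C_\epsilon > 0$ (depending only on $\epsilon$) such that the following holds: for every integer $a$ with $\gcd(a, p) = 1$, every integer $c$, and every positive integer $H \ge C_\epsilon\, p^{1/6 + \epsilon}$, there exist integers $0 \le X, Y \le p-1$ such that \[ |C_{a,c} \cap B(X, Y; H)| \ge 2 . \]
   Context: For a prime $p$, an integer $a$ with $\gcd(a,p)=1$ and an integer $c$, the modular reduced cubic is the set \[ C_{a,c} := \{ (x, y) \in (\mathbb{Z}/p\mathbb{Z})^2 : y \equiv a x^3 + c x \pmod p \}. \] For integers $X, Y$ and a positive integer $H$, the box $B(X,Y;H)$ is the set of residue pairs \[ B(X, Y; H) := \{ (x, y) \in (\mathbb{Z}/p\mathbb{Z})^2 : x \equiv X + i,\ y \equiv Y + j \pmod p \text{ for some integers } 1 \le i, j \le H \}. \] $|S|$ denotes the number of elements of a set $S$. -}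

module Defs where

open import Data.Nat as ℕ using (ℕ; zero; suc)
open import Data.Integer as ℤ using (ℤ; +_)
open import Data.Integer.DivMod using (_%ℕ_)
open import Data.Fin using (Fin; toℕ)
open import Data.Fin.Properties using (any?)
open import Data.List using (List; length; filter; cartesianProduct; allFin)
open import Data.Product using (_×_; _,_; ∃)
open import Relation.Binary.PropositionalEquality using (_≡_)
open import Relation.Nullary using (Dec)
open import Relation.Nullary.Decidable using (_×-dec_)
open import Data.Nat.Properties using () renaming (_≟_ to _≟ℕ_)

-- Residues mod p = suc q are represented by Fin p (values 0..p-1).
-- Points of (ℤ/pℤ)² are pairs in Fin p × Fin p.

InCubic : (q : ℕ) → ℤ → ℤ → Fin (suc q) × Fin (suc q) → Set
InCubic q a c (x , y) =
  toℕ y ≡ ((a ℤ.* ((+ toℕ x) ℤ.^ 3) ℤ.+ c ℤ.* (+ toℕ x)) %ℕ suc q)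

InInterval : (q : ℕ) → ℤ → ℕ → Fin (suc q) → Set
InInterval q X H x = ∃ λ (k : Fin H) → toℕ x ≡ ((X ℤ.+ + suc (toℕ k)) %ℕ suc q)

InBox : (q : ℕ) → ℤ → ℤ → ℕ → Fin (suc q) × Fin (suc q) → Set
InBox q X Y H (x , y) = InInterval q X H x × InInterval q Y H y

inInterval? : ∀ q X H x → Dec (InInterval q X H x)
inInterval? q X H x = any? (λ k → toℕ x ≟ℕ ((X ℤ.+ + suc (toℕ k)) %ℕ suc q))

inCubicBox? : ∀ q a c X Y H (pt : Fin (suc q) × Fin (suc q)) →
              Dec (InCubic q a c pt × InBox q X Y H pt)
inCubicBox? q a c X Y H (x , y) =
  (toℕ y ≟ℕ ((a ℤ.* ((+ toℕ x) ℤ.^ 3) ℤ.+ c ℤ.* (+ toℕ x)) %ℕ suc q))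
  ×-dec (inInterval? q X H x ×-dec inInterval? q Y H y)

-- |C_{a,c} ∩ B(X,Y;H)| for the prime p (p = 0 is excluded by primality; we set 0).
cubicBoxCount : (p : ℕ) → ℤ → ℤ → ℤ → ℤ → ℕ → ℕ
cubicBoxCount zero    a c X Y H = 0
cubicBoxCount (suc q) a c X Y H =
  length (filter (inCubicBox? q a c X Y H)
                 (cartesianProduct (allFin (suc q)) (allFin (suc q))))

{-# OPTIONS --safe #-}

-- Put p = 2h + 1 and f(x) = a x³ + c x. Since f(y + m) - f(y - m) = 2 (3 a m y² + f(m)), two points of the cubic
-- with abscissae 2m apart have ordinates 2s apart exactly when 3am (s - f(m)) is a square. If no box of side H
-- holds two points, these numbers are non-squares for all small m, s, so (s - f(m))ʰ = ±1 with a sign that does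
-- not depend on s; moreover the intervals f(m) + [0, H) are disjoint modulo p. Dividing by small w, as in
-- Burgess' method, λ = (v - f(m)) / w has the property that (λ + t)ʰ is the same sign for t = 1, …, k.
--
-- There are about H³ triples (m, v, w), and most of the λ are distinct once the w are taken pairwise coprime and in
-- a dyadic block: either few f(m) are fractions modulo p with small numerator and denominator, and then for given
-- m, w every other m′ can spoil only one v, or many are, and then a coincidence of two λ is an identity between
-- integers. On the other hand Stepanov's method bounds the number of such λ by about √p: a combination of
-- the products of the (x + t)ʰ⁺¹ with polynomial coefficients vanishes at all of them to order M = 2ᵏ⁻¹, because
-- on these points every derivative becomes a polynomial of low degree that can be made zero by a dimension count.
-- It is not the zero polynomial: (x + t)ʰ⁺¹ is a square root of tᵖ (x + t) modulo xᵖ, and the norm of the combination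
-- in this tower of quadratic extensions is a nonzero polynomial of degree less than p.

module Submission where

open import Defs
open import Level using (0ℓ)
open import Algebra.Bundles using (CommutativeRing)
import Algebra.Solver.Ring as RingSolver
open import Algebra.Solver.Ring.AlmostCommutativeRing
  using (fromCommutativeRing; _-Raw-AlmostCommutative⟶_)
open import Data.Empty using (⊥-elim; ⊥)
open import Data.Fin as Fin using (Fin; toℕ; fromℕ<; _↑ˡ_; _↑ʳ_; remQuot; combine; finToFun; funToFin)
import Data.Fin.Properties as Finₚ
open import Data.Fin.Properties using (any?)
open import Data.Integer as ℤ using (ℤ; +_; -[1+_])
import Data.Integer.Divisibility.Signed as Signed
open import Data.Integer.DivMod using (_%ℕ_; _/ℕ_; n%ℕd<d; a≡a%ℕn+[a/ℕn]*n)
open import Data.Integer.GCD using (gcd)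
import Data.Integer.Properties as ℤₚ
open import Data.List using (List; []; _∷_; map; length; tabulate; drop; filter; cartesianProduct; allFin; upTo; applyUpTo; _++_; lookup)
open import Data.List.Membership.Propositional using (_∈_; find; lose)
open import Data.List.Membership.Propositional.Properties
  using (∈-lookup; ∈-cartesianProduct⁻; ∈-cartesianProduct⁺; ∈-upTo⁻; ∈-applyUpTo⁻; ∈-filter⁺; ∈-allFin)
open import Data.List.Properties using (filter-++; length-++; length-map; length-upTo; length-applyUpTo)
open import Data.List.Relation.Unary.All as All using (All; []; _∷_)
import Data.List.Relation.Unary.All.Properties as Allₚ
open import Data.List.Relation.Unary.AllPairs using (AllPairs; []; _∷_)
import Data.List.Relation.Unary.AllPairs.Properties as AllPairsₚ
open import Data.List.Relation.Unary.Any as Any using (Any; here; there)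
import Data.List.Relation.Unary.Any.Properties as Anyₚ
open import Data.List.Relation.Unary.Unique.Propositional using (Unique)
import Data.List.Relation.Unary.Unique.Propositional.Properties as Uniqueₚ
open import Data.Maybe using (just; nothing)
open import Data.Nat as ℕ using (ℕ; zero; suc; _!)
open import Data.Nat.Coprimality as Coprimality using (Coprime; coprime-divisor; coprime?; gcd≡1⇒coprime)
open import Data.Nat.DivMod using (_%_; _/_; m≡m%n+[m/n]*n; m%n<n)
open import Data.Nat.Divisibility
  using (_∣_; _∣?_; divides; ∣-refl; ∣-trans; ∣⇒≤; m∣m*n; n∣m*n; ∣m+n∣m⇒∣n; 1∣_; 0∣⇒≡0; ∣1⇒≡1)
open import Data.Nat.GCD using (gcd[m,n]∣m; gcd[m,n]∣n; gcd-greatest) renaming (gcd to gcdℕ)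
open import Data.Nat.Induction using (<-rec)
open import Data.Nat.LCM using (lcm; m∣lcm[m,n]; n∣lcm[m,n]; lcm-least)
open import Data.Nat.ListAction using (product)
open import Data.Nat.Primality using (Prime; prime⇒irreducible; prime⇒nonTrivial; euclidsLemma)
open import Data.Nat.Primality.Factorisation using (factorise)
import Data.Nat.Properties as ℕₚ
open import Data.Nat.Tactic.RingSolver using (solve-∀)
open import Data.Product using (_×_; _,_; proj₁; proj₂; Σ)
open import Data.Sum using (_⊎_; inj₁; inj₂; [_,_]′)
open import Function using (id; _∘_)
open import Relation.Binary.Definitions using (tri<; tri≈; tri>)
open import Relation.Binary.PropositionalEquality as ≡ using (_≡_; _≢_; _≗_)
open import Relation.Nullary using (Dec; yes; no; ¬_; ¬?)
open import Relation.Nullary.Decidable using (_×-dec_; map′)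
open import Relation.Unary using (Decidable)

-- Ring equations with integer coefficients

-- The exponent 1/6 is where two counts meet: m, v, w of size about H give H³ values λ, while
-- Stepanov's bound for their number is about k p / M, with M at most about √p. Two requirements fix
-- the sizes. Vanishing to order M costs about M (n + M k) conditions against 2ᵏ (n + 1) unknown
-- coefficients, which suggests n = M k and M = 2ᵏ⁻¹. The norm has degree about 2ᵏ n, that is 2 M²
-- k, and has to stay below p. So 2ᵏ is nearly √p and the runs have logarithmic length; the factor
-- p^ε in H pays for k, for the scarcity of the coprime w and for all constants. The exponent is h +
-- 1 and not h because (x + t)^(2h + 2) = (x + t)ᵖ (x + t) is linear modulo xᵖ, whereas (x + t)^(2h)
-- = (x + t)ᵖ⁻¹ has full degree there; only a square root of something of low degree has a norm of
-- low degree. With ε = n / d, the inequality H ≥ C p^(1/6 + ε) is raised to the power 6 d, which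
-- keeps it within the natural numbers.

module IntegerMultiples (R : CommutativeRing 0ℓ 0ℓ) where
  open CommutativeRing R
  open import Algebra.Properties.Ring ring
  open import Algebra.Properties.AbelianGroup +-abelianGroup using (⁻¹-∙-comm)
  open import Algebra.Properties.Semiring.Mult.TCOptimised semiring
    using (×1-homo-*; ×-homo-+; 1+×) renaming (_×_ to _·_) public
  open import Relation.Binary.Reasoning.Setoid setoid

  ⟦_⟧ℤ : ℤ → Carrier
  ⟦ + n ⟧ℤ      = n · 1#
  ⟦ -[1+ n ] ⟧ℤ = - (suc n · 1#)

  ⟦-⟧ : ∀ i → ⟦ ℤ.- i ⟧ℤ ≈ - ⟦ i ⟧ℤ
  ⟦-⟧ (+ zero)   = sym -0#≈0#
  ⟦-⟧ (+ suc n)  = refl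
  ⟦-⟧ -[1+ n ]   = sym (-‿involutive _)

  cancel-1+ : ∀ a b → (1# + a) - (1# + b) ≈ a - b
  cancel-1+ a b = begin
    (1# + a) + - (1# + b)    ≈⟨ +-congˡ (⁻¹-∙-comm 1# b) ⟨
    (1# + a) + (- 1# + - b)  ≈⟨ +-congʳ (+-comm 1# a) ⟩
    (a + 1#) + (- 1# + - b)  ≈⟨ +-assoc a 1# _ ⟩
    a + (1# + (- 1# + - b))  ≈⟨ +-congˡ (+-assoc 1# (- 1#) (- b)) ⟨
    a + ((1# + - 1#) + - b)  ≈⟨ +-congˡ (+-congʳ (-‿inverseʳ 1#)) ⟩
    a + (0# + - b)           ≈⟨ +-congˡ (+-identityˡ (- b)) ⟩
    a - b                    ∎

  ⟦⊖⟧ : ∀ m n → ⟦ m ℤ.⊖ n ⟧ℤ ≈ m · 1# - n · 1#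
  ⟦⊖⟧ m zero = begin
    ⟦ m ℤ.⊖ 0 ⟧ℤ   ≡⟨ ≡.cong ⟦_⟧ℤ (ℤₚ.⊖-≥ {m} ℕ.z≤n) ⟩
    m · 1#         ≈⟨ +-identityʳ _ ⟨
    m · 1# + 0#    ≈⟨ +-congˡ -0#≈0# ⟨
    m · 1# - 0#    ∎
  ⟦⊖⟧ zero (suc n) = sym (+-identityˡ _)
  ⟦⊖⟧ (suc m) (suc n) = begin
    ⟦ suc m ℤ.⊖ suc n ⟧ℤ             ≡⟨ ≡.cong ⟦_⟧ℤ (ℤₚ.[1+m]⊖[1+n]≡m⊖n m n) ⟩
    ⟦ m ℤ.⊖ n ⟧ℤ                     ≈⟨ ⟦⊖⟧ m n ⟩
    m · 1# - n · 1#                  ≈⟨ cancel-1+ _ _ ⟨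
    (1# + m · 1#) - (1# + n · 1#)    ≈⟨ +-cong (1+× m 1#) (-‿cong (1+× n 1#)) ⟨
    suc m · 1# - suc n · 1#          ∎

  ⟦+⟧ : ∀ i j → ⟦ i ℤ.+ j ⟧ℤ ≈ ⟦ i ⟧ℤ + ⟦ j ⟧ℤ
  ⟦+⟧ (+ m)    (+ n)    = ×-homo-+ 1# m n
  ⟦+⟧ (+ m)    -[1+ n ] = ⟦⊖⟧ m (suc n)
  ⟦+⟧ -[1+ m ] (+ n)    = trans (⟦⊖⟧ n (suc m)) (+-comm _ _)
  ⟦+⟧ -[1+ m ] -[1+ n ] = begin
    - (suc (suc (m ℕ.+ n)) · 1#)        ≡⟨ ≡.cong (λ k → - (k · 1#)) (ℕₚ.+-suc (suc m) n) ⟨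
    - ((suc m ℕ.+ suc n) · 1#)          ≈⟨ -‿cong (×-homo-+ 1# (suc m) (suc n)) ⟩
    - (suc m · 1# + suc n · 1#)         ≈⟨ ⁻¹-∙-comm _ _ ⟨
    - (suc m · 1#) - suc n · 1#         ∎

  ⟦*⟧+ : ∀ m j → ⟦ + m ℤ.* j ⟧ℤ ≈ m · 1# * ⟦ j ⟧ℤ
  ⟦*⟧+ m (+ n) = begin
    ⟦ + m ℤ.* + n ⟧ℤ  ≡⟨ ≡.cong ⟦_⟧ℤ (ℤₚ.pos-* m n) ⟨
    (m ℕ.* n) · 1#    ≈⟨ ×1-homo-* m n ⟩
    m · 1# * n · 1#   ∎
  ⟦*⟧+ m -[1+ n ] = begin
    ⟦ + m ℤ.* -[1+ n ] ⟧ℤ       ≡⟨ ≡.cong ⟦_⟧ℤ (ℤₚ.neg-distribʳ-* (+ m) (+ suc n)) ⟨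
    ⟦ ℤ.- (+ m ℤ.* + suc n) ⟧ℤ  ≈⟨ ⟦-⟧ (+ m ℤ.* + suc n) ⟩
    - ⟦ + m ℤ.* + suc n ⟧ℤ      ≈⟨ -‿cong (⟦*⟧+ m (+ suc n)) ⟩
    - (m · 1# * suc n · 1#)     ≈⟨ -‿distribʳ-* _ _ ⟩
    m · 1# * ⟦ -[1+ n ] ⟧ℤ      ∎

  ⟦*⟧ : ∀ i j → ⟦ i ℤ.* j ⟧ℤ ≈ ⟦ i ⟧ℤ * ⟦ j ⟧ℤ
  ⟦*⟧ (+ m)    j = ⟦*⟧+ m j
  ⟦*⟧ -[1+ m ] j = begin
    ⟦ -[1+ m ] ℤ.* j ⟧ℤ         ≡⟨ ≡.cong ⟦_⟧ℤ (ℤₚ.neg-distribˡ-* (+ suc m) j) ⟨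
    ⟦ ℤ.- (+ suc m ℤ.* j) ⟧ℤ    ≈⟨ ⟦-⟧ (+ suc m ℤ.* j) ⟩
    - ⟦ + suc m ℤ.* j ⟧ℤ        ≈⟨ -‿cong (⟦*⟧+ (suc m) j) ⟩
    - (suc m · 1# * ⟦ j ⟧ℤ)     ≈⟨ -‿distribˡ-* _ _ ⟩
    ⟦ -[1+ m ] ⟧ℤ * ⟦ j ⟧ℤ      ∎

-- The coefficients are integers because their equality is decidable, while that of the ring need
-- not be. One solver thus serves fields, polynomials and towers.
module Solve (R : CommutativeRing 0ℓ 0ℓ) where
  open IntegerMultiples R
  private
    morphism : CommutativeRing.rawRing ℤₚ.+-*-commutativeRing -Raw-AlmostCommutative⟶ fromCommutativeRing R
    morphism = record
      { ⟦_⟧    = ⟦_⟧ℤ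
      ; +-homo = ⟦+⟧
      ; *-homo = ⟦*⟧
      ; -‿homo = ⟦-⟧
      ; 0-homo = CommutativeRing.refl R
      ; 1-homo = CommutativeRing.refl R
      }
    dec : ∀ i j → _
    dec i j with i ℤ.≟ j
    ... | yes eq = just (CommutativeRing.reflexive R (≡.cong ⟦_⟧ℤ eq))
    ... | no _   = nothing
  open RingSolver (CommutativeRing.rawRing ℤₚ.+-*-commutativeRing) (fromCommutativeRing R) morphism dec public
    using (solve; con; _:=_; _:+_; _:*_; _:-_; :-_)

-- Used for the integers modulo p and for polynomials modulo xᵖ. The carrier is kept and only the
-- equality changes, so an element of R is its own residue class.
module Quotient (R : CommutativeRing 0ℓ 0ℓ) (a : CommutativeRing.Carrier R) where
  open CommutativeRing R
  open Solve R
  open import Relation.Binary.Reasoning.Setoid setoid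

  infix 4 _~_
  record _~_ (x y : Carrier) : Set where
    constructor _by_
    field
      factor   : Carrier
      equation : x ≈ y + a * factor

  lift : ∀ {x y} → x ≈ y → x ~ y
  lift {x} {y} e = 0# by trans e (solve 2 (λ y a → y := y :+ a :* con (+ 0)) refl y a)

  ~-refl : ∀ {x} → x ~ x
  ~-refl = lift refl

  ~-sym : ∀ {x y} → x ~ y → y ~ x
  ~-sym {x} {y} (r by e) = (- r) by (begin
    y                      ≈⟨ solve 3 (λ y a r → y := y :+ a :* r :+ a :* (:- r)) refl y a r ⟩
    y + a * r + a * (- r)  ≈⟨ +-congʳ e ⟨
    x + a * (- r)          ∎)

  ~-trans : ∀ {x y z} → x ~ y → y ~ z → x ~ z
  ~-trans {x} {y} {z} (r by e) (s by f) = (s + r) by (begin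
    x                  ≈⟨ e ⟩
    y + a * r          ≈⟨ +-congʳ f ⟩
    z + a * s + a * r  ≈⟨ solve 4 (λ z a s r → z :+ a :* s :+ a :* r := z :+ a :* (s :+ r)) refl z a s r ⟩
    z + a * (s + r)    ∎)

  ~-+ : ∀ {x y u v} → x ~ y → u ~ v → x + u ~ y + v
  ~-+ {x} {y} {u} {v} (r by e) (s by f) = (r + s) by trans (+-cong e f)
    (solve 5 (λ y v a r s → (y :+ a :* r) :+ (v :+ a :* s) := y :+ v :+ a :* (r :+ s)) refl y v a r s)

  ~-* : ∀ {x y u v} → x ~ y → u ~ v → x * u ~ y * v
  ~-* {x} {y} {u} {v} (r by e) (s by f) = (r * v + y * s + a * r * s) by trans (*-cong e f)
    (solve 5 (λ y v a r s → (y :+ a :* r) :* (v :+ a :* s) :=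
       y :* v :+ a :* (r :* v :+ y :* s :+ a :* r :* s)) refl y v a r s)

  ~-neg : ∀ {x y} → x ~ y → - x ~ - y
  ~-neg {x} {y} (r by e) = (- r) by trans (-‿cong e)
    (solve 3 (λ y a r → :- (y :+ a :* r) := :- y :+ a :* (:- r)) refl y a r)

  quotient : CommutativeRing 0ℓ 0ℓ
  quotient = record
    { Carrier = Carrier ; _≈_ = _~_ ; _+_ = _+_ ; _*_ = _*_ ; -_ = -_ ; 0# = 0# ; 1# = 1#
    ; isCommutativeRing = record
      { isRing = record
        { +-isAbelianGroup = record
          { isGroup = record
            { isMonoid = record
              { isSemigroup = record
                { isMagma = record
                  { isEquivalence = record { refl = ~-refl ; sym = ~-sym ; trans = ~-trans }
                  ; ∙-cong = ~-+ }
                ; assoc = λ x y z → lift (+-assoc x y z) }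
              ; identity = (λ x → lift (+-identityˡ x)) , (λ x → lift (+-identityʳ x)) }
            ; inverse = (λ x → lift (-‿inverseˡ x)) , (λ x → lift (-‿inverseʳ x))
            ; ⁻¹-cong = ~-neg }
          ; comm = λ x y → lift (+-comm x y) }
        ; *-cong = ~-*
        ; *-assoc = λ x y z → lift (*-assoc x y z)
        ; *-identity = (λ x → lift (*-identityˡ x)) , (λ x → lift (*-identityʳ x))
        ; distrib = (λ x y z → lift (distribˡ x y z)) , (λ x y z → lift (distribʳ x y z)) }
      ; *-comm = λ x y → lift (*-comm x y) }
    }

-- R[g] / (g² - κ).
module Quadratic (R : CommutativeRing 0ℓ 0ℓ) (κ : CommutativeRing.Carrier R) where
  open CommutativeRing R
  open Solve R

  infix 4 _≈₂_
  _≈₂_ : Carrier × Carrier → Carrier × Carrier → Set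
  (a , b) ≈₂ (c , d) = a ≈ c × b ≈ d

  _+₂_ _*₂_ : Carrier × Carrier → Carrier × Carrier → Carrier × Carrier
  (a , b) +₂ (c , d) = a + c , b + d
  (a , b) *₂ (c , d) = a * c + κ * (b * d) , a * d + b * c

  quadratic : CommutativeRing 0ℓ 0ℓ
  quadratic = record
    { Carrier = Carrier × Carrier ; _≈_ = _≈₂_ ; _+_ = _+₂_ ; _*_ = _*₂_
    ; -_ = λ (a , b) → - a , - b ; 0# = 0# , 0# ; 1# = 1# , 0#
    ; isCommutativeRing = record
      { isRing = record
        { +-isAbelianGroup = record
          { isGroup = record
            { isMonoid = record
              { isSemigroup = record
                { isMagma = record
                  { isEquivalence = record
                    { refl = refl , refl
                    ; sym = λ (e , f) → sym e , sym f
                    ; trans = λ (e , f) (e′ , f′) → trans e e′ , trans f f′ }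
                  ; ∙-cong = λ (e , f) (e′ , f′) → +-cong e e′ , +-cong f f′ }
                ; assoc = λ _ _ _ → +-assoc _ _ _ , +-assoc _ _ _ }
              ; identity = (λ _ → +-identityˡ _ , +-identityˡ _) , (λ _ → +-identityʳ _ , +-identityʳ _) }
            ; inverse = (λ _ → -‿inverseˡ _ , -‿inverseˡ _) , (λ _ → -‿inverseʳ _ , -‿inverseʳ _)
            ; ⁻¹-cong = λ (e , f) → -‿cong e , -‿cong f }
          ; comm = λ _ _ → +-comm _ _ , +-comm _ _ }
        ; *-cong = λ (e , f) (e′ , f′) →
            +-cong (*-cong e e′) (*-congˡ (*-cong f f′)) , +-cong (*-cong e f′) (*-cong f e′)
        ; *-assoc = λ (a , b) (c , d) (u , v) →
            solve 7 (λ a b c d u v k →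
              (a :* c :+ k :* (b :* d)) :* u :+ k :* ((a :* d :+ b :* c) :* v) :=
              a :* (c :* u :+ k :* (d :* v)) :+ k :* (b :* (c :* v :+ d :* u))) refl a b c d u v κ ,
            solve 7 (λ a b c d u v k →
              (a :* c :+ k :* (b :* d)) :* v :+ (a :* d :+ b :* c) :* u :=
              a :* (c :* v :+ d :* u) :+ b :* (c :* u :+ k :* (d :* v))) refl a b c d u v κ
        ; *-identity =
            (λ (a , b) →
              solve 3 (λ a b k → con (+ 1) :* a :+ k :* (con (+ 0) :* b) := a) refl a b κ ,
              solve 2 (λ a b → con (+ 1) :* b :+ con (+ 0) :* a := b) refl a b) ,
            (λ (a , b) →
              solve 3 (λ a b k → a :* con (+ 1) :+ k :* (b :* con (+ 0)) := a) refl a b κ ,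
              solve 2 (λ a b → a :* con (+ 0) :+ b :* con (+ 1) := b) refl a b)
        ; distrib =
            (λ (a , b) (c , d) (u , v) →
              solve 7 (λ a b c d u v k → a :* (c :+ u) :+ k :* (b :* (d :+ v)) :=
                (a :* c :+ k :* (b :* d)) :+ (a :* u :+ k :* (b :* v))) refl a b c d u v κ ,
              solve 6 (λ a b c d u v → a :* (d :+ v) :+ b :* (c :+ u) :=
                (a :* d :+ b :* c) :+ (a :* v :+ b :* u)) refl a b c d u v) ,
            (λ (a , b) (c , d) (u , v) →
              solve 7 (λ a b c d u v k → (c :+ u) :* a :+ k :* ((d :+ v) :* b) :=
                (c :* a :+ k :* (d :* b)) :+ (u :* a :+ k :* (v :* b))) refl a b c d u v κ ,
              solve 6 (λ a b c d u v → (c :+ u) :* b :+ (d :+ v) :* a :=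
                (c :* b :+ d :* a) :+ (u :* b :+ v :* a)) refl a b c d u v) }
      ; *-comm = λ (a , b) (c , d) →
          solve 5 (λ a b c d k → a :* c :+ k :* (b :* d) := c :* a :+ k :* (d :* b)) refl a b c d κ ,
          solve 4 (λ a b c d → a :* d :+ b :* c := c :* b :+ d :* a) refl a b c d }
    }

-- Polynomials

module Polynomials (F : CommutativeRing 0ℓ 0ℓ) where
  open CommutativeRing F
  open Solve F
  open IntegerMultiples F using (_·_; 1+×)
  open import Relation.Binary.Reasoning.Setoid setoid

  Poly : Set
  Poly = List Carrier

  coef : Poly → ℕ → Carrier
  coef []      n       = 0#
  coef (a ∷ p) zero    = a
  coef (a ∷ p) (suc n) = coef p n

  infix 4 _≈ₚ_
  -- Lists that differ by trailing zeros are the same polynomial, hence the comparison by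
  -- coefficients. A record, unlike a function type, lets p and q be inferred.
  record _≈ₚ_ (p q : Poly) : Set where
    constructor coefwise
    field at : ∀ n → coef p n ≈ coef q n
  open _≈ₚ_ public

  infixl 6 _+ₚ_
  infixl 7 _*ₚ_

  opaque

    _+ₚ_ : Poly → Poly → Poly
    []      +ₚ q       = q
    (a ∷ p) +ₚ []      = a ∷ p
    (a ∷ p) +ₚ (b ∷ q) = a + b ∷ p +ₚ q

    -ₚ_ : Poly → Poly
    -ₚ_ = map (-_)

    scale : Carrier → Poly → Poly
    scale c = map (c *_)

    _*ₚ_ : Poly → Poly → Poly
    []      *ₚ q = []
    (a ∷ p) *ₚ q = scale a q +ₚ (0# ∷ p *ₚ q)

    coef-+ : ∀ p q n → coef (p +ₚ q) n ≈ coef p n + coef q n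
    coef-+ []      q       n       = sym (+-identityˡ _)
    coef-+ (a ∷ p) []      n       = sym (+-identityʳ _)
    coef-+ (a ∷ p) (b ∷ q) zero    = refl
    coef-+ (a ∷ p) (b ∷ q) (suc n) = coef-+ p q n

    coef-neg : ∀ p n → coef (-ₚ p) n ≈ - coef p n
    coef-neg []      n       = solve 0 (con (+ 0) := :- con (+ 0)) refl
    coef-neg (a ∷ p) zero    = refl
    coef-neg (a ∷ p) (suc n) = coef-neg p n

    coef-scale : ∀ c p n → coef (scale c p) n ≈ c * coef p n
    coef-scale c []      n       = sym (zeroʳ c)
    coef-scale c (a ∷ p) zero    = refl
    coef-scale c (a ∷ p) (suc n) = coef-scale c p n

    ≈ₚ-refl : ∀ {p} → p ≈ₚ p
    ≈ₚ-refl = coefwise λ n → refl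

    ≈ₚ-sym : ∀ {p q} → p ≈ₚ q → q ≈ₚ p
    ≈ₚ-sym e = coefwise λ n → sym (at e n)

    ≈ₚ-trans : ∀ {p q r} → p ≈ₚ q → q ≈ₚ r → p ≈ₚ r
    ≈ₚ-trans e f = coefwise λ n → trans (at e n) (at f n)

    +ₚ-cong : ∀ {p q r s} → p ≈ₚ q → r ≈ₚ s → p +ₚ r ≈ₚ q +ₚ s
    +ₚ-cong {p} {q} {r} {s} e f = coefwise λ n →
      trans (coef-+ p r n) (trans (+-cong (at e n) (at f n)) (sym (coef-+ q s n)))

    neg-cong : ∀ {p q} → p ≈ₚ q → -ₚ p ≈ₚ -ₚ q
    neg-cong {p} {q} e = coefwise λ n → trans (coef-neg p n) (trans (-‿cong (at e n)) (sym (coef-neg q n)))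

    +ₚ-assoc : ∀ p q r → (p +ₚ q) +ₚ r ≈ₚ p +ₚ (q +ₚ r)
    +ₚ-assoc p q r = coefwise λ n → begin
      coef ((p +ₚ q) +ₚ r) n            ≈⟨ trans (coef-+ (p +ₚ q) r n) (+-congʳ (coef-+ p q n)) ⟩
      coef p n + coef q n + coef r n    ≈⟨ +-assoc _ _ _ ⟩
      coef p n + (coef q n + coef r n)  ≈⟨ trans (coef-+ p (q +ₚ r) n) (+-congˡ (coef-+ q r n)) ⟨
      coef (p +ₚ (q +ₚ r)) n            ∎

    +ₚ-comm : ∀ p q → p +ₚ q ≈ₚ q +ₚ p
    +ₚ-comm p q = coefwise λ n → trans (coef-+ p q n) (trans (+-comm _ _) (sym (coef-+ q p n)))

    +ₚ-identityˡ : ∀ p → [] +ₚ p ≈ₚ p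
    +ₚ-identityˡ p = ≈ₚ-refl

    +ₚ-identityʳ : ∀ p → p +ₚ [] ≈ₚ p
    +ₚ-identityʳ p = +ₚ-comm p []

    neg-inverseˡ : ∀ p → -ₚ p +ₚ p ≈ₚ []
    neg-inverseˡ p = coefwise λ n →
      trans (coef-+ (-ₚ p) p n) (trans (+-congʳ (coef-neg p n)) (-‿inverseˡ _))

    scale-cong : ∀ {a b p q} → a ≈ b → p ≈ₚ q → scale a p ≈ₚ scale b q
    scale-cong {a} {b} {p} {q} e f = coefwise λ n →
      trans (coef-scale a p n) (trans (*-cong e (at f n)) (sym (coef-scale b q n)))

    scale-+ : ∀ a p q → scale a (p +ₚ q) ≈ₚ scale a p +ₚ scale a q
    scale-+ a p q = coefwise λ n → begin
      coef (scale a (p +ₚ q)) n      ≈⟨ trans (coef-scale a (p +ₚ q) n) (*-congˡ (coef-+ p q n)) ⟩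
      a * (coef p n + coef q n)      ≈⟨ distribˡ _ _ _ ⟩
      a * coef p n + a * coef q n    ≈⟨ trans (coef-+ (scale a p) (scale a q) n)
                                           (+-cong (coef-scale a p n) (coef-scale a q n)) ⟨
      coef (scale a p +ₚ scale a q) n ∎

    scale-scale : ∀ a b p → scale a (scale b p) ≈ₚ scale (a * b) p
    scale-scale a b p = coefwise λ n →
      trans (coef-scale a (scale b p) n) (trans (*-congˡ (coef-scale b p n))
        (trans (sym (*-assoc a b _)) (sym (coef-scale (a * b) p n))))

    scale-zero : ∀ p → scale 0# p ≈ₚ []
    scale-zero p = coefwise λ n → trans (coef-scale 0# p n) (zeroˡ _)

    scale-one : ∀ p → scale 1# p ≈ₚ p
    scale-one p = coefwise λ n → trans (coef-scale 1# p n) (*-identityˡ _)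

    ∷-cong : ∀ {a b p q} → a ≈ b → p ≈ₚ q → a ∷ p ≈ₚ b ∷ q
    ∷-cong e f = coefwise λ { zero → e ; (suc n) → at f n }

    ∷-zero : 0# ∷ [] ≈ₚ []
    ∷-zero = coefwise λ { zero → refl ; (suc n) → refl }

    shift-+ : ∀ p q → 0# ∷ (p +ₚ q) ≈ₚ (0# ∷ p) +ₚ (0# ∷ q)
    shift-+ p q = ∷-cong (sym (+-identityˡ 0#)) ≈ₚ-refl

    +ₚ-interchange : ∀ p q r s → (p +ₚ q) +ₚ (r +ₚ s) ≈ₚ (p +ₚ r) +ₚ (q +ₚ s)
    +ₚ-interchange p q r s = coefwise λ n → begin
      coef ((p +ₚ q) +ₚ (r +ₚ s)) n
        ≈⟨ trans (coef-+ (p +ₚ q) (r +ₚ s) n) (+-cong (coef-+ p q n) (coef-+ r s n)) ⟩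
      (coef p n + coef q n) + (coef r n + coef s n)
        ≈⟨ solve 4 (λ a b c d → (a :+ b) :+ (c :+ d) := (a :+ c) :+ (b :+ d)) refl _ _ _ _ ⟩
      (coef p n + coef r n) + (coef q n + coef s n)
        ≈⟨ trans (coef-+ (p +ₚ r) (q +ₚ s) n) (+-cong (coef-+ p r n) (coef-+ q s n)) ⟨
      coef ((p +ₚ r) +ₚ (q +ₚ s)) n ∎

    *ₚ-congˡ : ∀ p {q r} → q ≈ₚ r → p *ₚ q ≈ₚ p *ₚ r
    *ₚ-congˡ []      e = ≈ₚ-refl
    *ₚ-congˡ (a ∷ p) e = +ₚ-cong (scale-cong refl e) (∷-cong refl (*ₚ-congˡ p e))

    *ₚ-zeroʳ : ∀ p → p *ₚ [] ≈ₚ []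
    *ₚ-zeroʳ []      = ≈ₚ-refl
    *ₚ-zeroʳ (a ∷ p) = ≈ₚ-trans (∷-cong refl (*ₚ-zeroʳ p)) ∷-zero

    *ₚ-distribˡ : ∀ p q r → p *ₚ (q +ₚ r) ≈ₚ p *ₚ q +ₚ p *ₚ r
    *ₚ-distribˡ []      q r = ≈ₚ-refl
    *ₚ-distribˡ (a ∷ p) q r = ≈ₚ-trans
      (+ₚ-cong (scale-+ a q r) (≈ₚ-trans (∷-cong refl (*ₚ-distribˡ p q r)) (shift-+ (p *ₚ q) (p *ₚ r))))
      (+ₚ-interchange (scale a q) (scale a r) _ _)

    scale-* : ∀ a p q → scale a p *ₚ q ≈ₚ scale a (p *ₚ q)
    scale-* a []      q = ≈ₚ-refl
    scale-* a (b ∷ p) q = ≈ₚ-trans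
      (+ₚ-cong (≈ₚ-sym (scale-scale a b q)) (∷-cong (sym (zeroʳ a)) (scale-* a p q)))
      (≈ₚ-sym (scale-+ a (scale b q) _))

    shift-* : ∀ p q → (0# ∷ p) *ₚ q ≈ₚ 0# ∷ p *ₚ q
    shift-* p q = +ₚ-cong (scale-zero q) ≈ₚ-refl

    *ₚ-∷ : ∀ p b q → p *ₚ (b ∷ q) ≈ₚ scale b p +ₚ (0# ∷ p *ₚ q)
    *ₚ-∷ []      b q = ≈ₚ-sym ∷-zero
    *ₚ-∷ (a ∷ p) b q = ∷-cong (+-congʳ (*-comm a b))
      (≈ₚ-trans (+ₚ-cong ≈ₚ-refl (*ₚ-∷ p b q))
      (≈ₚ-trans (≈ₚ-sym (+ₚ-assoc (scale a q) (scale b p) _))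
      (≈ₚ-trans (+ₚ-cong (+ₚ-comm (scale a q) (scale b p)) ≈ₚ-refl)
                (+ₚ-assoc (scale b p) (scale a q) _))))

    *ₚ-comm : ∀ p q → p *ₚ q ≈ₚ q *ₚ p
    *ₚ-comm []      q = ≈ₚ-sym (*ₚ-zeroʳ q)
    *ₚ-comm (a ∷ p) q = ≈ₚ-trans (+ₚ-cong ≈ₚ-refl (∷-cong refl (*ₚ-comm p q))) (≈ₚ-sym (*ₚ-∷ q a p))

    *ₚ-cong : ∀ {p q r s} → p ≈ₚ q → r ≈ₚ s → p *ₚ r ≈ₚ q *ₚ s
    *ₚ-cong {p} {q} {r} {s} e f = ≈ₚ-trans (*ₚ-congˡ p f)
      (≈ₚ-trans (*ₚ-comm p s) (≈ₚ-trans (*ₚ-congˡ s e) (*ₚ-comm s q)))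

    *ₚ-distribʳ : ∀ p q r → (q +ₚ r) *ₚ p ≈ₚ q *ₚ p +ₚ r *ₚ p
    *ₚ-distribʳ p q r = ≈ₚ-trans (*ₚ-comm (q +ₚ r) p)
      (≈ₚ-trans (*ₚ-distribˡ p q r) (+ₚ-cong (*ₚ-comm p q) (*ₚ-comm p r)))

    *ₚ-assoc : ∀ p q r → (p *ₚ q) *ₚ r ≈ₚ p *ₚ (q *ₚ r)
    *ₚ-assoc []      q r = ≈ₚ-refl
    *ₚ-assoc (a ∷ p) q r = ≈ₚ-trans (*ₚ-distribʳ r (scale a q) _)
      (+ₚ-cong (scale-* a q r) (≈ₚ-trans (shift-* (p *ₚ q) r) (∷-cong refl (*ₚ-assoc p q r))))

    *ₚ-identityˡ : ∀ p → (1# ∷ []) *ₚ p ≈ₚ p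
    *ₚ-identityˡ p = ≈ₚ-trans (+ₚ-cong (scale-one p) ∷-zero) (+ₚ-identityʳ p)

  polyRing : CommutativeRing 0ℓ 0ℓ
  polyRing = record
    { Carrier = Poly ; _≈_ = _≈ₚ_ ; _+_ = _+ₚ_ ; _*_ = _*ₚ_ ; -_ = -ₚ_ ; 0# = [] ; 1# = 1# ∷ []
    ; isCommutativeRing = record
      { isRing = record
        { +-isAbelianGroup = record
          { isGroup = record
            { isMonoid = record
              { isSemigroup = record
                { isMagma = record
                  { isEquivalence = record { refl = ≈ₚ-refl ; sym = ≈ₚ-sym ; trans = ≈ₚ-trans }
                  ; ∙-cong = +ₚ-cong }
                ; assoc = +ₚ-assoc }
              ; identity = +ₚ-identityˡ , +ₚ-identityʳ }
            ; inverse = neg-inverseˡ , λ p → ≈ₚ-trans (+ₚ-comm p (-ₚ p)) (neg-inverseˡ p)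
            ; ⁻¹-cong = neg-cong }
          ; comm = +ₚ-comm }
        ; *-cong = *ₚ-cong
        ; *-assoc = *ₚ-assoc
        ; *-identity = *ₚ-identityˡ , λ p → ≈ₚ-trans (*ₚ-comm p _) (*ₚ-identityˡ p)
        ; distrib = *ₚ-distribˡ , *ₚ-distribʳ }
      ; *-comm = *ₚ-comm }
    }

  module P = CommutativeRing polyRing
  module PS = Solve polyRing
  open import Algebra.Properties.Semiring.Exp P.semiring public using () renaming (_^_ to _^ₚ_)

  const : Carrier → Poly
  const c = c ∷ []

  X+ : Carrier → Poly
  X+ t = t ∷ 1# ∷ []

  opaque
    unfolding _+ₚ_

    const-+ : ∀ a b → const (a + b) ≈ₚ const a +ₚ const b
    const-+ a b = ≈ₚ-refl

    const-* : ∀ c p → const c *ₚ p ≈ₚ scale c p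
    const-* c p = ≈ₚ-trans (+ₚ-cong ≈ₚ-refl ∷-zero) (+ₚ-identityʳ _)

    coef-X+* : ∀ t p n → coef (X+ t *ₚ p) (suc n) ≈ t * coef p (suc n) + coef p n
    coef-X+* t p n = trans (coef-+ (scale t p) _ (suc n))
      (+-cong (coef-scale t p (suc n)) (at (*ₚ-identityˡ p) n))

  zero-tail : ∀ {a p} → a ∷ p ≈ₚ [] → p ≈ₚ []
  zero-tail e = coefwise λ n → at e (suc n)

  eval : Carrier → Poly → Carrier
  eval l []      = 0#
  eval l (a ∷ p) = a + l * eval l p

  eval-zero : ∀ l p → p ≈ₚ [] → eval l p ≈ 0#
  eval-zero l []      e = refl
  eval-zero l (a ∷ p) e = begin
    a + l * eval l p  ≈⟨ +-cong (at e 0) (*-congˡ (eval-zero l p (zero-tail e))) ⟩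
    0# + l * 0#       ≈⟨ solve 1 (λ l → con (+ 0) :+ l :* con (+ 0) := con (+ 0)) refl l ⟩
    0#                ∎

  eval-cong : ∀ l {p q} → p ≈ₚ q → eval l p ≈ eval l q
  eval-cong l {[]}    {q}     e = sym (eval-zero l q (≈ₚ-sym e))
  eval-cong l {a ∷ p} {[]}    e = eval-zero l (a ∷ p) e
  eval-cong l {a ∷ p} {b ∷ q} e =
    +-cong (at e 0) (*-congˡ (eval-cong l {p} {q} (coefwise λ n → at e (suc n))))

  opaque
    unfolding _+ₚ_

    eval-+ : ∀ l p q → eval l (p +ₚ q) ≈ eval l p + eval l q
    eval-+ l []      q       = sym (+-identityˡ _)
    eval-+ l (a ∷ p) []      = sym (+-identityʳ _)
    eval-+ l (a ∷ p) (b ∷ q) = trans (+-congˡ (*-congˡ (eval-+ l p q)))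
      (solve 5 (λ a b l p q → a :+ b :+ l :* (p :+ q) := a :+ l :* p :+ (b :+ l :* q)) refl a b l _ _)

    eval-scale : ∀ l c p → eval l (scale c p) ≈ c * eval l p
    eval-scale l c []      = sym (zeroʳ c)
    eval-scale l c (a ∷ p) = trans (+-congˡ (*-congˡ (eval-scale l c p)))
      (solve 4 (λ c a l p → c :* a :+ l :* (c :* p) := c :* (a :+ l :* p)) refl c a l _)

    eval-* : ∀ l p q → eval l (p *ₚ q) ≈ eval l p * eval l q
    eval-* l []      q = sym (zeroˡ _)
    eval-* l (a ∷ p) q = begin
      eval l (scale a q +ₚ (0# ∷ p *ₚ q))              ≈⟨ eval-+ l (scale a q) _ ⟩
      eval l (scale a q) + (0# + l * eval l (p *ₚ q))  ≈⟨ +-cong (eval-scale l a q) (+-congˡ (*-congˡ (eval-* l p q))) ⟩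
      a * eval l q + (0# + l * (eval l p * eval l q))
        ≈⟨ solve 4 (λ a q l p → a :* q :+ (con (+ 0) :+ l :* (p :* q)) := (a :+ l :* p) :* q) refl a _ l _ ⟩
      (a + l * eval l p) * eval l q                    ∎

    eval-const : ∀ l c → eval l (const c) ≈ c
    eval-const l c = solve 2 (λ l c → c :+ l :* con (+ 0) := c) refl l c

    eval-X+ : ∀ l t → eval l (X+ t) ≈ l + t
    eval-X+ l t = solve 2 (λ l t → t :+ l :* (con (+ 1) :+ l :* con (+ 0)) := l :+ t) refl l t

  open import Algebra.Properties.Semiring.Exp semiring public using (_^_)

  eval-^ : ∀ l p n → eval l (p ^ₚ n) ≈ eval l p ^ n
  eval-^ l p zero    = eval-const l 1#
  eval-^ l p (suc n) = trans (eval-* l p (p ^ₚ n)) (*-congˡ (eval-^ l p n))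

  -- The Leibniz rule for a + x p: no integer multiples appear until `coef-D` computes them.
  D : Poly → Poly
  D []      = []
  D (a ∷ p) = p +ₚ (0# ∷ D p)

  opaque
    unfolding _+ₚ_

    coef-D : ∀ p n → coef (D p) n ≈ (suc n · 1#) * coef p (suc n)
    coef-D []      n       = sym (zeroʳ _)
    coef-D (a ∷ p) zero    = trans (coef-+ p (0# ∷ D p) 0)
      (solve 1 (λ c → c :+ con (+ 0) := con (+ 1) :* c) refl _)
    coef-D (a ∷ p) (suc n) = begin
      coef (p +ₚ (0# ∷ D p)) (suc n)                           ≈⟨ coef-+ p (0# ∷ D p) (suc n) ⟩
      coef p (suc n) + coef (D p) n                            ≈⟨ +-congˡ (coef-D p n) ⟩
      coef p (suc n) + (suc n · 1#) * coef p (suc n)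
        ≈⟨ solve 2 (λ c k → c :+ k :* c := (con (+ 1) :+ k) :* c) refl _ _ ⟩
      (1# + suc n · 1#) * coef p (suc n)                       ≈⟨ *-congʳ (1+× (suc n) 1#) ⟨
      (suc (suc n) · 1#) * coef p (suc n)                      ∎

  D-cong : ∀ {p q} → p ≈ₚ q → D p ≈ₚ D q
  D-cong {p} {q} e = coefwise λ n →
    trans (coef-D p n) (trans (*-congˡ (at e (suc n))) (sym (coef-D q n)))

  opaque
    unfolding _+ₚ_

    D-+ : ∀ p q → D (p +ₚ q) ≈ₚ D p +ₚ D q
    D-+ p q = coefwise λ n → begin
      coef (D (p +ₚ q)) n      ≈⟨ trans (coef-D (p +ₚ q) n) (*-congˡ (coef-+ p q (suc n))) ⟩
      (suc n · 1#) * (coef p (suc n) + coef q (suc n))  ≈⟨ distribˡ _ _ _ ⟩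
      (suc n · 1#) * coef p (suc n) + (suc n · 1#) * coef q (suc n)
        ≈⟨ trans (coef-+ (D p) (D q) n) (+-cong (coef-D p n) (coef-D q n)) ⟨
      coef (D p +ₚ D q) n ∎

    D-scale : ∀ c p → D (scale c p) ≈ₚ scale c (D p)
    D-scale c p = coefwise λ n → begin
      coef (D (scale c p)) n               ≈⟨ trans (coef-D (scale c p) n) (*-congˡ (coef-scale c p (suc n))) ⟩
      (suc n · 1#) * (c * coef p (suc n))  ≈⟨ solve 3 (λ k c a → k :* (c :* a) := c :* (k :* a)) refl _ _ _ ⟩
      c * ((suc n · 1#) * coef p (suc n))  ≈⟨ trans (coef-scale c (D p) n) (*-congˡ (coef-D p n)) ⟨
      coef (scale c (D p)) n               ∎

    D-* : ∀ p q → D (p *ₚ q) ≈ₚ D p *ₚ q +ₚ p *ₚ D q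
    D-* []      q = ≈ₚ-refl
    D-* (a ∷ p) q = P.trans (D-+ (scale a q) (0# ∷ p *ₚ q))
      (P.trans (P.+-cong (D-scale a q) (P.+-congˡ {p *ₚ q} (∷-cong refl (D-* p q))))
      (P.trans (P.+-congˡ {scale a (D q)} (P.+-congˡ {p *ₚ q} (shift-+ (D p *ₚ q) (p *ₚ D q))))
      (P.trans (rearrange (scale a (D q)) (p *ₚ q) (0# ∷ D p *ₚ q) (0# ∷ p *ₚ D q))
               (P.+-congʳ (P.sym (P.trans (*ₚ-distribʳ q p (0# ∷ D p)) (P.+-congˡ {p *ₚ q} (shift-* (D p) q))))))))
      where
      rearrange : ∀ a b c d → a +ₚ (b +ₚ (c +ₚ d)) ≈ₚ (b +ₚ c) +ₚ (a +ₚ d)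
      rearrange = PS.solve 4 (λ a b c d → a PS.:+ (b PS.:+ (c PS.:+ d)) PS.:= (b PS.:+ c) PS.:+ (a PS.:+ d)) P.refl

    D-X+ : ∀ t → D (X+ t) ≈ₚ P.1#
    D-X+ t = coefwise λ { zero → +-identityʳ _ ; (suc zero) → refl ; (suc (suc n)) → refl }

  D-neg : ∀ p → D (-ₚ p) ≈ₚ -ₚ D p
  D-neg p = coefwise λ n → begin
    coef (D (-ₚ p)) n                  ≈⟨ trans (coef-D (-ₚ p) n) (*-congˡ (coef-neg p (suc n))) ⟩
    (suc n · 1#) * - coef p (suc n)    ≈⟨ solve 2 (λ k a → k :* (:- a) := :- (k :* a)) refl _ _ ⟩
    - ((suc n · 1#) * coef p (suc n))  ≈⟨ trans (coef-neg (D p) n) (-‿cong (coef-D p n)) ⟨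
    coef (-ₚ D p) n                    ∎

  D-X+^ : ∀ t n → D (X+ t ^ₚ suc n) ≈ₚ const (suc n · 1#) *ₚ X+ t ^ₚ n
  D-X+^ t zero    = P.trans (D-cong (P.*-identityʳ (X+ t))) (P.trans (D-X+ t) (P.sym (P.*-identityʳ (const 1#))))
  D-X+^ t (suc n) = P.trans (D-* (X+ t) (X+ t ^ₚ suc n))
    (P.trans (P.+-cong (P.*-congʳ (D-X+ t)) (P.*-congˡ {X+ t} (D-X+^ t n)))
    (P.trans (PS.solve 3 (λ x y k → PS.con (+ 1) PS.:* (x PS.:* y) PS.:+ x PS.:* (k PS.:* y)
                 PS.:= (PS.con (+ 1) PS.:+ k) PS.:* (x PS.:* y)) P.refl (X+ t) (X+ t ^ₚ n) (const (suc n · 1#)))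
             (P.*-congʳ (P.sym (P.trans (∷-cong (1+× (suc n) 1#) P.refl) (const-+ 1# (suc n · 1#)))))))

  -- Degree below n, expressed so that the zero polynomial is no exception and n counts the
  -- available coefficients.
  record Small (n : ℕ) (p : Poly) : Set where
    constructor small
    field beyond : ∀ i → n ℕ.≤ i → coef p i ≈ 0#
  open Small public

  Deg≤ : ℕ → Poly → Set
  Deg≤ n = Small (suc n)

  Small-cong : ∀ {n p q} → p ≈ₚ q → Small n p → Small n q
  Small-cong e s = small λ i n≤i → trans (sym (at e i)) (beyond s i n≤i)

  Small-mono : ∀ {m n p} → m ℕ.≤ n → Small m p → Small n p
  Small-mono m≤n s = small λ i n≤i → beyond s i (ℕₚ.≤-trans m≤n n≤i)

  Small-zero : ∀ {p} → Small 0 p → p ≈ₚ []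
  Small-zero s = coefwise λ n → beyond s n ℕ.z≤n

  Small-[] : ∀ {n} → Small n []
  Small-[] = small λ _ _ → refl

  opaque
    unfolding _+ₚ_

    Small-+ : ∀ {n p q} → Small n p → Small n q → Small n (p +ₚ q)
    Small-+ {n} {p} {q} s t = small λ i n≤i →
      trans (coef-+ p q i) (trans (+-cong (beyond s i n≤i) (beyond t i n≤i)) (+-identityˡ 0#))

    Small-neg : ∀ {n p} → Small n p → Small n (-ₚ p)
    Small-neg {n} {p} s = small λ i n≤i →
      trans (coef-neg p i) (trans (-‿cong (beyond s i n≤i)) (solve 0 (:- con (+ 0) := con (+ 0)) refl))

    Small-scale : ∀ {n p} c → Small n p → Small n (scale c p)
    Small-scale {n} {p} c s = small λ i n≤i →
      trans (coef-scale c p i) (trans (*-congˡ (beyond s i n≤i)) (zeroʳ c))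

  Small-∷ : ∀ {n p} a → Small n p → Small (suc n) (a ∷ p)
  Small-∷ {n} a s = small λ { zero () ; (suc i) (ℕ.s≤s n≤i) → beyond s i n≤i }

  Small-tail : ∀ {n a p} → Small (suc n) (a ∷ p) → Small n p
  Small-tail s = small λ i n≤i → beyond s (suc i) (ℕ.s≤s n≤i)

  opaque
    unfolding _+ₚ_

    Deg-* : ∀ {n m p q} → Deg≤ n p → Deg≤ m q → Deg≤ (n ℕ.+ m) (p *ₚ q)
    Deg-* {p = []} s t = Small-[]
    Deg-* {zero} {m} {a ∷ p} {q} s t = Small-+ (Small-scale a t)
      (Small-cong (P.sym (P.trans (∷-cong refl (P.*-congʳ {q} (Small-zero (Small-tail s)))) ∷-zero)) Small-[])
    Deg-* {suc n} {m} {a ∷ p} s t = Small-+ (Small-scale a (Small-mono (ℕ.s≤s (ℕₚ.m≤n+m m (suc n))) t))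
      (Small-∷ 0# (Deg-* (Small-tail s) t))

  Deg-const : ∀ c → Deg≤ 0 (const c)
  Deg-const c = Small-∷ c Small-[]

  Deg-X+ : ∀ t → Deg≤ 1 (X+ t)
  Deg-X+ t = Small-∷ t (Small-∷ 1# Small-[])

  Deg-X+^ : ∀ t n → Deg≤ n (X+ t ^ₚ n)
  Deg-X+^ t zero    = Deg-const 1#
  Deg-X+^ t (suc n) = Deg-* (Deg-X+ t) (Deg-X+^ t n)

  Small-D : ∀ {n p} → Small n p → Small n (D p)
  Small-D {n} {p} s = small λ i n≤i → trans (coef-D p i)
    (trans (*-congˡ (beyond s (suc i) (ℕₚ.≤-trans n≤i (ℕₚ.n≤1+n i)))) (zeroʳ _))

  -- Synthetic division by x - l: the Horner values of the tails are the coefficients of the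
  -- quotient.
  quot : Carrier → Poly → Poly
  quot l []      = []
  quot l (a ∷ p) = eval l p ∷ quot l p

  opaque
    unfolding _+ₚ_

    division : ∀ l p → p ≈ₚ X+ (- l) *ₚ quot l p +ₚ const (eval l p)
    division l []      = P.sym (P.trans (P.+-cong (P.zeroʳ (X+ (- l))) ∷-zero) P.refl)
    division l (a ∷ p) = coefwise λ where
      zero → solve 3 (λ a l e → a := (:- l :* e :+ con (+ 0)) :+ (a :+ l :* e)) refl a l (eval l p)
      (suc n) → begin
        coef p n                                                                   ≈⟨ at (division l p) n ⟩
        coef (X+ (- l) *ₚ quot l p +ₚ const (eval l p)) n                          ≈⟨ lemma n ⟩
        - l * coef (quot l (a ∷ p)) (suc n) + coef (quot l (a ∷ p)) n              ≈⟨ coef-X+* (- l) (quot l (a ∷ p)) n ⟨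
        coef (X+ (- l) *ₚ quot l (a ∷ p)) (suc n)                                  ≈⟨ +-identityʳ _ ⟨
        coef (X+ (- l) *ₚ quot l (a ∷ p)) (suc n) + 0#
          ≈⟨ coef-+ (X+ (- l) *ₚ quot l (a ∷ p)) (const (eval l (a ∷ p))) (suc n) ⟨
        coef (X+ (- l) *ₚ quot l (a ∷ p) +ₚ const (eval l (a ∷ p))) (suc n)        ∎
     where
      lemma : ∀ n → coef (X+ (- l) *ₚ quot l p +ₚ const (eval l p)) n ≈
                    - l * coef (quot l p) n + coef (eval l p ∷ quot l p) n
      lemma zero = trans (coef-+ (X+ (- l) *ₚ quot l p) (const (eval l p)) 0)
        (+-congʳ (trans (coef-+ (scale (- l) (quot l p)) _ 0)
          (trans (+-identityʳ _) (coef-scale (- l) (quot l p) 0))))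
      lemma (suc n) = trans (coef-+ (X+ (- l) *ₚ quot l p) (const (eval l p)) (suc n))
        (trans (+-identityʳ _) (coef-X+* (- l) (quot l p) n))

  root-factor : ∀ l p → eval l p ≈ 0# → p ≈ₚ X+ (- l) *ₚ quot l p
  root-factor l p e = P.trans (division l p)
    (P.trans (P.+-congˡ {X+ (- l) *ₚ quot l p} (P.trans (∷-cong e P.refl) ∷-zero)) (P.+-identityʳ _))

  coef-length : ∀ p i → length p ℕ.≤ i → coef p i ≈ 0#
  coef-length []      i       _          = refl
  coef-length (a ∷ p) (suc i) (ℕ.s≤s l≤i) = coef-length p i l≤i

  -- From the top coefficient down: coefficient i of p is determined by coefficient i + 1 of p and of (x + t) p.
  Small-cancel : ∀ {n} t p → Small (suc n) (X+ t *ₚ p) → Small n p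
  Small-cancel {n} t p s = small λ i n≤i → go (length p) i n≤i (ℕₚ.m≤n+m (length p) i)
    where
    go : ∀ k i → n ℕ.≤ i → length p ℕ.≤ i ℕ.+ k → coef p i ≈ 0#
    go zero    i n≤i l≤ = coef-length p i (≡.subst (length p ℕ.≤_) (ℕₚ.+-identityʳ i) l≤)
    go (suc k) i n≤i l≤ = begin
      coef p i                           ≈⟨ +-identityˡ _ ⟨
      0# + coef p i                      ≈⟨ +-congʳ (zeroʳ t) ⟨
      t * 0# + coef p i                  ≈⟨ +-congʳ (*-congˡ (go k (suc i) (ℕₚ.m≤n⇒m≤1+n n≤i)
                                               (≡.subst (length p ℕ.≤_) (ℕₚ.+-suc i k) l≤))) ⟨
      t * coef p (suc i) + coef p i      ≈⟨ coef-X+* t p i ⟨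
      coef (X+ t *ₚ p) (suc i)           ≈⟨ beyond s (suc i) (ℕ.s≤s n≤i) ⟩
      0#                                 ∎

  X+-cancel-zero : ∀ t p → X+ t *ₚ p ≈ₚ [] → p ≈ₚ []
  X+-cancel-zero t p e = Small-zero (Small-cancel t p (small λ i _ → at e i))

  X+-cancel : ∀ t p q → X+ t *ₚ p ≈ₚ X+ t *ₚ q → p ≈ₚ q
  X+-cancel t p q e = P.trans
    (PS.solve 2 (λ p q → p PS.:= (p PS.:- q) PS.:+ q) P.refl p q)
    (P.trans (P.+-congʳ (X+-cancel-zero t (p +ₚ -ₚ q) (P.trans
      (PS.solve 3 (λ x p q → x PS.:* (p PS.:- q) PS.:= x PS.:* p PS.:- x PS.:* q) P.refl (X+ t) p q)
      (P.trans (P.+-congʳ e) (P.-‿inverseʳ (X+ t *ₚ q)))))) (P.+-identityˡ q))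

-- Towers of quadratic extensions

-- R ⊂ R[√κ₀] ⊂ R[√κ₀, √κ₁] ⊂ …
module Towers (R : CommutativeRing 0ℓ 0ℓ) (κ : ℕ → CommutativeRing.Carrier R) where
  private module R = CommutativeRing R

  Tower : ℕ → CommutativeRing 0ℓ 0ℓ
  ι : ∀ k → R.Carrier → CommutativeRing.Carrier (Tower k)

  Tower zero    = R
  Tower (suc k) = Quadratic.quadratic (Tower k) (ι k (κ k))

  ι zero    r = r
  ι (suc k) r = ι k r , CommutativeRing.0# (Tower k)

  module T k = CommutativeRing (Tower k)
  module TS k = Solve (Tower k)

  ι-cong : ∀ k {r s} → r R.≈ s → T._≈_ k (ι k r) (ι k s)
  ι-cong zero    e = e
  ι-cong (suc k) e = ι-cong k e , T.refl k

  ι-* : ∀ k r s → T._≈_ k (ι k (r R.* s)) (T._*_ k (ι k r) (ι k s))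
  ι-* zero    r s = R.refl
  ι-* (suc k) r s =
    T.trans k (ι-* k r s)
      (solve 3 (λ r s κ → r :* s := r :* s :+ κ :* (con (+ 0) :* con (+ 0))) (T.refl k) (ι k r) (ι k s) (ι k (κ k))) ,
    solve 2 (λ r s → con (+ 0) := r :* con (+ 0) :+ con (+ 0) :* s) (T.refl k) (ι k r) (ι k s)
    where open TS k

  scaleT : ∀ k → R.Carrier → T.Carrier k → T.Carrier k
  scaleT zero    r a       = r R.* a
  scaleT (suc k) r (a , b) = scaleT k r a , scaleT k r b

  ι-scale : ∀ k r a → T._≈_ k (T._*_ k (ι k r) a) (scaleT k r a)
  ι-scale zero    r a       = R.refl
  ι-scale (suc k) r (a , b) =
    T.trans k
      (solve 4 (λ r a b κ → r :* a :+ κ :* (con (+ 0) :* b) := r :* a) (T.refl k) (ι k r) a b (ι k (κ k)))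
      (ι-scale k r a) ,
    T.trans k
      (solve 3 (λ r a b → r :* b :+ con (+ 0) :* a := r :* b) (T.refl k) (ι k r) a b)
      (ι-scale k r b)
    where open TS k

  -- An element of the base ring acts on each coordinate separately, so it remains a
  -- non-zero-divisor in the tower.
  ι-cancel : ∀ k r → (∀ x → r R.* x R.≈ R.0# → x R.≈ R.0#) →
             ∀ a → T._≈_ k (T._*_ k (ι k r) a) (T.0# k) → T._≈_ k a (T.0# k)
  ι-cancel k r cancel a e = go k a (T.trans k (T.sym k (ι-scale k r a)) e)
    where
    go : ∀ k a → T._≈_ k (scaleT k r a) (T.0# k) → T._≈_ k a (T.0# k)
    go zero    a       e       = cancel a e
    go (suc k) (a , b) (e , f) = go k a e , go k b f

  norm : ∀ k → T.Carrier (suc k) → T.Carrier k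
  norm k (a , b) = T._-_ k (T._*_ k a a) (T._*_ k (ι k (κ k)) (T._*_ k b b))

  -- After evaluation at a point some κ i may become squares, and then the tower has zero divisors.
  -- The absence of nilpotents is what survives, and it suffices for the descent.
  Reduced : CommutativeRing 0ℓ 0ℓ → Set
  Reduced S = ∀ x → x * x ≈ 0# → x ≈ 0#
    where open CommutativeRing S

  TwoTorsionFree : CommutativeRing 0ℓ 0ℓ → Set
  TwoTorsionFree S = ∀ x → x + x ≈ 0# → x ≈ 0#
    where open CommutativeRing S

  two-torsion-free : TwoTorsionFree R → ∀ k → TwoTorsionFree (Tower k)
  two-torsion-free tf zero    x       e       = tf x e
  two-torsion-free tf (suc k) (a , b) (e , f) = two-torsion-free tf k a e , two-torsion-free tf k b f

  -- From (a + b√K)² = 0 come 2ab = 0 and a² + K b² = 0, hence a⁴ = a² (a² + K b²) - K (ab)² = 0.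
  -- Reducedness one level below gives a = 0, and then K b² = 0 gives b = 0.
  reduced : TwoTorsionFree R → Reduced R → ∀ k →
            (∀ i → i ℕ.< k → ∀ x → κ i R.* x R.≈ R.0# → x R.≈ R.0#) → Reduced (Tower k)
  reduced tf red zero    cancel x e = red x e
  reduced tf red (suc k) cancel (a , b) (e , f) = a≈0 , b≈0
    where
    open T k
    open TS k
    IH : Reduced (Tower k)
    IH = reduced tf red k (λ i i<k → cancel i (ℕₚ.m<n⇒m<1+n i<k))
    K = ι k (κ k)
    ab≈0 : a * b ≈ 0#
    ab≈0 = two-torsion-free tf k (a * b) (trans (+-congˡ (*-comm a b)) f)
    a⁴≈0 : (a * a) * (a * a) ≈ 0#
    a⁴≈0 = begin
      (a * a) * (a * a)
        ≈⟨ solve 3 (λ a b K → (a :* a) :* (a :* a) :=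
             a :* a :* (a :* a :+ K :* (b :* b)) :- K :* (a :* b) :* (a :* b)) refl a b K ⟩
      a * a * (a * a + K * (b * b)) - K * (a * b) * (a * b)
        ≈⟨ +-cong (*-congˡ e) (-‿cong (*-congˡ ab≈0)) ⟩
      a * a * 0# - K * (a * b) * 0#
        ≈⟨ solve 2 (λ x y → x :* con (+ 0) :- y :* con (+ 0) := con (+ 0)) refl _ _ ⟩
      0# ∎
      where open import Relation.Binary.Reasoning.Setoid setoid
    a≈0 : a ≈ 0#
    a≈0 = IH a (IH (a * a) a⁴≈0)
    b≈0 : b ≈ 0#
    b≈0 = IH b (ι-cancel k (κ k) (cancel k ℕₚ.≤-refl) (b * b) (begin
      K * (b * b)              ≈⟨ solve 2 (λ x y → x := con (+ 0) :* y :+ x) refl _ a ⟩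
      0# * a + K * (b * b)     ≈⟨ +-congʳ (*-congʳ a≈0) ⟨
      a * a + K * (b * b)      ≈⟨ e ⟩
      0#                       ∎))
      where open import Relation.Binary.Reasoning.Setoid setoid

-- Acts on all 2ᵏ coordinates; φ will be the evaluation of polynomials at a point.
module BaseChange (R S : CommutativeRing 0ℓ 0ℓ)
  (φ : CommutativeRing.Carrier R → CommutativeRing.Carrier S)
  (κ : ℕ → CommutativeRing.Carrier R)
  (φ-cong : ∀ {x y} → CommutativeRing._≈_ R x y → CommutativeRing._≈_ S (φ x) (φ y))
  (φ-+ : ∀ x y → CommutativeRing._≈_ S (φ (CommutativeRing._+_ R x y)) (CommutativeRing._+_ S (φ x) (φ y)))
  (φ-* : ∀ x y → CommutativeRing._≈_ S (φ (CommutativeRing._*_ R x y)) (CommutativeRing._*_ S (φ x) (φ y)))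
  (φ-0 : CommutativeRing._≈_ S (φ (CommutativeRing.0# R)) (CommutativeRing.0# S))
  where
  module A = Towers R κ
  module B = Towers S (λ i → φ (κ i))

  baseChange : ∀ k → A.T.Carrier k → B.T.Carrier k
  baseChange zero    a       = φ a
  baseChange (suc k) (a , b) = baseChange k a , baseChange k b

  baseChange-cong : ∀ k {a b} → A.T._≈_ k a b → B.T._≈_ k (baseChange k a) (baseChange k b)
  baseChange-cong zero    e       = φ-cong e
  baseChange-cong (suc k) (e , f) = baseChange-cong k e , baseChange-cong k f

  baseChange-0 : ∀ k → B.T._≈_ k (baseChange k (A.T.0# k)) (B.T.0# k)
  baseChange-0 zero    = φ-0
  baseChange-0 (suc k) = baseChange-0 k , baseChange-0 k

  baseChange-+ : ∀ k a b → B.T._≈_ k (baseChange k (A.T._+_ k a b)) (B.T._+_ k (baseChange k a) (baseChange k b))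
  baseChange-+ zero    a       b       = φ-+ a b
  baseChange-+ (suc k) (a , b) (c , d) = baseChange-+ k a c , baseChange-+ k b d

  baseChange-ι : ∀ k r → B.T._≈_ k (baseChange k (A.ι k r)) (B.ι k (φ r))
  baseChange-ι zero    r = CommutativeRing.refl S
  baseChange-ι (suc k) r = baseChange-ι k r , baseChange-0 k

  baseChange-* : ∀ k a b → B.T._≈_ k (baseChange k (A.T._*_ k a b)) (B.T._*_ k (baseChange k a) (baseChange k b))
  baseChange-* zero    a       b       = φ-* a b
  baseChange-* (suc k) (a , b) (c , d) =
    trans (baseChange-+ k _ _) (+-cong (baseChange-* k a c)
      (trans (baseChange-* k _ _) (*-cong (baseChange-ι k (κ k)) (baseChange-* k b d)))) ,
    trans (baseChange-+ k _ _) (+-cong (baseChange-* k a d) (baseChange-* k b c))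
    where open B.T k

-- The ring homomorphism from the tower over R that sends the square root of κ i to γ i.
module Adjunction (R S : CommutativeRing 0ℓ 0ℓ)
  (φ : CommutativeRing.Carrier R → CommutativeRing.Carrier S)
  (κ : ℕ → CommutativeRing.Carrier R)
  (γ : ℕ → CommutativeRing.Carrier S)
  (φ-cong : ∀ {x y} → CommutativeRing._≈_ R x y → CommutativeRing._≈_ S (φ x) (φ y))
  (φ-+ : ∀ x y → CommutativeRing._≈_ S (φ (CommutativeRing._+_ R x y)) (CommutativeRing._+_ S (φ x) (φ y)))
  (φ-* : ∀ x y → CommutativeRing._≈_ S (φ (CommutativeRing._*_ R x y)) (CommutativeRing._*_ S (φ x) (φ y)))
  (φ-0 : CommutativeRing._≈_ S (φ (CommutativeRing.0# R)) (CommutativeRing.0# S))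
  (φ-neg : ∀ x → CommutativeRing._≈_ S (φ (CommutativeRing.-_ R x)) (CommutativeRing.-_ S (φ x)))
  where
  open Towers R κ
  open CommutativeRing S
  open Solve S
  open import Relation.Binary.Reasoning.Setoid setoid

  realise : ∀ k → T.Carrier k → Carrier
  realise zero    a       = φ a
  realise (suc k) (a , b) = realise k a + realise k b * γ k

  realise-cong : ∀ k {a b} → T._≈_ k a b → realise k a ≈ realise k b
  realise-cong zero    e       = φ-cong e
  realise-cong (suc k) (e , f) = +-cong (realise-cong k e) (*-congʳ (realise-cong k f))

  realise-0 : ∀ k → realise k (T.0# k) ≈ 0#
  realise-0 zero    = φ-0
  realise-0 (suc k) = trans (+-cong (realise-0 k) (*-congʳ (realise-0 k)))
    (solve 1 (λ g → con (+ 0) :+ con (+ 0) :* g := con (+ 0)) refl (γ k))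

  realise-+ : ∀ k a b → realise k (T._+_ k a b) ≈ realise k a + realise k b
  realise-+ zero    a       b       = φ-+ a b
  realise-+ (suc k) (a , b) (c , d) = trans (+-cong (realise-+ k a c) (*-congʳ (realise-+ k b d)))
    (solve 5 (λ a b c d g → (a :+ c) :+ (b :+ d) :* g := (a :+ b :* g) :+ (c :+ d :* g)) refl _ _ _ _ (γ k))

  realise-neg : ∀ k a → realise k (T.-_ k a) ≈ - realise k a
  realise-neg zero    a       = φ-neg a
  realise-neg (suc k) (a , b) = trans (+-cong (realise-neg k a) (*-congʳ (realise-neg k b)))
    (solve 3 (λ a b g → :- a :+ (:- b) :* g := :- (a :+ b :* g)) refl _ _ (γ k))

  realise-ι : ∀ k r → realise k (ι k r) ≈ φ r
  realise-ι zero    r = refl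
  realise-ι (suc k) r = trans (+-cong (realise-ι k r) (*-congʳ (realise-0 k)))
    (solve 2 (λ r g → r :+ con (+ 0) :* g := r) refl _ (γ k))

  -- In the application this relation holds modulo xᵖ only. What rests on it is therefore kept apart
  -- from the additive facts, which are applied to polynomials themselves.
  module Multiplicative (γ² : ∀ i → γ i * γ i ≈ φ (κ i)) where

    realise-* : ∀ k a b → realise k (T._*_ k a b) ≈ realise k a * realise k b
    realise-* zero    a       b       = φ-* a b
    realise-* (suc k) (a , b) (c , d) = begin
      realise k (T._+_ k (T._*_ k a c) (T._*_ k (ι k (κ k)) (T._*_ k b d)))
        + realise k (T._+_ k (T._*_ k a d) (T._*_ k b c)) * γ k
        ≈⟨ +-cong (trans (realise-+ k _ _) (+-cong (realise-* k a c)
              (trans (realise-* k _ _) (*-cong (trans (realise-ι k (κ k)) (sym (γ² k))) (realise-* k b d)))))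
            (*-congʳ (trans (realise-+ k _ _) (+-cong (realise-* k a d) (realise-* k b c)))) ⟩
      (a′ * c′ + (γ k * γ k) * (b′ * d′)) + (a′ * d′ + b′ * c′) * γ k
        ≈⟨ solve 5 (λ a b c d g → (a :* c :+ (g :* g) :* (b :* d)) :+ (a :* d :+ b :* c) :* g :=
             (a :+ b :* g) :* (c :+ d :* g)) refl a′ b′ c′ d′ (γ k) ⟩
      (a′ + b′ * γ k) * (c′ + d′ * γ k) ∎
      where
      a′ = realise k a
      b′ = realise k b
      c′ = realise k c
      d′ = realise k d

    -- The norm is the product of a + b γ with its conjugate a - b γ.
    realise-norm : ∀ k α → realise (suc k) α ≈ 0# → realise k (norm k α) ≈ 0#
    realise-norm k (a , b) e = begin
      realise k (norm k (a , b))
        ≈⟨ trans (realise-+ k _ _) (+-cong (realise-* k a a) (trans (realise-neg k _) (-‿cong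
             (trans (realise-* k _ _) (*-cong (trans (realise-ι k (κ k)) (sym (γ² k))) (realise-* k b b)))))) ⟩
      a′ * a′ - (γ k * γ k) * (b′ * b′)
        ≈⟨ solve 3 (λ a b g → a :* a :- (g :* g) :* (b :* b) := (a :+ b :* g) :* (a :- b :* g)) refl a′ b′ (γ k) ⟩
      (a′ + b′ * γ k) * (a′ - b′ * γ k)  ≈⟨ *-congʳ e ⟩
      0# * (a′ - b′ * γ k)               ≈⟨ zeroˡ _ ⟩
      0#                                 ∎
      where
      a′ = realise k a
      b′ = realise k b

-- Norms in a tower of quadratic extensions of F[x]

module NormsOverPolynomials (F : CommutativeRing 0ℓ 0ℓ)
  (domain : ∀ x y → CommutativeRing._≈_ F (CommutativeRing._*_ F x y) (CommutativeRing.0# F) →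
    CommutativeRing._≈_ F x (CommutativeRing.0# F) ⊎ CommutativeRing._≈_ F y (CommutativeRing.0# F))
  (2≉0 : ¬ CommutativeRing._≈_ F (CommutativeRing._+_ F (CommutativeRing.1# F) (CommutativeRing.1# F)) (CommutativeRing.0# F))
  (c t : ℕ → CommutativeRing.Carrier F)
  where
  open CommutativeRing F
  open Polynomials F
  open Solve F

  cancel-nonzero : ∀ {x} → ¬ x ≈ 0# → ∀ y → x * y ≈ 0# → y ≈ 0#
  cancel-nonzero {x} x≉0 y e = [ (λ x≈0 → ⊥-elim (x≉0 x≈0)) , id ]′ (domain x y e)

  κ : ℕ → Poly
  κ i = const (c i) *ₚ X+ (t i)

  open Towers polyRing κ public

  Deg-κ : ∀ i → Deg≤ 1 (κ i)
  Deg-κ i = Deg-* (Deg-const (c i)) (Deg-X+ (t i))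

  SmallT : ∀ k → ℕ → T.Carrier k → Set
  SmallT zero    n a       = Small n a
  SmallT (suc k) n (a , b) = SmallT k n a × SmallT k n b

  SmallT-cong : ∀ k {n a b} → T._≈_ k a b → SmallT k n a → SmallT k n b
  SmallT-cong zero    e       s       = Small-cong e s
  SmallT-cong (suc k) (e , f) (s , u) = SmallT-cong k e s , SmallT-cong k f u

  SmallT-mono : ∀ k {m n a} → m ℕ.≤ n → SmallT k m a → SmallT k n a
  SmallT-mono zero    m≤n s       = Small-mono m≤n s
  SmallT-mono (suc k) m≤n (s , u) = SmallT-mono k m≤n s , SmallT-mono k m≤n u

  SmallT-+ : ∀ k {n a b} → SmallT k n a → SmallT k n b → SmallT k n (T._+_ k a b)
  SmallT-+ zero    s       u         = Small-+ s u
  SmallT-+ (suc k) (s , u) (s′ , u′) = SmallT-+ k s s′ , SmallT-+ k u u′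

  SmallT-neg : ∀ k {n a} → SmallT k n a → SmallT k n (T.-_ k a)
  SmallT-neg zero    s       = Small-neg s
  SmallT-neg (suc k) (s , u) = SmallT-neg k s , SmallT-neg k u

  SmallT-zero : ∀ k {a} → SmallT k 0 a → T._≈_ k a (T.0# k)
  SmallT-zero zero    s       = Small-zero s
  SmallT-zero (suc k) (s , u) = SmallT-zero k s , SmallT-zero k u

  Deg-scaleT : ∀ k {m n r a} → Deg≤ m r → SmallT k (suc n) a → SmallT k (suc (m ℕ.+ n)) (scaleT k r a)
  Deg-scaleT zero    d s       = Deg-* d s
  Deg-scaleT (suc k) d (s , u) = Deg-scaleT k d s , Deg-scaleT k d u

  Deg-ι* : ∀ k {m n r a} → Deg≤ m r → SmallT k (suc n) a → SmallT k (suc (m ℕ.+ n)) (T._*_ k (ι k r) a)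
  Deg-ι* k {r = r} {a} d s = SmallT-cong k (T.sym k (ι-scale k r a)) (Deg-scaleT k d s)

  -- Each level of the tower brings in one factor κ i, of degree 1; this is the extra k.
  Deg-T* : ∀ k {m n a b} → SmallT k (suc m) a → SmallT k (suc n) b → SmallT k (suc (k ℕ.+ (m ℕ.+ n))) (T._*_ k a b)
  Deg-T* zero    s u = Deg-* s u
  Deg-T* (suc k) {m} {n} (s , u) (s′ , u′) =
    SmallT-+ k (SmallT-mono k (ℕₚ.n≤1+n _) (Deg-T* k s s′)) (Deg-ι* k (Deg-κ k) (Deg-T* k u u′)) ,
    SmallT-mono k (ℕₚ.n≤1+n _) (SmallT-+ k (Deg-T* k s u′) (Deg-T* k u s′))

  Deg-norm : ∀ k {n α} → SmallT (suc k) (suc n) α → SmallT k (suc (suc (k ℕ.+ (n ℕ.+ n)))) (norm k α)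
  Deg-norm k (s , u) = SmallT-+ k (SmallT-mono k (ℕₚ.n≤1+n _) (Deg-T* k s s))
    (SmallT-neg k (Deg-ι* k (Deg-κ k) (Deg-T* k u u)))

  -- The κ i are then nonzero linear polynomials with distinct roots, hence independent modulo
  -- squares, so that each square root is really new.
  Admissible : ℕ → Set
  Admissible k = ∀ i → i ℕ.< k → ¬ c i ≈ 0# × (∀ j → j ℕ.< i → ¬ t j ≈ t i)

  -- Setting x = - t k makes the k-th generator vanish, while the tower below stays reduced.
  module AtRoot (k : ℕ) (adm : Admissible (suc k)) where
    private
      l = - t k
      module BC = BaseChange polyRing F (eval l) κ (eval-cong l) (eval-+ l) (eval-* l) refl
      module B = BC.B
      c≉0 = proj₁ (adm k ℕₚ.≤-refl)

    open BC using (baseChange)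

    eval-κ : ∀ i → eval l (κ i) ≈ c i * (t i - t k)
    eval-κ i = trans (eval-* l (const (c i)) (X+ (t i)))
      (*-cong (eval-const l (c i)) (trans (eval-X+ l (t i)) (+-comm _ _)))

    reduced-below : B.Reduced (B.Tower k)
    reduced-below = B.reduced
      (λ x e → cancel-nonzero 2≉0 x (trans (solve 1 (λ x → (con (+ 1) :+ con (+ 1)) :* x := x :+ x) refl x) e))
      (λ x e → [ id , id ]′ (domain x x e)) k
      (λ i i<k → cancel-nonzero (λ e → [ proj₁ (adm i (ℕₚ.m<n⇒m<1+n i<k)) ,
         (λ d → proj₂ (adm k ℕₚ.≤-refl) i i<k (trans (solve 2 (λ a b → a := (a :- b) :+ b) refl (t i) (t k))
                  (trans (+-congʳ d) (+-identityˡ _)))) ]′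
         (domain (c i) (t i - t k) (trans (sym (eval-κ i)) e))))

    π : Poly
    π = X+ (t k)

    -- Vanishing at - t k makes every coordinate divisible by π. The degree drops by one, which is
    -- the measure for `descent`.
    divide : ∀ k′ {n} (a : T.Carrier k′) → B.T._≈_ k′ (baseChange k′ a) (B.T.0# k′) → SmallT k′ (suc n) a →
             Σ (T.Carrier k′) λ q → T._≈_ k′ a (T._*_ k′ (ι k′ π) q) × SmallT k′ n q
    divide zero {n} a e s = quot l a , fac ,
      Small-cancel (t k) (quot l a) (Small-cong fac s)
      where
      fac : a ≈ₚ π *ₚ quot l a
      fac = P.trans (root-factor l a e) (P.*-congʳ (∷-cong (solve 1 (λ t → :- :- t := t) refl (t k)) P.refl))
    divide (suc k′) (a , b) (e , f) (s , u)
      with q , ea , sq ← divide k′ a e s | r , eb , sr ← divide k′ b f u =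
      (q , r) ,
      T.trans (suc k′) (ea , eb) (T.trans (suc k′) (ι-scale k′ π q , ι-scale k′ π r)
        (T.sym (suc k′) (ι-scale (suc k′) π (q , r)))) ,
      (sq , sr)

    π-vanishes : ∀ y → B.T._≈_ k (baseChange k (T._*_ k (ι k π) y)) (B.T.0# k)
    π-vanishes y =
      B.T.trans k (BC.baseChange-* k (ι k π) y)
      (B.T.trans k (B.T.*-congʳ k (B.T.trans k (BC.baseChange-ι k π)
         (B.ι-cong k (trans (eval-X+ l (t k)) (-‿inverseˡ (t k))))))
      (B.T.trans k (B.ι-scale k 0# (baseChange k y)) (scale0 k (baseChange k y))))
      where
      scale0 : ∀ k y → B.T._≈_ k (B.scaleT k 0# y) (B.T.0# k)
      scale0 zero    y       = zeroˡ y
      scale0 (suc k) (y , z) = scale0 k y , scale0 k z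

    -- As in the irrationality proof for a square root: a² = cπ b² vanishes modulo π, so a = π q by
    -- reducedness there; then π q² = c b² forces b = π r, and q, r satisfy the same equation with
    -- smaller degrees.
    descent : ∀ n (a b : T.Carrier k) → SmallT k n a → SmallT k n b →
              T._≈_ k (T._*_ k a a) (T._*_ k (ι k (κ k)) (T._*_ k b b)) →
              T._≈_ k a (T.0# k) × T._≈_ k b (T.0# k)
    descent zero    a b s u e = SmallT-zero k s , SmallT-zero k u
    descent (suc n) a b s u e = finish (divide k a a̅≈0 s)
      where
      open T k
        renaming (_≈_ to _≈ᵀ_; _*_ to _*ᵀ_; 0# to 0ᵀ; refl to reflᵀ; sym to symᵀ; trans to transᵀ;
                  _+_ to _+ᵀ_; _-_ to _-ᵀ_; *-cong to *ᵀ-cong; *-congˡ to *ᵀ-congˡ; *-congʳ to *ᵀ-congʳ;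
                  zeroʳ to zeroʳᵀ; +-congʳ to +ᵀ-congʳ; -‿inverseʳ to -ᵀ-inverseʳ; +-identityˡ to +ᵀ-identityˡ)
        using ()
      open import Relation.Binary.Reasoning.Setoid (T.setoid k)
      module K = TS k
      C Π : T.Carrier k
      C = ι k (const (c k))
      Π = ι k π

      e′ : a *ᵀ a ≈ᵀ C *ᵀ Π *ᵀ (b *ᵀ b)
      e′ = transᵀ e (*ᵀ-congʳ (ι-* k (const (c k)) π))

      vanishes : ∀ x y → x *ᵀ x ≈ᵀ Π *ᵀ y → B.T._≈_ k (baseChange k x) (B.T.0# k)
      vanishes x y q = reduced-below (baseChange k x)
        (B.T.trans k (B.T.sym k (BC.baseChange-* k x x)) (B.T.trans k (BC.baseChange-cong k q) (π-vanishes y)))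

      a̅≈0 : B.T._≈_ k (baseChange k a) (B.T.0# k)
      a̅≈0 = vanishes a (C *ᵀ (b *ᵀ b))
        (transᵀ e′ (K.solve 3 (λ c π b → c K.:* π K.:* b K.:= π K.:* (c K.:* b)) reflᵀ C Π (b *ᵀ b)))

      cancel : ∀ r → (∀ x → r *ₚ x ≈ₚ [] → x ≈ₚ []) → ∀ x y → ι k r *ᵀ x ≈ᵀ ι k r *ᵀ y → x ≈ᵀ y
      cancel r cr x y q = begin
        x              ≈⟨ K.solve 2 (λ x y → x K.:= (x K.:- y) K.:+ y) reflᵀ x y ⟩
        (x -ᵀ y) +ᵀ y  ≈⟨ +ᵀ-congʳ (ι-cancel k r cr (x -ᵀ y) (begin
          ι k r *ᵀ (x -ᵀ y)          ≈⟨ K.solve 3 (λ r x y → r K.:* (x K.:- y) K.:= r K.:* x K.:- r K.:* y) reflᵀ (ι k r) x y ⟩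
          ι k r *ᵀ x -ᵀ ι k r *ᵀ y   ≈⟨ +ᵀ-congʳ q ⟩
          ι k r *ᵀ y -ᵀ ι k r *ᵀ y   ≈⟨ -ᵀ-inverseʳ _ ⟩
          0ᵀ                         ∎)) ⟩
        0ᵀ +ᵀ y        ≈⟨ +ᵀ-identityˡ y ⟩
        y              ∎

      cancel-π : ∀ x y → Π *ᵀ x ≈ᵀ Π *ᵀ y → x ≈ᵀ y
      cancel-π = cancel π (λ x → X+-cancel-zero (t k) x)

      finish : (Σ (T.Carrier k) λ q → a ≈ᵀ Π *ᵀ q × SmallT k n q) → a ≈ᵀ 0ᵀ × b ≈ᵀ 0ᵀ
      finish (q , ea , sq) = finish′ (divide k b b̅≈0 u)
        where
        f : Π *ᵀ (q *ᵀ q) ≈ᵀ C *ᵀ (b *ᵀ b)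
        f = cancel-π _ _ (begin
          Π *ᵀ (Π *ᵀ (q *ᵀ q))    ≈⟨ K.solve 2 (λ π q → π K.:* (π K.:* (q K.:* q)) K.:= (π K.:* q) K.:* (π K.:* q)) reflᵀ Π q ⟩
          (Π *ᵀ q) *ᵀ (Π *ᵀ q)    ≈⟨ *ᵀ-cong ea ea ⟨
          a *ᵀ a                  ≈⟨ e′ ⟩
          C *ᵀ Π *ᵀ (b *ᵀ b)      ≈⟨ K.solve 3 (λ c π b → c K.:* π K.:* b K.:= π K.:* (c K.:* b)) reflᵀ C Π (b *ᵀ b) ⟩
          Π *ᵀ (C *ᵀ (b *ᵀ b))    ∎)
        b̅≈0 : B.T._≈_ k (baseChange k b) (B.T.0# k)
        b̅≈0 = reduced-below (baseChange k b) b̅²≈0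
          where
          Cb² : B.T._≈_ k (B.T._*_ k (B.ι k (c k)) (B.T._*_ k (baseChange k b) (baseChange k b))) (B.T.0# k)
          Cb² = B.T.trans k (B.T.*-cong k
                  (B.T.trans k (B.ι-cong k (sym (eval-const l (c k)))) (B.T.sym k (BC.baseChange-ι k (const (c k)))))
                  (B.T.sym k (BC.baseChange-* k b b)))
            (B.T.trans k (B.T.sym k (BC.baseChange-* k C (b *ᵀ b)))
            (B.T.trans k (BC.baseChange-cong k (symᵀ f)) (π-vanishes (q *ᵀ q))))
          b̅²≈0 : B.T._≈_ k (B.T._*_ k (baseChange k b) (baseChange k b)) (B.T.0# k)
          b̅²≈0 = B.ι-cancel k (c k) (cancel-nonzero c≉0) _ Cb²

        finish′ : (Σ (T.Carrier k) λ r → b ≈ᵀ Π *ᵀ r × SmallT k n r) → a ≈ᵀ 0ᵀ × b ≈ᵀ 0ᵀ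
        finish′ (r , eb , sr) = transᵀ ea (transᵀ (*ᵀ-congˡ (proj₁ IH)) (zeroʳᵀ Π)) ,
                                transᵀ eb (transᵀ (*ᵀ-congˡ (proj₂ IH)) (zeroʳᵀ Π))
          where
          IH : q ≈ᵀ 0ᵀ × r ≈ᵀ 0ᵀ
          IH = descent n q r sq sr (cancel-π _ _ (begin
            Π *ᵀ (q *ᵀ q)                  ≈⟨ f ⟩
            C *ᵀ (b *ᵀ b)                  ≈⟨ *ᵀ-congˡ (*ᵀ-cong eb eb) ⟩
            C *ᵀ ((Π *ᵀ r) *ᵀ (Π *ᵀ r))
              ≈⟨ K.solve 3 (λ c π r → c K.:* ((π K.:* r) K.:* (π K.:* r)) K.:= π K.:* ((c K.:* π) K.:* (r K.:* r))) reflᵀ C Π r ⟩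
            Π *ᵀ ((C *ᵀ Π) *ᵀ (r *ᵀ r))    ≈⟨ *ᵀ-congˡ (*ᵀ-congʳ (ι-* k (const (c k)) π)) ⟨
            Π *ᵀ (ι k (κ k) *ᵀ (r *ᵀ r))   ∎))

    norm-zero : ∀ {n} α → SmallT (suc k) n α → T._≈_ k (norm k α) (T.0# k) → T._≈_ (suc k) α (T.0# (suc k))
    norm-zero {n} (a , b) (s , u) e = descent n a b s u (begin
      T._*_ k a a                    ≈⟨ K.solve 2 (λ x y → x K.:= (x K.:- y) K.:+ y) (T.refl k) _ _ ⟩
      T._+_ k (norm k (a , b)) y     ≈⟨ T.+-congʳ k e ⟩
      T._+_ k (T.0# k) y             ≈⟨ T.+-identityˡ k y ⟩
      y                              ∎)
      where
      module K = TS k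
      y = T._*_ k (ι k (κ k)) (T._*_ k b b)
      open import Relation.Binary.Reasoning.Setoid (T.setoid k)

  fullNorm : ∀ k → T.Carrier k → Poly
  fullNorm zero    α = α
  fullNorm (suc k) α = fullNorm k (norm k α)

  fullNorm-zero : ∀ k → Admissible k → ∀ {n} α → SmallT k (suc n) α → fullNorm k α ≈ₚ [] → T._≈_ k α (T.0# k)
  fullNorm-zero zero    adm α s e = e
  fullNorm-zero (suc k) adm α s e = AtRoot.norm-zero k adm α s
    (fullNorm-zero k (λ i i<k → adm i (ℕₚ.m<n⇒m<1+n i<k)) (norm k α) (Deg-norm k s) e)

  fullNormDegree : ℕ → ℕ → ℕ
  fullNormDegree zero    n = n
  fullNormDegree (suc k) n = fullNormDegree k (suc (k ℕ.+ (n ℕ.+ n)))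

  -- The sum of degree, height and 2 at most doubles with each norm: (2n + k + 1) + k + 2 ≤ 2 (n +
  -- (k + 1) + 2).
  fullNormDegree-bound : ∀ k n → fullNormDegree k n ℕ.+ 2 ℕ.≤ 2 ℕ.^ k ℕ.* (n ℕ.+ k ℕ.+ 2)
  fullNormDegree-bound zero    n = ℕₚ.≤-reflexive (lemma n)
    where
    lemma : ∀ n → n ℕ.+ 2 ≡ 1 ℕ.* (n ℕ.+ 0 ℕ.+ 2)
    lemma = solve-∀
  fullNormDegree-bound (suc k) n = ℕₚ.≤-trans (fullNormDegree-bound k (suc (k ℕ.+ (n ℕ.+ n))))
    (ℕₚ.≤-trans (ℕₚ.*-monoʳ-≤ (2 ℕ.^ k) (≡.subst (suc (k ℕ.+ (n ℕ.+ n)) ℕ.+ k ℕ.+ 2 ℕ.≤_) (lemma₁ n k) (ℕₚ.m≤m+n _ 3)))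
      (ℕₚ.≤-reflexive (lemma₂ (2 ℕ.^ k) (n ℕ.+ suc k ℕ.+ 2))))
    where
    lemma₁ : ∀ n k → suc (k ℕ.+ (n ℕ.+ n)) ℕ.+ k ℕ.+ 2 ℕ.+ 3 ≡ 2 ℕ.* (n ℕ.+ suc k ℕ.+ 2)
    lemma₁ = solve-∀
    lemma₂ : ∀ x y → x ℕ.* (2 ℕ.* y) ≡ 2 ℕ.* x ℕ.* y
    lemma₂ = solve-∀

  Deg-fullNorm : ∀ k {n α} → SmallT k (suc n) α → Deg≤ (fullNormDegree k n) (fullNorm k α)
  Deg-fullNorm zero    s = s
  Deg-fullNorm (suc k) s = Deg-fullNorm k (Deg-norm k s)

-- Counting and pairwise coprime numbers

module PairwiseCoprimeNumbers where
  open import Data.Nat using (_+_; _*_; _^_; _∸_; _≤_; _<_; _≤?_; _≟_; z≤n; s≤s; NonZero; >-nonZero; nonTrivial⇒n>1)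

  allPairs-from-unique : ∀ {A : Set} {P : A → Set} {R : A → A → Set} → (∀ x y → P x → P y → x ≢ y → R x y) →
                         ∀ {xs} → Unique xs → All P xs → AllPairs R xs
  allPairs-from-unique f []       []         = []
  allPairs-from-unique f (x∉ ∷ u) (px ∷ pxs) =
    All.zipWith (λ (x≢y , py) → f _ _ px py x≢y) (x∉ , pxs) ∷ allPairs-from-unique f u pxs

  length-filter-¬ : ∀ {A : Set} {P : A → Set} (P? : Decidable P) xs →
                    length (filter P? xs) + length (filter (¬? ∘ P?) xs) ≡ length xs
  length-filter-¬ P? [] = ≡.refl
  length-filter-¬ P? (x ∷ xs) with P? x
  ... | yes _ = ≡.cong suc (length-filter-¬ P? xs)
  ... | no  _ = ≡.trans (ℕₚ.+-suc _ _) (≡.cong suc (length-filter-¬ P? xs))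

  length-filter-map : ∀ {A B : Set} {P : B → Set} (P? : Decidable P) (f : A → B) xs →
                      length (filter P? (map f xs)) ≡ length (filter (P? ∘ f) xs)
  length-filter-map P? f [] = ≡.refl
  length-filter-map P? f (x ∷ xs) with P? (f x)
  ... | yes _ = ≡.cong suc (length-filter-map P? f xs)
  ... | no  _ = length-filter-map P? f xs

  length-filter-product : ∀ {A B : Set} {P : A × B → Set} (P? : Decidable P) c xs ys →
    All (λ x → c ≤ length (filter (λ y → P? (x , y)) ys)) xs →
    length xs * c ≤ length (filter P? (cartesianProduct xs ys))
  length-filter-product P? c []       ys []       = z≤n
  length-filter-product P? c (x ∷ xs) ys (b ∷ bs) = begin
    c + length xs * c
      ≤⟨ ℕₚ.+-mono-≤ b (length-filter-product P? c xs ys bs) ⟩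
    length (filter (λ y → P? (x , y)) ys) + length (filter P? (cartesianProduct xs ys))
      ≡⟨ ≡.cong (_+ length (filter P? (cartesianProduct xs ys))) (length-filter-map P? (x ,_) ys) ⟨
    length (filter P? (map (x ,_) ys)) + length (filter P? (cartesianProduct xs ys))
      ≡⟨ length-++ (filter P? (map (x ,_) ys)) ⟨
    length (filter P? (map (x ,_) ys) ++ filter P? (cartesianProduct xs ys))
      ≡⟨ ≡.cong length (filter-++ P? (map (x ,_) ys) (cartesianProduct xs ys)) ⟨
    length (filter P? (cartesianProduct (x ∷ xs) ys)) ∎
    where open ℕₚ.≤-Reasoning

  unique-lookup : ∀ {A : Set} {xs : List A} → Unique xs → ∀ {i j} → i Fin.< j → lookup xs i ≢ lookup xs j
  unique-lookup {xs = x ∷ xs} (x∉ ∷ u) {Fin.zero}  {Fin.suc j} _           e = All.lookup x∉ (∈-lookup j) e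
  unique-lookup {xs = x ∷ xs} (x∉ ∷ u) {Fin.suc i} {Fin.suc j} (s≤s i<j) e = unique-lookup u i<j e

  -- Choosing a partner in ys for each x is injective because K is functional, and the pigeonhole
  -- principle applies.
  functional-matching : ∀ {A B : Set} {K : B → A → Set} (xs : List A) (ys : List B) → Unique xs →
    All (λ x → Any (λ y → K y x) ys) xs → (∀ y x x′ → K y x → K y x′ → x ≡ x′) → length xs ≤ length ys
  functional-matching {K = K} xs ys u matched functional = ℕₚ.≮⇒≥ λ lt →
    let i , j , i<j , e = Finₚ.pigeonhole lt partner
    in unique-lookup u i<j (functional _ _ _ (related i)
         (≡.subst (λ k → K (lookup ys k) (lookup xs j)) (≡.sym e) (related j)))
    where
    partner : Fin (length xs) → Fin (length ys)
    partner i = Any.index (All.lookup matched (∈-lookup i))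
    related : ∀ i → K (lookup ys (partner i)) (lookup xs i)
    related i = Anyₚ.lookup-index (All.lookup matched (∈-lookup i))

  coprime-* : ∀ {k a b} → Coprime k a → Coprime k b → Coprime k (a * b)
  coprime-* ka kb {i} (i∣k , i∣ab) =
    kb (i∣k , coprime-divisor (λ (j∣i , j∣a) → ka (∣-trans j∣i i∣k , j∣a)) i∣ab)

  coprime-product : ∀ {k} xs → All (Coprime k) xs → Coprime k (product xs)
  coprime-product []       []       (_ , d∣1) = ∣1⇒≡1 d∣1
  coprime-product (x ∷ xs) (c ∷ cs) = coprime-* c (coprime-product xs cs)

  coprime-*∣ : ∀ {a b n} → Coprime a b → a ∣ n → b ∣ n → a * b ∣ n
  coprime-*∣ {a} {b} c (divides k ≡.refl) b∣ka with divides l ≡.refl ← coprime-divisor {o = k} (Coprimality.sym c) (≡.subst (b ∣_) (ℕₚ.*-comm k a) b∣ka) =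
    divides l (lemma l b a)
    where
    lemma : ∀ l b a → l * b * a ≡ l * (a * b)
    lemma = solve-∀

  -- The gcds of the w with n + 1 are at least 2 and pairwise coprime, so their product divides n +
  -- 1.
  few-common-factors : ∀ n ws → AllPairs Coprime ws → All (λ w → ¬ Coprime w (suc n)) ws → 2 ^ length ws ≤ suc n
  few-common-factors n ws coprimes shared = ℕₚ.≤-trans (size ws shared) (∣⇒≤ (divisor ws coprimes))
    where
    g : ℕ → ℕ
    g w = gcdℕ w (suc n)
    size : ∀ ws → All (λ w → ¬ Coprime w (suc n)) ws → 2 ^ length ws ≤ product (map g ws)
    size []       []       = ℕₚ.≤-refl
    size (w ∷ ws) (c ∷ cs) = ℕₚ.*-mono-≤ (2≤g (g w) ≡.refl) (size ws cs)
      where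
      2≤g : ∀ k → g w ≡ k → 2 ≤ k
      2≤g 0 e with () ← 0∣⇒≡0 (≡.subst (_∣ suc n) e (gcd[m,n]∣n w (suc n)))
      2≤g 1 e = ⊥-elim (c (gcd≡1⇒coprime e))
      2≤g (suc (suc k)) e = s≤s (s≤s z≤n)
    divisor : ∀ ws → AllPairs Coprime ws → product (map g ws) ∣ suc n
    divisor []       []        = 1∣ suc n
    divisor (w ∷ ws) (cs ∷ ps) = coprime-*∣
      (coprime-product (map g ws) (spread ws cs)) (gcd[m,n]∣n w (suc n)) (divisor ws ps)
      where
      spread : ∀ vs → All (Coprime w) vs → All (Coprime (g w)) (map g vs)
      spread []       []       = []
      spread (v ∷ vs) (c ∷ cs) = (λ (d∣gw , d∣gv) → c (∣-trans d∣gw (gcd[m,n]∣m w (suc n)) , ∣-trans d∣gv (gcd[m,n]∣m v (suc n)))) ∷ spread vs cs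

  -- The size of lcm(1, ..., N) and the supply of prime powers

  lcmUpTo : ℕ → ℕ
  lcmUpTo zero    = 1
  lcmUpTo (suc n) = lcm (lcmUpTo n) (suc n)

  ∣lcmUpTo : ∀ {m n} → 0 < m → m ≤ n → m ∣ lcmUpTo n
  ∣lcmUpTo {suc m} {zero}  0<m ()
  ∣lcmUpTo {suc m} {suc n} 0<m m≤n with suc m ≟ suc n
  ... | yes ≡.refl = n∣lcm[m,n] (lcmUpTo n) (suc n)
  ... | no  m≢n    = ∣-trans (∣lcmUpTo 0<m (ℕₚ.≤-pred (ℕₚ.≤∧≢⇒< m≤n m≢n))) (m∣lcm[m,n] (lcmUpTo n) (suc n))

  lcmUpTo>0 : ∀ n → 0 < lcmUpTo n
  lcmUpTo>0 zero    = s≤s z≤n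
  lcmUpTo>0 (suc n) with lcm (lcmUpTo n) (suc n) | lcm-least {lcmUpTo n} {suc n} (m∣m*n (suc n)) (n∣m*n (lcmUpTo n))
  ... | suc _ | _           = s≤s z≤n
  ... | zero  | d           = ⊥-elim (ℕₚ.<⇒≢ (ℕₚ.*-mono-≤ (lcmUpTo>0 n) (s≤s {n = n} z≤n)) (≡.sym (0∣⇒≡0 d)))

  -- lcm(1, …, N) ∫₀¹ xʲ (1 - x)ᵏ dx is an integer.
  beta-integral : ∀ N k j → suc (j + k) ≤ N → Σ ℕ λ a → a * (suc (j + k)) ! ≡ lcmUpTo N * (j ! * k !)
  beta-integral N zero j lt with divides a e ← ∣lcmUpTo {suc j} {N} (s≤s z≤n) (≡.subst (λ i → suc i ≤ N) (ℕₚ.+-identityʳ j) lt) =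
    a , (begin
      a * (suc (j + 0)) !            ≡⟨ ≡.cong (λ i → a * (suc i) !) (ℕₚ.+-identityʳ j) ⟩
      a * (suc j * j !)              ≡⟨ lemma a (suc j) (j !) ⟩
      a * suc j * (j ! * 1)        ≡⟨ ≡.cong (_* (j ! * 1)) e ⟨
      lcmUpTo N * (j ! * 0 !)        ∎)
    where
    open ≡.≡-Reasoning
    lemma : ∀ a s f → a * (s * f) ≡ a * s * (f * 1)
    lemma = solve-∀
  beta-integral N (suc k) j lt
    with a₁ , e₁ ← beta-integral N k j (ℕₚ.≤-trans (s≤s (ℕₚ.+-monoʳ-≤ j (ℕₚ.n≤1+n k))) lt)
       | a₂ , e₂ ← beta-integral N k (suc j) (≡.subst (λ i → suc i ≤ N) (ℕₚ.+-suc j k) lt) =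
    -- From xʲ (1 - x)ᵏ⁺¹ = xʲ (1 - x)ᵏ - xʲ⁺¹ (1 - x)ᵏ.
    a₁ ∸ a₂ , (begin
      (a₁ ∸ a₂) * (suc (j + suc k)) !
        ≡⟨ ≡.cong (λ i → (a₁ ∸ a₂) * (suc i) !) (ℕₚ.+-suc j k) ⟩
      (a₁ ∸ a₂) * X               ≡⟨ ℕₚ.*-distribʳ-∸ X a₁ a₂ ⟩
      a₁ * X ∸ a₂ * X           ≡⟨ ≡.cong₂ _∸_ first e₂ ⟩
      L * (suc j ! * k !) + L * (j ! * suc k !) ∸ L * (suc j ! * k !)
        ≡⟨ ℕₚ.m+n∸m≡n (L * (suc j ! * k !)) _ ⟩
      L * (j ! * suc k !)         ∎)
    where
    open ≡.≡-Reasoning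
    L = lcmUpTo N
    X = (suc (suc (j + k))) !
    lemma₁ : ∀ a s f → a * (s * f) ≡ s * (a * f)
    lemma₁ = solve-∀
    lemma₂ : ∀ j k L f g → suc (suc (j + k)) * (L * (f * g)) ≡ L * (suc j * f * g) + L * (f * (suc k * g))
    lemma₂ = solve-∀
    first : a₁ * X ≡ L * (suc j ! * k !) + L * (j ! * suc k !)
    first = begin
      a₁ * X                                              ≡⟨ lemma₁ a₁ (suc (suc (j + k))) ((suc (j + k)) !) ⟩
      suc (suc (j + k)) * (a₁ * (suc (j + k)) !)    ≡⟨ ≡.cong (suc (suc (j + k)) *_) e₁ ⟩
      suc (suc (j + k)) * (L * (j ! * k !))         ≡⟨ lemma₂ j k L (j !) (k !) ⟩
      L * (suc j ! * k !) + L * (j ! * suc k !)   ∎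

  -- The splitting ∫ xʲ (1 - x)ᵏ = ∫ xʲ⁺¹ (1 - x)ᵏ + ∫ xʲ (1 - x)ᵏ⁺¹, iterated down to positive integers.
  beta-lower : ∀ N i j k → suc (j + k) + i ≤ N → ∀ a → a * (suc (j + k)) ! ≡ lcmUpTo N * (j ! * k !) → 2 ^ i ≤ a
  beta-lower N zero j k lt zero    e = ⊥-elim (ℕₚ.<⇒≢ (ℕₚ.*-mono-≤ (lcmUpTo>0 N) (ℕₚ.*-mono-≤ (ℕₚ.1≤n! j) (ℕₚ.1≤n! k))) e)
  beta-lower N zero j k lt (suc a) e = s≤s z≤n
  beta-lower N (suc i) j k lt a e
    with lt′ ← ≡.subst (_≤ N) (ℕₚ.+-suc (suc (j + k)) i) lt
    with a₂ , e₂ ← beta-integral N k (suc j) (ℕₚ.≤-trans (ℕₚ.m≤m+n _ i) lt′)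
       | a₃ , e₃ ← beta-integral N (suc k) j (≡.subst (λ m → suc m ≤ N) (≡.sym (ℕₚ.+-suc j k)) (ℕₚ.≤-trans (ℕₚ.m≤m+n _ i) lt′)) =
    ≡.subst (2 ^ suc i ≤_) (≡.sym split)
      (ℕₚ.+-mono-≤ (beta-lower N i (suc j) k lt′ a₂ e₂)
        (ℕₚ.≤-trans (ℕₚ.≤-reflexive (ℕₚ.+-identityʳ _))
          (beta-lower N i j (suc k) (≡.subst (λ m → suc m + i ≤ N) (≡.sym (ℕₚ.+-suc j k)) lt′) a₃ e₃)))
    where
    open ≡.≡-Reasoning
    L = lcmUpTo N
    X = (suc (suc (j + k))) !
    lemma₁ : ∀ a s f → a * (s * f) ≡ s * (a * f)
    lemma₁ = solve-∀
    lemma₂ : ∀ j k L f g → suc (suc (j + k)) * (L * (f * g)) ≡ L * (suc j * f * g) + L * (f * (suc k * g))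
    lemma₂ = solve-∀
    split : a ≡ a₂ + a₃
    split = ℕₚ.*-cancelʳ-≡ a (a₂ + a₃) X {{ℕₚ._!≢0 (suc (suc (j + k)))}} (begin
      a * X                                              ≡⟨ lemma₁ a (suc (suc (j + k))) ((suc (j + k)) !) ⟩
      suc (suc (j + k)) * (a * (suc (j + k)) !)    ≡⟨ ≡.cong (suc (suc (j + k)) *_) e ⟩
      suc (suc (j + k)) * (L * (j ! * k !))        ≡⟨ lemma₂ j k L (j !) (k !) ⟩
      L * (suc j ! * k !) + L * (j ! * suc k !)
        ≡⟨ ≡.cong₂ _+_ (≡.sym e₂) (≡.sym (≡.trans (≡.cong (λ m → a₃ * (suc m) !) (≡.sym (ℕₚ.+-suc j k))) e₃)) ⟩
      a₂ * X + a₃ * X                                ≡⟨ ℕₚ.*-distribʳ-+ X a₂ a₃ ⟨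
      (a₂ + a₃) * X                                    ∎)

  -- For j = k = 0 the integral is 1; n rounds of splitting leave 2ⁿ positive integers that add up
  -- to the lcm.
  lcmUpTo-lower : ∀ n → 2 ^ n ≤ lcmUpTo (suc n)
  lcmUpTo-lower n = beta-lower (suc n) n 0 0 ℕₚ.≤-refl (lcmUpTo (suc n)) ≡.refl

  -- The places where lcm(1, ..., N) jumps, that is the prime powers above 1. In this form they are
  -- counted directly by the growth of the lcm.
  Fresh : ℕ → Set
  Fresh zero    = ⊥
  Fresh (suc n) = ¬ suc n ∣ lcmUpTo n

  fresh? : ∀ n → Dec (Fresh n)
  fresh? zero    = no id
  fresh? (suc n) = ¬? (suc n ∣? lcmUpTo n)

  prime-divisor : ∀ n → n ≢ 0 → n ≢ 1 → Σ ℕ λ q → Prime q × q ∣ n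
  prime-divisor zero    n≢0 n≢1 = ⊥-elim (n≢0 ≡.refl)
  prime-divisor (suc n) n≢0 n≢1 with factorise (suc n)
  ... | record { factors = []     ; isFactorisation = e } = ⊥-elim (n≢1 e)
  ... | record { factors = q ∷ qs ; isFactorisation = e ; factorsPrime = pq ∷ _ } =
    q , pq , ≡.subst (q ∣_) (≡.sym e) (m∣m*n (product qs))

  prime>1 : ∀ {q} → Prime q → 1 < q
  prime>1 {q} pq = nonTrivial⇒n>1 q {{prime⇒nonTrivial pq}}

  extract-power : ∀ {q} → Prime q → ∀ w → 0 < w → Σ ℕ λ k → Σ ℕ λ b → w ≡ q ^ k * b × ¬ q ∣ b
  extract-power {q} pq = <-rec _ go
    where
    go : ∀ w → (∀ {v} → v < w → 0 < v → Σ ℕ λ k → Σ ℕ λ b → v ≡ q ^ k * b × ¬ q ∣ b) →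
         0 < w → Σ ℕ λ k → Σ ℕ λ b → w ≡ q ^ k * b × ¬ q ∣ b
    go w rec 0<w with q ∣? w
    ... | no q∤w = 0 , w , ≡.sym (ℕₚ.*-identityˡ w) , q∤w
    go w rec () | yes (divides zero ≡.refl)
    ... | yes (divides (suc v) ≡.refl)
      with k , b , e , q∤b ← rec {suc v} (ℕₚ.m<m*n (suc v) q (prime>1 pq)) (s≤s z≤n) =
      suc k , b , ≡.trans (≡.cong (_* q) e) (lemma q (q ^ k) b) , q∤b
      where
      lemma : ∀ q y b → y * b * q ≡ q * y * b
      lemma = solve-∀

  coprime-power : ∀ {q b} → Coprime b q → ∀ k → Coprime b (q ^ k)
  coprime-power c zero    = coprime-product [] []
  coprime-power {q} c (suc k) = coprime-* {a = q} c (coprime-power {q} c k)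

  prime-coprime : ∀ {q b} → Prime q → ¬ q ∣ b → Coprime q b
  prime-coprime pq q∤b (d∣q , d∣b) with prime⇒irreducible pq d∣q
  ... | inj₁ d≡1    = d≡1
  ... | inj₂ ≡.refl = ⊥-elim (q∤b d∣b)

  -- If w = qᵏ b with b > 1 prime to q, both factors are below w and divide lcm(1, ..., w - 1);
  -- being coprime, so does their product w.
  fresh-prime-power : ∀ {q w} → Prime q → Fresh w → q ∣ w → Σ ℕ λ k → w ≡ q ^ k
  fresh-prime-power {q} {suc n} pq fresh q∣w with extract-power pq (suc n) (s≤s z≤n)
  ... | zero  , b , e , q∤b = ⊥-elim (q∤b (≡.subst (q ∣_) (≡.trans e (ℕₚ.*-identityˡ b)) q∣w))
  ... | suc k , 0 , e , q∤b = ⊥-elim (q∤b (divides 0 ≡.refl))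
  ... | suc k , 1 , e , q∤b = suc k , ≡.trans e (ℕₚ.*-identityʳ _)
  ... | suc k , b@(suc (suc b′)) , e , q∤b = ⊥-elim (fresh (≡.subst (_∣ lcmUpTo n) (≡.sym e)
      (coprime-*∣ {Q} {b} (Coprimality.sym {b} (coprime-power {q} (Coprimality.sym {q} (prime-coprime pq q∤b)) (suc k))) (∣lcmUpTo 0<Q (ℕₚ.≤-pred Q<)) (∣lcmUpTo {b} (s≤s z≤n) (ℕₚ.≤-pred b<)))))
    where
    Q = q ^ suc k
    1<Q : 1 < Q
    1<Q = ℕₚ.<-≤-trans (prime>1 pq) (ℕₚ.m≤m*n q (q ^ k) {{ℕₚ.m^n≢0 q k {{>-nonZero (ℕₚ.<⇒≤ (prime>1 pq))}}}})
    0<Q : 0 < Q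
    0<Q = ℕₚ.<⇒≤ 1<Q
    Q< : Q < suc n
    Q< = ≡.subst (Q <_) (≡.sym e) (ℕₚ.m<m*n Q b {{>-nonZero 0<Q}} (s≤s (s≤s z≤n)))
    b< : b < suc n
    b< = ≡.subst (b <_) (≡.sym (≡.trans e (ℕₚ.*-comm Q b))) (ℕₚ.m<m*n b Q 1<Q)

  -- A common prime q would make both numbers powers of q, and these differ by a factor of at least
  -- 2.
  fresh-coprime : ∀ {w w′} → Fresh w → Fresh w′ → w < w′ → w′ < w + w → Coprime w w′
  fresh-coprime {suc n} {w′} fw fw′ lt lt′ {i} (i∣w , i∣w′) with i ≟ 1
  ... | yes i≡1 = i≡1
  ... | no  i≢1 with q , pq , q∣i ← prime-divisor i (λ { ≡.refl → ℕₚ.1+n≢0 (0∣⇒≡0 i∣w) }) i≢1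
    with k , e ← fresh-prime-power pq fw (∣-trans q∣i i∣w)
       | l , e′ ← fresh-prime-power pq fw′ (∣-trans q∣i i∣w′) = ⊥-elim (ℕₚ.<⇒≱ lt′ double)
    where
    q≢0 : NonZero q
    q≢0 = >-nonZero (ℕₚ.<⇒≤ (prime>1 pq))
    k<l : k < l
    k<l = ℕₚ.≰⇒> λ l≤k → ℕₚ.<⇒≱ lt (≡.subst₂ _≤_ (≡.sym e′) (≡.sym e) (ℕₚ.^-monoʳ-≤ q {{q≢0}} l≤k))
    double : suc n + suc n ≤ w′
    double = begin
      suc n + suc n           ≡⟨ ≡.cong (λ z → suc n + z) (ℕₚ.+-identityʳ (suc n)) ⟨
      2 * suc n               ≤⟨ ℕₚ.*-monoˡ-≤ (suc n) (prime>1 pq) ⟩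
      q * suc n               ≡⟨ ≡.cong (q *_) e ⟩
      q ^ suc k               ≤⟨ ℕₚ.^-monoʳ-≤ q {{q≢0}} k<l ⟩
      q ^ l                   ≡⟨ e′ ⟨
      w′                        ∎
      where open ℕₚ.≤-Reasoning

  freshAfter : ℕ → ℕ → List ℕ
  freshAfter u zero    = []
  freshAfter u (suc k) with fresh? (u + suc k)
  ... | yes _ = u + suc k ∷ freshAfter u k
  ... | no  _ = freshAfter u k

  length-freshAfter : ∀ u k → length (freshAfter u k) ≤ k
  length-freshAfter u zero    = z≤n
  length-freshAfter u (suc k) with fresh? (u + suc k)
  ... | yes _ = s≤s (length-freshAfter u k)
  ... | no  _ = ℕₚ.m≤n⇒m≤1+n (length-freshAfter u k)

  All-freshAfter : ∀ u k → All (λ w → Fresh w × u < w × w ≤ u + k) (freshAfter u k)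
  All-freshAfter u zero    = []
  All-freshAfter u (suc k) with fresh? (u + suc k)
  ... | yes f = (f , ℕₚ.m<m+n u (s≤s z≤n) , ℕₚ.≤-refl) ∷
                All.map (λ (f , l , r) → f , l , ℕₚ.≤-trans r (ℕₚ.+-monoʳ-≤ u (ℕₚ.n≤1+n k))) (All-freshAfter u k)
  ... | no  _ = All.map (λ (f , l , r) → f , l , ℕₚ.≤-trans r (ℕₚ.+-monoʳ-≤ u (ℕₚ.n≤1+n k))) (All-freshAfter u k)

  coprime-freshAfter : ∀ u k → k ≤ u → AllPairs Coprime (freshAfter u k)
  coprime-freshAfter u zero    k≤u = []
  coprime-freshAfter u (suc k) k≤u with fresh? (u + suc k)
  ... | yes f = All.map (λ {w} (f′ , l , r) {d} → Coprimality.sym {w} (fresh-coprime f′ f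
                   (ℕₚ.≤-<-trans r (ℕₚ.+-monoʳ-< u (ℕₚ.n<1+n k)))
                   (ℕₚ.≤-<-trans (ℕₚ.+-monoʳ-≤ u k≤u) (ℕₚ.+-mono-<-≤ l (ℕₚ.<⇒≤ l)))) {d}) (All-freshAfter u k)
                ∷ coprime-freshAfter u k (ℕₚ.<⇒≤ k≤u)
  ... | no  _ = coprime-freshAfter u k (ℕₚ.<⇒≤ k≤u)

  unique-freshAfter : ∀ u k → Unique (freshAfter u k)
  unique-freshAfter u zero    = []
  unique-freshAfter u (suc k) with fresh? (u + suc k)
  ... | yes f = All.map (λ (f′ , l , r) e → ℕₚ.<⇒≢ (ℕₚ.≤-<-trans r (ℕₚ.+-monoʳ-< u (ℕₚ.n<1+n k))) (≡.sym e)) (All-freshAfter u k)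
                ∷ unique-freshAfter u k
  ... | no  _ = unique-freshAfter u k

  lcmUpTo-step : ∀ n → lcmUpTo (suc n) ≤ lcmUpTo n * suc n
  lcmUpTo-step n = ∣⇒≤ {{>-nonZero (ℕₚ.*-mono-≤ (lcmUpTo>0 n) (s≤s {n = n} z≤n))}}
    (lcm-least {lcmUpTo n} (m∣m*n (suc n)) (n∣m*n (lcmUpTo n)))

  lcmUpTo-old : ∀ n → ¬ Fresh (suc n) → lcmUpTo (suc n) ≤ lcmUpTo n
  lcmUpTo-old n old with suc n ∣? lcmUpTo n
  ... | yes d = ∣⇒≤ {{>-nonZero (lcmUpTo>0 n)}} (lcm-least ∣-refl d)
  ... | no  d = ⊥-elim (old d)

  -- Only a fresh number enlarges the lcm, and by no more than itself, which is at most B.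
  lcmUpTo-growth : ∀ B u k → u + k ≤ B → lcmUpTo (u + k) ≤ lcmUpTo u * B ^ length (freshAfter u k)
  lcmUpTo-growth B u zero    b = ℕₚ.≤-reflexive (≡.trans (≡.cong lcmUpTo (ℕₚ.+-identityʳ u)) (≡.sym (ℕₚ.*-identityʳ _)))
  lcmUpTo-growth B u (suc k) b with fresh? (u + suc k)
  ... | yes f = begin
    lcmUpTo (u + suc k)                                              ≡⟨ ≡.cong lcmUpTo (ℕₚ.+-suc u k) ⟩
    lcmUpTo (suc (u + k))                                            ≤⟨ lcmUpTo-step (u + k) ⟩
    lcmUpTo (u + k) * suc (u + k)
      ≤⟨ ℕₚ.*-mono-≤ (lcmUpTo-growth B u k (ℕₚ.≤-trans (ℕₚ.+-monoʳ-≤ u (ℕₚ.n≤1+n k)) b)) (≡.subst (_≤ B) (ℕₚ.+-suc u k) b) ⟩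
    lcmUpTo u * B ^ length (freshAfter u k) * B                  ≡⟨ lemma (lcmUpTo u) (B ^ length (freshAfter u k)) B ⟩
    lcmUpTo u * (B * B ^ length (freshAfter u k))                ∎
    where
    open ℕₚ.≤-Reasoning
    lemma : ∀ x y z → x * y * z ≡ x * (z * y)
    lemma = solve-∀
  ... | no old = begin
    lcmUpTo (u + suc k)                         ≡⟨ ≡.cong lcmUpTo (ℕₚ.+-suc u k) ⟩
    lcmUpTo (suc (u + k))                       ≤⟨ lcmUpTo-old (u + k) (λ f → old (≡.subst Fresh (≡.sym (ℕₚ.+-suc u k)) f)) ⟩
    lcmUpTo (u + k)                             ≤⟨ lcmUpTo-growth B u k (ℕₚ.≤-trans (ℕₚ.+-monoʳ-≤ u (ℕₚ.n≤1+n k)) b) ⟩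
    lcmUpTo u * B ^ length (freshAfter u k)   ∎
    where open ℕₚ.≤-Reasoning

  -- If none of the i dyadic blocks up to 2ⁱ holds A fresh numbers, the lcm has at most i A jumps.
  dyadic-search : ∀ B A i → 2 ^ i ≤ B →
    (Σ ℕ λ j → j < i × A ≤ length (freshAfter (2 ^ j) (2 ^ j))) ⊎ lcmUpTo (2 ^ i) ≤ B ^ (i * A)
  dyadic-search B A zero    b = inj₂ ℕₚ.≤-refl
  dyadic-search B A (suc i) b with dyadic-search B A i (ℕₚ.≤-trans (ℕₚ.m≤m+n _ _) b)
  ... | inj₁ (j , j<i , e) = inj₁ (j , ℕₚ.m<n⇒m<1+n j<i , e)
  ... | inj₂ l with A ≤? length (freshAfter (2 ^ i) (2 ^ i))
  ...   | yes e = inj₁ (i , ℕₚ.≤-refl , e)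
  ...   | no ne = inj₂ (begin
    lcmUpTo (2 ^ suc i)                              ≡⟨ ≡.cong lcmUpTo (≡.cong (λ z → 2 ^ i + z) (ℕₚ.+-identityʳ _)) ⟩
    lcmUpTo (2 ^ i + 2 ^ i)
      ≤⟨ lcmUpTo-growth B (2 ^ i) (2 ^ i) (≡.subst (_≤ B) (≡.cong (λ z → 2 ^ i + z) (ℕₚ.+-identityʳ _)) b) ⟩
    lcmUpTo (2 ^ i) * B ^ length (freshAfter (2 ^ i) (2 ^ i))
      ≤⟨ ℕₚ.*-mono-≤ l (ℕₚ.^-monoʳ-≤ B {{>-nonZero 0<B}} (ℕₚ.<⇒≤ (ℕₚ.≰⇒> ne))) ⟩
    B ^ (i * A) * B ^ A                        ≡⟨ ℕₚ.*-comm (B ^ (i * A)) (B ^ A) ⟩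
    B ^ A * B ^ (i * A)                        ≡⟨ ℕₚ.^-distribˡ-+-* B A (i * A) ⟨
    B ^ (suc i * A)                                ∎)
    where
    open ℕₚ.≤-Reasoning
    0<B : 0 < B
    0<B = ℕₚ.<-≤-trans (ℕₚ.m^n>0 2 (suc i)) b

  -- Since lcm(1, …, 2ⁱ) ≥ 2^(2ⁱ - 1), the fresh numbers, which are prime powers, cannot be rare in all dyadic blocks.
  pairwise-coprime-block : ∀ i A → i * (i * A) + 1 < 2 ^ i →
    Σ ℕ λ u → Σ (List ℕ) λ ws → u + u ≤ 2 ^ i × A ≤ u × A ≤ length ws × AllPairs Coprime ws × Unique ws ×
      All (λ w → u < w × w ≤ u + u) ws
  pairwise-coprime-block i A lt with dyadic-search (2 ^ i) A i ℕₚ.≤-refl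
  ... | inj₁ (j , j<i , e) = 2 ^ j , freshAfter (2 ^ j) (2 ^ j) ,
    ≡.subst (_≤ 2 ^ i) (≡.cong (λ z → 2 ^ j + z) (ℕₚ.+-identityʳ _)) (ℕₚ.^-monoʳ-≤ 2 j<i) ,
    ℕₚ.≤-trans e (length-freshAfter (2 ^ j) (2 ^ j)) , e ,
    coprime-freshAfter (2 ^ j) (2 ^ j) ℕₚ.≤-refl , unique-freshAfter (2 ^ j) (2 ^ j) ,
    All.map proj₂ (All-freshAfter (2 ^ j) (2 ^ j))
  ... | inj₂ l = ⊥-elim (ℕₚ.<⇒≱ (ℕₚ.^-monoʳ-< 2 (s≤s (s≤s z≤n)) exponents) (begin
    2 ^ n                             ≤⟨ lcmUpTo-lower n ⟩
    lcmUpTo (suc n)                     ≡⟨ ≡.cong lcmUpTo suc-n ⟩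
    lcmUpTo (2 ^ i)                   ≤⟨ l ⟩
    (2 ^ i) ^ (i * A)             ≡⟨ ℕₚ.^-*-assoc 2 i (i * A) ⟩
    2 ^ (i * (i * A))             ∎))
    where
    open ℕₚ.≤-Reasoning
    n = 2 ^ i ∸ 1
    suc-n : suc n ≡ 2 ^ i
    suc-n = ℕₚ.m+[n∸m]≡n (ℕₚ.m^n>0 2 i)
    exponents : i * (i * A) < n
    exponents = ℕₚ.≤-pred (≡.subst₂ _<_ (ℕₚ.+-comm _ 1) (≡.sym suc-n) lt)

  length-product : ∀ {A B : Set} (xs : List A) (ys : List B) → length (cartesianProduct xs ys) ≡ length xs * length ys
  length-product []       ys = ≡.refl
  length-product (x ∷ xs) ys = ≡.trans (length-++ (map (x ,_) ys)) (≡.cong₂ _+_ (length-map (x ,_) ys) (length-product xs ys))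

  allPairs-lookup : ∀ {A : Set} {R : A → A → Set} → (∀ {x y} → R x y → R y x) → ∀ {xs} → AllPairs R xs →
                    ∀ {x y} → x ∈ xs → y ∈ xs → x ≢ y → R x y
  allPairs-lookup s (r ∷ rs) (here ≡.refl) (here ≡.refl) x≢y = ⊥-elim (x≢y ≡.refl)
  allPairs-lookup s (r ∷ rs) (here ≡.refl) (there y∈)    x≢y = All.lookup r y∈
  allPairs-lookup s (r ∷ rs) (there x∈)    (here ≡.refl) x≢y = s (All.lookup r x∈)
  allPairs-lookup s (r ∷ rs) (there x∈)    (there y∈)    x≢y = allPairs-lookup s rs x∈ y∈ x≢y

open PairwiseCoprimeNumbers

-- Stepanov's method

module Roots (F : CommutativeRing 0ℓ 0ℓ)
  (domain : ∀ x y → CommutativeRing._≈_ F (CommutativeRing._*_ F x y) (CommutativeRing.0# F) →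
    CommutativeRing._≈_ F x (CommutativeRing.0# F) ⊎ CommutativeRing._≈_ F y (CommutativeRing.0# F))
  where
  open CommutativeRing F
  open Polynomials F
  open Solve F

  DivisibleAt : Carrier → ℕ → Poly → Set
  DivisibleAt l m p = Σ Poly λ q → p ≈ₚ X+ (- l) ^ₚ m *ₚ q

  root-of-product : ∀ {l m} M a b → ¬ m ≈ l → X+ (- m) ^ₚ suc M *ₚ a ≈ₚ X+ (- l) *ₚ b → eval m b ≈ 0#
  root-of-product {l} {m} M a b m≉l e =
    [ (λ d → ⊥-elim (m≉l (trans (solve 2 (λ m l → m := (m :- l) :+ l) refl m l)
                                (trans (+-congʳ d) (+-identityˡ l))))) , id ]′
    (domain (m - l) (eval m b) (begin
      (m - l) * eval m b                                    ≈⟨ *-congʳ (eval-X+ m (- l)) ⟨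
      eval m (X+ (- l)) * eval m b                          ≈⟨ eval-* m (X+ (- l)) b ⟨
      eval m (X+ (- l) *ₚ b)                                ≈⟨ eval-cong m e ⟨
      eval m (X+ (- m) ^ₚ suc M *ₚ a)                       ≈⟨ eval-* m (X+ (- m) ^ₚ suc M) a ⟩
      eval m (X+ (- m) ^ₚ suc M) * eval m a                 ≈⟨ *-congʳ (eval-* m (X+ (- m)) (X+ (- m) ^ₚ M)) ⟩
      eval m (X+ (- m)) * eval m (X+ (- m) ^ₚ M) * eval m a ≈⟨ *-congʳ (*-congʳ (trans (eval-X+ m (- m)) (-‿inverseʳ m))) ⟩
      0# * eval m (X+ (- m) ^ₚ M) * eval m a                ≈⟨ solve 2 (λ x y → con (+ 0) :* x :* y := con (+ 0)) refl _ _ ⟩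
      0#                                                    ∎))
    where open import Relation.Binary.Reasoning.Setoid setoid

  -- Coprimality of x - l and (x - m)ᴹ without a Euclidean algorithm: evaluation at m shows that x -
  -- m divides b, and cancelling it lowers M.
  swap-factor : ∀ {l m} M a b → ¬ m ≈ l → X+ (- m) ^ₚ M *ₚ a ≈ₚ X+ (- l) *ₚ b → DivisibleAt m M b
  swap-factor zero a b m≉l e = b , P.sym (P.*-identityˡ b)
  swap-factor {l} {m} (suc M) a b m≉l e = proj₁ IH ,
    P.trans b-factor (P.trans (P.*-congˡ (proj₂ IH)) (P.sym (P.*-assoc (X+ (- m)) (X+ (- m) ^ₚ M) (proj₁ IH))))
    where
    b-factor : b ≈ₚ X+ (- m) *ₚ quot m b
    b-factor = root-factor m b (root-of-product M a b m≉l e)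
    IH : DivisibleAt m M (quot m b)
    IH = swap-factor M a (quot m b) m≉l (X+-cancel (- m) _ _
      (P.trans (P.sym (P.*-assoc (X+ (- m)) (X+ (- m) ^ₚ M) a))
      (P.trans e (P.trans (P.*-congˡ b-factor)
        (PS.solve 3 (λ x y z → x PS.:* (y PS.:* z) PS.:= y PS.:* (x PS.:* z)) P.refl (X+ (- l)) (X+ (- m)) (quot m b))))))

  swap-power : ∀ {l m} M K a b → ¬ m ≈ l → X+ (- m) ^ₚ M *ₚ a ≈ₚ X+ (- l) ^ₚ K *ₚ b → DivisibleAt m M b
  swap-power M zero    a b m≉l e = a , P.sym (P.trans e (P.*-identityˡ b))
  swap-power {l} {m} M (suc K) a b m≉l e
    with c , f ← swap-factor M a (X+ (- l) ^ₚ K *ₚ b) m≉l (P.trans e (P.*-assoc (X+ (- l)) (X+ (- l) ^ₚ K) b)) =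
    swap-power M K c b m≉l (P.sym f)

  Small-cancel-power : ∀ l M n q → Small (M ℕ.+ n) (X+ l ^ₚ M *ₚ q) → Small n q
  Small-cancel-power l zero    n q s = Small-cong (P.*-identityˡ q) s
  Small-cancel-power l (suc M) n q s = Small-cancel-power l M n q
    (Small-cancel l _ (Small-cong (P.*-assoc (X+ l) (X+ l ^ₚ M) q) s))

  -- Division by (x - l)ᴹ removes M coefficients and keeps the divisibility at the other points.
  too-many-roots : ∀ M ls p → AllPairs (λ l m → ¬ l ≈ m) ls → All (λ l → DivisibleAt l M p) ls →
                   Small (length ls ℕ.* M) p → p ≈ₚ []
  too-many-roots M []       p _            _              s = Small-zero s
  too-many-roots M (l ∷ ls) p (l∉ls ∷ dist) ((q , e) ∷ div) s =
    P.trans e (P.trans (P.*-congˡ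
      (too-many-roots M ls q dist
        (All.zipWith (λ { {m} (l≉m , (a , f)) → swap-power M M a q (λ m≈l → l≉m (sym m≈l)) (P.trans (P.sym f) e) }) (l∉ls , div))
        (Small-cancel-power (- l) M _ q (Small-cong e s))))
      (P.zeroʳ (X+ (- l) ^ₚ M)))

-- The field of p = 2h + 1 elements in abstract form: `rep` and `emb` make coefficients accessible
-- to the pigeonhole principle, `numeral` to the induction behind Fermat's theorem.
module OverPrimeField (F : CommutativeRing 0ℓ 0ℓ)
  (domain : ∀ x y → CommutativeRing._≈_ F (CommutativeRing._*_ F x y) (CommutativeRing.0# F) →
    CommutativeRing._≈_ F x (CommutativeRing.0# F) ⊎ CommutativeRing._≈_ F y (CommutativeRing.0# F))
  (h : ℕ) (h>0 : 0 ℕ.< h)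
  (p·1≈0 : CommutativeRing._≈_ F (IntegerMultiples._·_ F (suc (h ℕ.+ h)) (CommutativeRing.1# F)) (CommutativeRing.0# F))
  (n·1≉0 : ∀ n → 0 ℕ.< n → n ℕ.< suc (h ℕ.+ h) →
    ¬ CommutativeRing._≈_ F (IntegerMultiples._·_ F n (CommutativeRing.1# F)) (CommutativeRing.0# F))
  (rep : CommutativeRing.Carrier F → Fin (suc (h ℕ.+ h)))
  (rep-injective : ∀ {x y} → rep x ≡ rep y → CommutativeRing._≈_ F x y)
  (emb : Fin (suc (h ℕ.+ h)) → CommutativeRing.Carrier F)
  (emb-injective : ∀ {i j} → CommutativeRing._≈_ F (emb i) (emb j) → i ≡ j)
  (numeral : ∀ x → Σ ℕ λ n → CommutativeRing._≈_ F x (IntegerMultiples._·_ F n (CommutativeRing.1# F)))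
  (_≈?_ : ∀ x y → Dec (CommutativeRing._≈_ F x y))
  where
  open CommutativeRing F
  open Polynomials F
  open Solve F
  open IntegerMultiples F using (_·_; 1+×; ×-homo-+; ×1-homo-*; ⟦_⟧ℤ; ⟦+⟧; ⟦*⟧; ⟦-⟧)
  open Roots F domain
  open import Algebra.Properties.Semiring.Exp semiring using (^-homo-*; ^-congˡ)
  open import Algebra.Properties.CommutativeSemiring.Exp commutativeSemiring using (^-distrib-*)
  open import Relation.Binary.Reasoning.Setoid setoid

  p : ℕ
  p = suc (h ℕ.+ h)

  2<p : 2 ℕ.< p
  2<p = ℕ.s≤s (ℕₚ.+-mono-≤ h>0 h>0)

  cancel : ∀ {x} → ¬ x ≈ 0# → ∀ y → x * y ≈ 0# → y ≈ 0#
  cancel x≉0 y e = [ (λ x≈0 → ⊥-elim (x≉0 x≈0)) , id ]′ (domain _ y e)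

  1≉0 : ¬ 1# ≈ 0#
  1≉0 = n·1≉0 1 (ℕ.s≤s ℕ.z≤n) (ℕₚ.<-trans (ℕ.s≤s (ℕ.s≤s ℕ.z≤n)) 2<p)

  power-nonzero : ∀ {x} → ¬ x ≈ 0# → ∀ n → ¬ x ^ n ≈ 0#
  power-nonzero x≉0 zero    e = 1≉0 e
  power-nonzero x≉0 (suc n) e = power-nonzero x≉0 n (cancel x≉0 _ e)

  zero-power : ∀ {x n} → 0 ℕ.< n → x ≈ 0# → x ^ n ≈ 0#
  zero-power {x} {suc n} _ e = trans (*-congʳ e) (zeroˡ _)

  shift : ℕ → Poly → Poly
  shift zero    q = q
  shift (suc n) q = 0# ∷ shift n q

  coef-shift-< : ∀ n q i → i ℕ.< n → coef (shift n q) i ≈ 0#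
  coef-shift-< (suc n) q zero    _           = refl
  coef-shift-< (suc n) q (suc i) (ℕ.s≤s i<n) = coef-shift-< n q i i<n

  coef-shift-+ : ∀ n q i → coef (shift n q) (n ℕ.+ i) ≈ coef q i
  coef-shift-+ zero    q i = refl
  coef-shift-+ (suc n) q i = coef-shift-+ n q i

  xⁿ : ℕ → Poly
  xⁿ n = shift n P.1#

  xⁿ-* : ∀ n q → xⁿ n *ₚ q ≈ₚ shift n q
  xⁿ-* zero    q = P.*-identityˡ q
  xⁿ-* (suc n) q = P.trans (shift-* (xⁿ n) q) (∷-cong refl (xⁿ-* n q))

  coef-drop : ∀ n q i → coef (drop n q) i ≈ coef q (n ℕ.+ i)
  coef-drop zero    q       i = refl
  coef-drop (suc n) []      i = refl
  coef-drop (suc n) (a ∷ q) i = coef-drop n q i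

  open Quotient polyRing (xⁿ p) using (_~_; _by_; quotient; lift; ~-trans)

  -- The middle coefficients of (x + t)ᵖ vanish because its derivative p (x + t)ᵖ⁻¹ does.
  frobenius-coef : ∀ t i → suc i ℕ.< p → coef (X+ t ^ₚ p) (suc i) ≈ 0#
  frobenius-coef t i i<p = cancel (n·1≉0 (suc i) (ℕ.s≤s ℕ.z≤n) i<p) _ (begin
    (suc i · 1#) * coef (X+ t ^ₚ p) (suc i)         ≈⟨ coef-D (X+ t ^ₚ p) i ⟨
    coef (D (X+ t ^ₚ p)) i                          ≈⟨ at (D-X+^ t (h ℕ.+ h)) i ⟩
    coef (const (p · 1#) *ₚ X+ t ^ₚ (h ℕ.+ h)) i    ≈⟨ at (const-* (p · 1#) (X+ t ^ₚ (h ℕ.+ h))) i ⟩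
    coef (scale (p · 1#) (X+ t ^ₚ (h ℕ.+ h))) i     ≈⟨ coef-scale (p · 1#) (X+ t ^ₚ (h ℕ.+ h)) i ⟩
    (p · 1#) * coef (X+ t ^ₚ (h ℕ.+ h)) i           ≈⟨ *-congʳ p·1≈0 ⟩
    0# * coef (X+ t ^ₚ (h ℕ.+ h)) i                 ≈⟨ zeroˡ _ ⟩
    0#                                              ∎)

  coef-0 : ∀ q → coef q 0 ≈ eval 0# q
  coef-0 []      = refl
  coef-0 (a ∷ q) = solve 2 (λ a x → a := a :+ con (+ 0) :* x) refl a _

  frobenius : ∀ t → X+ t ^ₚ p ≈ₚ const (t ^ p) +ₚ shift p (drop p (X+ t ^ₚ p))
  frobenius t = coefwise λ where
    zero → begin
      coef (X+ t ^ₚ p) 0               ≈⟨ trans (coef-0 (X+ t ^ₚ p)) (eval-^ 0# (X+ t) p) ⟩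
      eval 0# (X+ t) ^ p               ≈⟨ ^-congˡ p (trans (eval-X+ 0# t) (+-identityˡ t)) ⟩
      t ^ p                            ≈⟨ +-identityʳ _ ⟨
      t ^ p + 0#                       ≈⟨ coef-+ (const (t ^ p)) (shift p (drop p (X+ t ^ₚ p))) 0 ⟨
      coef (const (t ^ p) +ₚ shift p (drop p (X+ t ^ₚ p))) 0 ∎
    (suc i) → trans (higher i) (sym (trans (coef-+ (const (t ^ p)) (shift p (drop p (X+ t ^ₚ p))) (suc i)) (+-identityˡ _)))
   where
    higher : ∀ i → coef (X+ t ^ₚ p) (suc i) ≈ coef (shift p (drop p (X+ t ^ₚ p))) (suc i)
    higher i with suc i ℕ.<? p
    ... | yes i<p = trans (frobenius-coef t i i<p) (sym (coef-shift-< p _ (suc i) i<p))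
    ... | no  i≮p = begin
      coef (X+ t ^ₚ p) (suc i)                                       ≡⟨ ≡.cong (coef (X+ t ^ₚ p)) j-eq ⟨
      coef (X+ t ^ₚ p) (p ℕ.+ j)                                     ≈⟨ coef-drop p (X+ t ^ₚ p) j ⟨
      coef (drop p (X+ t ^ₚ p)) j                                    ≈⟨ coef-shift-+ p (drop p (X+ t ^ₚ p)) j ⟨
      coef (shift p (drop p (X+ t ^ₚ p))) (p ℕ.+ j)                  ≡⟨ ≡.cong (coef (shift p (drop p (X+ t ^ₚ p)))) j-eq ⟩
      coef (shift p (drop p (X+ t ^ₚ p))) (suc i)                    ∎
      where
      j : ℕ
      j = suc i ℕ.∸ p
      j-eq : p ℕ.+ j ≡ suc i
      j-eq = ℕₚ.m+[n∸m]≡n (ℕₚ.≮⇒≥ i≮p)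

  frobenius~ : ∀ t → X+ t ^ₚ p ~ const (t ^ p)
  frobenius~ t = drop p (X+ t ^ₚ p) by P.trans (frobenius t) (P.+-congˡ (P.sym (xⁿ-* p (drop p (X+ t ^ₚ p)))))

  ~-small : ∀ q → q ~ [] → Small p q → q ≈ₚ []
  ~-small q (r by e) s = coefwise λ i → aux i (i ℕ.<? p)
    where
    aux : ∀ i → Dec (i ℕ.< p) → coef q i ≈ 0#
    aux i (no i≮p)  = beyond s i (ℕₚ.≮⇒≥ i≮p)
    aux i (yes i<p) = trans (at (P.trans e (P.trans (P.+-identityˡ _) (xⁿ-* p r))) i) (coef-shift-< p r i i<p)

  -- The shifts begin at 1 because tᵖ (x + t) must not be zero. The constant is left as the pth
  -- power that `frobenius` produces.
  t c : ℕ → Carrier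
  t i = suc i · 1#
  c i = t i ^ p

  2≉0 : ¬ 1# + 1# ≈ 0#
  2≉0 = n·1≉0 2 (ℕ.s≤s ℕ.z≤n) 2<p

  open NormsOverPolynomials F domain 2≉0 c t

  -- Modulo xᵖ, (x + t)ʰ⁺¹ squares to (x + t)ᵖ (x + t) ≡ tᵖ (x + t).
  G : ℕ → Poly
  G i = X+ (t i) ^ₚ suc h

  -- The same substitution of G i for √κ i read twice: in F[x], where it is additive, and modulo xᵖ,
  -- where it is also multiplicative.
  module Exact = Adjunction polyRing polyRing id κ G id (λ _ _ → P.refl) (λ _ _ → P.refl) P.refl (λ _ → P.refl)
  module Q = CommutativeRing quotient
  module Modular = Adjunction polyRing quotient id κ G lift (λ _ _ → Q.refl) (λ _ _ → Q.refl) Q.refl (λ _ → Q.refl)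

  open Exact using () renaming (realise to ev)

  open import Algebra.Properties.Semiring.Exp P.semiring using () renaming (^-homo-* to ^ₚ-homo-*)

  G² : ∀ i → G i *ₚ G i ~ κ i
  G² i = ~-trans (lift (P.trans
      (PS.solve 2 (λ x y → (x PS.:* y) PS.:* (x PS.:* y) PS.:= (x PS.:* (y PS.:* y)) PS.:* x) P.refl (X+ (t i)) (X+ (t i) ^ₚ h))
      (P.*-congʳ (P.*-congˡ (P.sym (^ₚ-homo-* (X+ (t i)) h h))))))
    (Q.*-cong (frobenius~ (t i)) Q.refl)

  open Modular.Multiplicative G² using (realise-norm)

  modular-exact : ∀ k α → Modular.realise k α ≡ ev k α
  modular-exact zero    α       = ≡.refl
  modular-exact (suc k) (a , b) = ≡.cong₂ (λ u v → u +ₚ v *ₚ G k) (modular-exact k a) (modular-exact k b)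

  norm-vanishes : ∀ k α → Modular.realise k α ~ [] → fullNorm k α ~ []
  norm-vanishes zero    α e = e
  norm-vanishes (suc k) α e = norm-vanishes k (norm k α) (realise-norm k α e)

  admissible : ∀ k → k ℕ.< p → Admissible k
  admissible k k<p i i<k = power-nonzero (n·1≉0 (suc i) (ℕ.s≤s ℕ.z≤n) i<p) p ,
    λ j j<i e → n·1≉0 (i ℕ.∸ j) (ℕₚ.m<n⇒0<n∸m j<i) (ℕₚ.≤-<-trans (ℕₚ.m∸n≤m i j) (ℕₚ.<-trans (ℕₚ.n<1+n i) i<p)) (begin
      (i ℕ.∸ j) · 1#                                  ≈⟨ solve 2 (λ x y → x := (y :+ x) :- y) refl _ (t j) ⟩
      (t j + (i ℕ.∸ j) · 1#) - t j                    ≈⟨ +-congʳ (×-homo-+ 1# (suc j) (i ℕ.∸ j)) ⟨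
      (suc (j ℕ.+ (i ℕ.∸ j)) · 1#) - t j
        ≡⟨ ≡.cong (λ m → (suc m · 1#) - t j) (ℕₚ.m+[n∸m]≡n (ℕₚ.<⇒≤ j<i)) ⟩
      t i - t j                                       ≈⟨ +-congˡ (-‿cong e) ⟩
      t i - t i                                       ≈⟨ -‿inverseʳ _ ⟩
      0#                                              ∎)
    where
    i<p : suc i ℕ.< p
    i<p = ℕₚ.≤-<-trans i<k k<p

  -- If `ev k α` is zero, the norm of α is divisible by xᵖ. Its degree is below p, so the norm is
  -- zero, and by descent α is zero.
  independence : ∀ k → k ℕ.< p → ∀ {n} α → SmallT k (suc n) α → fullNormDegree k n ℕ.< p →
                 ev k α ≈ₚ [] → T._≈_ k α (T.0# k)
  independence k k<p {n} α s deg e = fullNorm-zero k (admissible k k<p) α s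
    (~-small (fullNorm k α)
      (norm-vanishes k α (≡.subst (_~ []) (≡.sym (modular-exact k α)) (lift e)))
      (Small-mono deg (Deg-fullNorm k s)))

  Deg-ev : ∀ k {n α} → SmallT k (suc n) α → Deg≤ (n ℕ.+ k ℕ.* suc h) (ev k α)
  Deg-ev zero    {n} s = Small-mono (ℕ.s≤s (ℕₚ.m≤m+n n 0)) s
  Deg-ev (suc k) {n} {a , b} (s , u) = Small-+
    (Small-mono (ℕ.s≤s (ℕₚ.+-monoʳ-≤ n (ℕₚ.m≤n+m (k ℕ.* suc h) (suc h)))) (Deg-ev k s))
    (≡.subst (λ m → Deg≤ m (ev k b *ₚ G k))
      (≡.trans (ℕₚ.+-assoc n _ (suc h)) (≡.cong (n ℕ.+_) (ℕₚ.+-comm _ (suc h))))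
      (Deg-* (Deg-ev k u) (Deg-X+^ (t k) (suc h))))

  W : ℕ → Poly
  W zero    = P.1#
  W (suc k) = W k *ₚ X+ (t k)

  Deg-W : ∀ k → Deg≤ k (W k)
  Deg-W zero    = Deg-const 1#
  Deg-W (suc k) = ≡.subst (λ m → Deg≤ m (W (suc k))) (ℕₚ.+-comm k 1) (Deg-* (Deg-W k) (Deg-X+ (t k)))

  -- The factor in W (k + 1) · D (G k) = (h + 1) W k · G k.
  logDer : ℕ → Poly
  logDer k = const (suc h · 1#) *ₚ W k

  Deg-logDer : ∀ k → Deg≤ k (logDer k)
  Deg-logDer k = Deg-* (Deg-const _) (Deg-W k)

  -- The derivation W d/dx of F[x], lifted to the tower.
  δ : ∀ k → T.Carrier k → T.Carrier k
  δ zero    a       = D a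
  δ (suc k) (a , b) =
    T._*_ k (ι k (X+ (t k))) (δ k a) ,
    T._+_ k (T._*_ k (ι k (X+ (t k))) (δ k b)) (T._*_ k (ι k (logDer k)) b)

  Deg-δ : ∀ k {n α} → SmallT k (suc n) α → SmallT k (suc (k ℕ.+ n)) (δ k α)
  Deg-δ zero    s = Small-D s
  Deg-δ (suc k) {n} (s , u) = Deg-ι* k (Deg-X+ (t k)) (Deg-δ k s) ,
    SmallT-+ k (Deg-ι* k (Deg-X+ (t k)) (Deg-δ k u))
      (SmallT-mono k (ℕₚ.n≤1+n _) (Deg-ι* k (Deg-logDer k) u))

  ev-ι* : ∀ k r a → ev k (T._*_ k (ι k r) a) ≈ₚ r *ₚ ev k a
  ev-ι* k r a = P.trans (Exact.realise-cong k (ι-scale k r a)) (go k a)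
    where
    go : ∀ k a → ev k (scaleT k r a) ≈ₚ r *ₚ ev k a
    go zero    a       = P.refl
    go (suc k) (a , b) = P.trans (P.+-cong (go k a) (P.*-congʳ (go k b)))
      (PS.solve 4 (λ r a b g → r PS.:* a PS.:+ (r PS.:* b) PS.:* g PS.:= r PS.:* (a PS.:+ b PS.:* g)) P.refl r _ _ (G k))

  ev-δ : ∀ k α → ev k (δ k α) ≈ₚ W k *ₚ D (ev k α)
  ev-δ zero    a       = P.sym (P.*-identityˡ (D a))
  ev-δ (suc k) (a , b) = P.trans (P.+-cong
      (P.trans (ev-ι* k π (δ k a)) (P.*-congˡ (ev-δ k a)))
      (P.*-congʳ (P.trans (Exact.realise-+ k _ _) (P.+-cong (P.trans (ev-ι* k π (δ k b)) (P.*-congˡ (ev-δ k b))) (ev-ι* k (logDer k) b)))))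
    (P.trans
      (PS.solve 7 (λ w x da db b h y → x PS.:* (w PS.:* da) PS.:+ (x PS.:* (w PS.:* db) PS.:+ (h PS.:* w) PS.:* b) PS.:* (x PS.:* y)
          PS.:= w PS.:* x PS.:* (da PS.:+ (db PS.:* (x PS.:* y) PS.:+ b PS.:* (h PS.:* y)))) P.refl
        (W k) π (D (ev k a)) (D (ev k b)) (ev k b) (const (suc h · 1#)) (X+ (t k) ^ₚ h))
      (P.*-congˡ {W k *ₚ π} (P.sym (P.trans (D-+ (ev k a) (ev k b *ₚ G k))
        (P.+-congˡ (P.trans (D-* (ev k b) (G k)) (P.+-congˡ (P.*-congˡ (D-X+^ (t k) h)))))))))
    where π = X+ (t k)

  module AtValue (e : Carrier) (e≉0 : ¬ e ≈ 0#) where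

    -- Replaces each (x + t)ʰ by the constant e.
    specialise : ∀ k → T.Carrier k → Poly
    specialise zero    a       = a
    specialise (suc k) (a , b) = specialise k a +ₚ specialise k b *ₚ scale e (X+ (t k))

    Deg-specialise : ∀ k {n α} → SmallT k (suc n) α → Deg≤ (n ℕ.+ k) (specialise k α)
    Deg-specialise zero    {n} s = Small-mono (ℕ.s≤s (ℕₚ.m≤m+n n 0)) s
    Deg-specialise (suc k) {n} {a , b} (s , u) = Small-+
      (Small-mono (ℕ.s≤s (ℕₚ.+-monoʳ-≤ n (ℕₚ.n≤1+n k))) (Deg-specialise k s))
      (≡.subst (λ m → Deg≤ m (specialise k b *ₚ scale e (X+ (t k))))
        (≡.trans (ℕₚ.+-assoc n k 1) (≡.cong (n ℕ.+_) (ℕₚ.+-comm k 1)))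
        (Deg-* (Deg-specialise k u) (Small-scale e (Deg-X+ (t k)))))

    Constant : ℕ → Carrier → Set
    Constant k l = ∀ i → i ℕ.< k → (l + t i) ^ h ≈ e

    -- At such a point G takes the value (l + t) (l + t)ʰ = e (l + t), that of a linear polynomial.
    eval-specialise : ∀ k l α → Constant k l → eval l (ev k α) ≈ eval l (specialise k α)
    eval-specialise zero    l α       cst = refl
    eval-specialise (suc k) l (a , b) cst = begin
      eval l (ev k a +ₚ ev k b *ₚ G k)               ≈⟨ trans (eval-+ l (ev k a) _) (+-congˡ (eval-* l (ev k b) (G k))) ⟩
      eval l (ev k a) + eval l (ev k b) * eval l (G k)
        ≈⟨ +-cong (eval-specialise k l a cst′) (*-cong (eval-specialise k l b cst′) eval-G) ⟩
      eval l (specialise k a) + eval l (specialise k b) * eval l (scale e (X+ (t k)))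
        ≈⟨ trans (eval-+ l (specialise k a) _) (+-congˡ (eval-* l (specialise k b) (scale e (X+ (t k))))) ⟨
      eval l (specialise k a +ₚ specialise k b *ₚ scale e (X+ (t k))) ∎
      where
      cst′ : Constant k l
      cst′ i i<k = cst i (ℕₚ.m<n⇒m<1+n i<k)
      eval-G : eval l (G k) ≈ eval l (scale e (X+ (t k)))
      eval-G = begin
        eval l (G k)                              ≈⟨ eval-* l (X+ (t k)) (X+ (t k) ^ₚ h) ⟩
        eval l (X+ (t k)) * eval l (X+ (t k) ^ₚ h)
          ≈⟨ *-congˡ (trans (eval-^ l (X+ (t k)) h) (trans (^-congˡ h (eval-X+ l (t k))) (cst k ℕₚ.≤-refl))) ⟩
        eval l (X+ (t k)) * e                     ≈⟨ *-comm _ e ⟩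
        e * eval l (X+ (t k))                     ≈⟨ eval-scale l e (X+ (t k)) ⟨
        eval l (scale e (X+ (t k)))               ∎

    -- At a root - t of W, the constant e would be 0ʰ = 0.
    W-nonzero : ∀ k l → Constant k l → ¬ eval l (W k) ≈ 0#
    W-nonzero zero    l cst z = 1≉0 (trans (sym (eval-const l 1#)) z)
    W-nonzero (suc k) l cst z =
      [ W-nonzero k l (λ i i<k → cst i (ℕₚ.m<n⇒m<1+n i<k)) ,
        (λ z′ → e≉0 (trans (sym (cst k ℕₚ.≤-refl)) (zero-power h>0 (trans (sym (eval-X+ l (t k))) z′)))) ]′
      (domain _ _ (trans (sym (eval-* l (W k) (X+ (t k)))) z))

  -- Iterates of W d/dx instead of d/dx: W times the derivative of a generator is again a polynomial
  -- multiple of it, so the iterates stay in the tower. Where W does not vanish, they detect the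
  -- same orders of vanishing.
  ∇^ : ℕ → ℕ → Poly → Poly
  ∇^ k zero    f = f
  ∇^ k (suc j) f = ∇^ k j (W k *ₚ D f)

  δ^ : ∀ k → ℕ → T.Carrier k → T.Carrier k
  δ^ k zero    α = α
  δ^ k (suc j) α = δ^ k j (δ k α)

  ∇^-cong : ∀ k j {f g} → f ≈ₚ g → ∇^ k j f ≈ₚ ∇^ k j g
  ∇^-cong k zero    e = e
  ∇^-cong k (suc j) e = ∇^-cong k j (P.*-congˡ (D-cong e))

  ∇^-ev : ∀ k j α → ∇^ k j (ev k α) ≈ₚ ev k (δ^ k j α)
  ∇^-ev k zero    α = P.refl
  ∇^-ev k (suc j) α = P.trans (∇^-cong k j (P.sym (ev-δ k α))) (∇^-ev k j (δ k α))

  ∇^-minus : ∀ k j f g → ∇^ k j (f +ₚ -ₚ g) ≈ₚ ∇^ k j f +ₚ -ₚ ∇^ k j g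
  ∇^-minus k zero    f g = P.refl
  ∇^-minus k (suc j) f g = P.trans
    (∇^-cong k j (P.trans (P.*-congˡ (P.trans (D-+ f (-ₚ g)) (P.+-congˡ (D-neg g))))
      (PS.solve 3 (λ w a b → w PS.:* (a PS.:- b) PS.:= w PS.:* a PS.:- w PS.:* b) P.refl (W k) (D f) (D g))))
    (∇^-minus k j (W k *ₚ D f) (W k *ₚ D g))

  Deg-δ^ : ∀ k j {n α} → SmallT k (suc n) α → SmallT k (suc (n ℕ.+ j ℕ.* k)) (δ^ k j α)
  Deg-δ^ k zero    {n} s = SmallT-mono k (ℕ.s≤s (ℕₚ.m≤m+n n 0)) s
  Deg-δ^ k (suc j) {n} {α} s = ≡.subst (λ m → SmallT k (suc m) (δ^ k j (δ k α)))
    (≡.trans (≡.cong (ℕ._+ j ℕ.* k) (ℕₚ.+-comm k n)) (ℕₚ.+-assoc n k _)) (Deg-δ^ k j (Deg-δ k s))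

  -- If f = (x - l)ᵐ q then ∇ᵐ f takes the value m! W(l)ᵐ q(l) at l.
  order-step : ∀ k l → ¬ eval l (W k) ≈ 0# → ∀ m → m ℕ.< p → ∀ q f → f ≈ₚ X+ (- l) ^ₚ m *ₚ q →
               eval l (∇^ k m f) ≈ 0# → eval l q ≈ 0#
  order-step k l W≉0 zero    m<p q f e z = trans (eval-cong l (P.trans (P.sym (P.*-identityˡ q)) (P.sym e))) z
  order-step k l W≉0 (suc m) m<p q f e z =
    cancel (n·1≉0 (suc m) (ℕ.s≤s ℕ.z≤n) m<p) (eval l q) (cancel W≉0 _ (begin
      eval l (W k) * ((suc m · 1#) * eval l q)
        ≈⟨ solve 4 (λ w s q d → w :* (s :* q) := w :* (s :* q :+ con (+ 0) :* d)) refl _ _ _ (eval l (D q)) ⟩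
      eval l (W k) * ((suc m · 1#) * eval l q + 0# * eval l (D q))
        ≈⟨ *-congˡ (+-cong (*-congʳ (eval-const l _)) (*-congʳ (trans (eval-X+ l (- l)) (-‿inverseʳ l)))) ⟨
      eval l (W k) * (eval l s * eval l q + eval l x * eval l (D q))
        ≈⟨ trans (eval-* l (W k) _) (*-congˡ (trans (eval-+ l (s *ₚ q) _) (+-cong (eval-* l s q) (eval-* l x (D q))))) ⟨
      eval l q₁
        ≈⟨ order-step k l W≉0 m (ℕₚ.<-trans (ℕₚ.n<1+n m) m<p) q₁ (W k *ₚ D f) e₁ z ⟩
      0# ∎))
    where
    x s q₁ : Poly
    x = X+ (- l)
    s = const (suc m · 1#)
    q₁ = W k *ₚ (s *ₚ q +ₚ x *ₚ D q)
    e₁ : W k *ₚ D f ≈ₚ x ^ₚ m *ₚ q₁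
    e₁ = P.trans (P.*-congˡ (P.trans (D-cong e) (P.trans (D-* (x ^ₚ suc m) q) (P.+-congʳ (P.*-congʳ (D-X+^ (- l) m))))))
      (PS.solve 6 (λ w s y x q d → w PS.:* ((s PS.:* y) PS.:* q PS.:+ (x PS.:* y) PS.:* d) PS.:=
         y PS.:* (w PS.:* (s PS.:* q PS.:+ x PS.:* d))) P.refl (W k) s (x ^ₚ m) x q (D q))

  -- The bound m ≤ p keeps the factorials that occur in `order-step` invertible.
  divisible : ∀ k l → ¬ eval l (W k) ≈ 0# → ∀ m → m ℕ.≤ p → ∀ f → (∀ j → j ℕ.< m → eval l (∇^ k j f) ≈ 0#) →
              DivisibleAt l m f
  divisible k l W≉0 zero    m≤p f z = f , P.sym (P.*-identityˡ f)
  divisible k l W≉0 (suc m) m≤p f z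
    with q , e ← divisible k l W≉0 m (ℕₚ.<⇒≤ m≤p) f (λ j j<m → z j (ℕₚ.m<n⇒m<1+n j<m)) =
    quot l q , P.trans e (P.trans (P.*-congˡ (root-factor l q (order-step k l W≉0 m m≤p q f e (z m ℕₚ.≤-refl))))
      (PS.solve 3 (λ y x r → y PS.:* (x PS.:* r) PS.:= (x PS.:* y) PS.:* r) P.refl (X+ (- l) ^ₚ m) (X+ (- l)) (quot l q)))

  -- The auxiliary polynomial and Stepanov's bound

  dim : ℕ → ℕ → ℕ
  dim n zero    = suc n
  dim n (suc k) = dim n k ℕ.+ dim n k

  dim≡ : ∀ n k → dim n k ≡ 2 ℕ.^ k ℕ.* suc n
  dim≡ n zero    = ≡.sym (ℕₚ.*-identityˡ (suc n))
  dim≡ n (suc k) = ≡.trans (≡.cong₂ ℕ._+_ (dim≡ n k) (dim≡ n k)) (lemma (2 ℕ.^ k) (suc n))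
    where
    lemma : ∀ x y → x ℕ.* y ℕ.+ x ℕ.* y ≡ (x ℕ.+ (x ℕ.+ 0)) ℕ.* y
    lemma = solve-∀

  build : ∀ n k → (Fin (dim n k) → Fin p) → T.Carrier k
  build n zero    u = tabulate (emb ∘ u)
  build n (suc k) u = build n k (u ∘ (_↑ˡ dim n k)) , build n k (u ∘ (dim n k ↑ʳ_))

  coef-tabulate : ∀ {n} (f : Fin n → Carrier) i → coef (tabulate f) (toℕ i) ≡ f i
  coef-tabulate {suc n} f Fin.zero    = ≡.refl
  coef-tabulate {suc n} f (Fin.suc i) = coef-tabulate (f ∘ Fin.suc) i

  Small-tabulate : ∀ {n} (f : Fin n → Carrier) → Small n (tabulate f)
  Small-tabulate {zero}  f = Small-[]
  Small-tabulate {suc n} f = Small-∷ (f Fin.zero) (Small-tabulate (f ∘ Fin.suc))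

  Small-build : ∀ n k u → SmallT k (suc n) (build n k u)
  Small-build n zero    u = Small-tabulate (emb ∘ u)
  Small-build n (suc k) u = Small-build n k _ , Small-build n k _

  build-injective : ∀ n k u v → T._≈_ k (build n k u) (build n k v) → u ≗ v
  build-injective n zero u v e i = emb-injective (begin
    emb (u i)                              ≡⟨ coef-tabulate (emb ∘ u) i ⟨
    coef (tabulate (emb ∘ u)) (toℕ i)      ≈⟨ at e (toℕ i) ⟩
    coef (tabulate (emb ∘ v)) (toℕ i)      ≡⟨ coef-tabulate (emb ∘ v) i ⟩
    emb (v i)                              ∎)
  build-injective n (suc k) u v (e , f) i = ≡.subst (λ j → u j ≡ v j) (Finₚ.join-splitAt (dim n k) (dim n k) i)
    (aux (Fin.splitAt (dim n k) i))
    where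
    aux : ∀ s → u (Fin.join (dim n k) (dim n k) s) ≡ v (Fin.join (dim n k) (dim n k) s)
    aux (inj₁ j) = build-injective n k _ _ e j
    aux (inj₂ j) = build-injective n k _ _ f j

  funToFin-cong : ∀ {m n} {f g : Fin m → Fin n} → f ≗ g → funToFin f ≡ funToFin g
  funToFin-cong {zero}  e = ≡.refl
  funToFin-cong {suc m} e = ≡.cong₂ combine (e Fin.zero) (funToFin-cong (e ∘ Fin.suc))

  -- Replaces a rank argument: of the pⁿ inputs two share one of the pᵐ outputs. The difference of
  -- such a pair will serve as a kernel element.
  pigeonhole-functions : ∀ {m n} → m ℕ.< n → (Φ : (Fin n → Fin p) → Fin m → Fin p) →
    Σ (Fin n → Fin p) λ u → Σ (Fin n → Fin p) λ v → ¬ u ≗ v × Φ u ≗ Φ v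
  pigeonhole-functions {m} {n} m<n Φ
    with i , j , i<j , e ← Finₚ.pigeonhole (ℕₚ.^-monoʳ-< p (ℕₚ.<-trans (ℕ.s≤s (ℕ.s≤s ℕ.z≤n)) 2<p) m<n)
                             (λ i → funToFin (Φ (finToFun {p} {n} i))) =
    finToFun {p} {n} i , finToFun {p} {n} j ,
    (λ u≗v → Finₚ.<⇒≢ i<j (≡.trans (≡.sym (Finₚ.funToFin-finToFin {n} {p} i))
      (≡.trans (funToFin-cong u≗v) (Finₚ.funToFin-finToFin {n} {p} j)))) ,
    λ x → ≡.trans (≡.sym (Finₚ.finToFun-funToFin (Φ (finToFun {p} {n} i)) x))
      (≡.trans (≡.cong (λ y → finToFun {p} {m} y x) e) (Finₚ.finToFun-funToFin (Φ (finToFun {p} {n} j)) x))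

  module _ (e : Carrier) (e≉0 : ¬ e ≈ 0#) where
    open AtValue e e≉0

    module _ (k M n : ℕ) where
      -- For j < M the polynomial `specialise k (δ^ k j α)` has degree at most n + j k + k ≤ n + M
      -- k; N is the number of its coefficients.
      N : ℕ
      N = suc (n ℕ.+ M ℕ.* k)

      observe : (Fin (dim n k) → Fin p) → Fin M × Fin N → Fin p
      observe u (j , i) = rep (coef (specialise k (δ^ k (toℕ j) (build n k u))) (toℕ i))

      auxiliary-pair : M ℕ.* N ℕ.< dim n k →
        Σ (T.Carrier k) λ α → Σ (T.Carrier k) λ β → SmallT k (suc n) α × SmallT k (suc n) β × ¬ T._≈_ k α β ×
        (∀ j → j ℕ.< M → specialise k (δ^ k j α) ≈ₚ specialise k (δ^ k j β))
      auxiliary-pair lt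
        with u , v , u≢v , same ← pigeonhole-functions lt
               (λ u x → observe u (remQuot {M} N x)) =
        build n k u , build n k v , Small-build n k u , Small-build n k v ,
        (λ eq → u≢v (build-injective n k u v eq)) ,
        λ j j<M → coefwise λ i → agree u v same j j<M i (i ℕ.<? N)
        where
        bound : ∀ j → j ℕ.< M → ∀ u → Small N (specialise k (δ^ k j (build n k u)))
        bound j j<M u = Small-mono (ℕ.s≤s (ℕₚ.≤-trans (ℕₚ.≤-reflexive (ℕₚ.+-assoc n (j ℕ.* k) k))
            (ℕₚ.+-monoʳ-≤ n (ℕₚ.≤-trans (ℕₚ.≤-reflexive (ℕₚ.+-comm (j ℕ.* k) k)) (ℕₚ.*-monoˡ-≤ k j<M)))))
          (Deg-specialise k (Deg-δ^ k j (Small-build n k u)))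
        agree : ∀ u v → (∀ x → observe u (remQuot {M} N x) ≡ observe v (remQuot {M} N x)) →
                ∀ j → j ℕ.< M → ∀ i → Dec (i ℕ.< N) →
                coef (specialise k (δ^ k j (build n k u))) i ≈ coef (specialise k (δ^ k j (build n k v))) i
        agree u v same j j<M i (no i≮N) =
          trans (beyond (bound j j<M u) i (ℕₚ.≮⇒≥ i≮N)) (sym (beyond (bound j j<M v) i (ℕₚ.≮⇒≥ i≮N)))
        agree u v same j j<M i (yes i<N) = ≡.subst₂
          (λ j i → coef (specialise k (δ^ k j (build n k u))) i ≈ coef (specialise k (δ^ k j (build n k v))) i)
          (Finₚ.toℕ-fromℕ< j<M) (Finₚ.toℕ-fromℕ< i<N)
          (rep-injective (≡.subst (λ y → observe u y ≡ observe v y) (Finₚ.remQuot-combine (fromℕ< j<M) (fromℕ< i<N))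
            (same (combine (fromℕ< j<M) (fromℕ< i<N)))))

    -- The difference of an auxiliary pair vanishes to order M at every l, and its degree is at most
    -- n + k (h + 1). With more points it would be the zero polynomial, against `independence`.
    few-constant-runs : ∀ k M n → k ℕ.< p → M ℕ.≤ p → M ℕ.* suc (n ℕ.+ M ℕ.* k) ℕ.< dim n k →
      fullNormDegree k n ℕ.< p → ∀ ls → AllPairs (λ l m → ¬ l ≈ m) ls → All (Constant k) ls →
      length ls ℕ.* M ℕ.≤ n ℕ.+ k ℕ.* suc h
    few-constant-runs k M n k<p M≤p lt deg ls distinct consts
      with α , β , sα , sβ , α≉β , agree ← auxiliary-pair k M n lt =
      ℕₚ.≮⇒≥ λ many → α≉β (T.trans k
        (TS.solve k 2 (λ x y → TS._:=_ k x (TS._:+_ k (TS._:-_ k x y) y)) (T.refl k) α β)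
        (T.trans k (T.+-congʳ k (independence k k<p (T._-_ k α β) (SmallT-+ k sα (SmallT-neg k sβ)) deg
            (P.trans ev-minus (too-many-roots M ls f distinct (All.map (λ {l} → root l) consts)
              (Small-mono many (Small-+ (Deg-ev k sα) (Small-neg (Deg-ev k sβ))))))))
          (T.+-identityˡ k β)))
      where
      f : Poly
      f = ev k α +ₚ -ₚ ev k β
      ev-minus : ev k (T._-_ k α β) ≈ₚ f
      ev-minus = P.trans (Exact.realise-+ k α (T.-_ k β)) (P.+-congˡ (Exact.realise-neg k β))
      root : ∀ l → Constant k l → DivisibleAt l M f
      root l cst = divisible k l (W-nonzero k l cst) M M≤p f λ j j<M → begin
        eval l (∇^ k j f)                                          ≈⟨ eval-cong l (∇^-minus k j (ev k α) (ev k β)) ⟩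
        eval l (∇^ k j (ev k α) +ₚ -ₚ ∇^ k j (ev k β))
          ≈⟨ eval-cong l (P.+-cong (∇^-ev k j α) (P.-‿cong (∇^-ev k j β))) ⟩
        eval l (ev k (δ^ k j α) +ₚ -ₚ ev k (δ^ k j β))             ≈⟨ eval-minus (ev k (δ^ k j α)) (ev k (δ^ k j β)) ⟩
        eval l (ev k (δ^ k j α)) - eval l (ev k (δ^ k j β))
          ≈⟨ +-cong (trans (eval-specialise k l _ cst) (eval-cong l (agree j j<M))) (-‿cong (eval-specialise k l _ cst)) ⟩
        eval l (specialise k (δ^ k j β)) - eval l (specialise k (δ^ k j β)) ≈⟨ -‿inverseʳ _ ⟩
        0#                                                         ∎
        where
        eval-minus : ∀ q r → eval l (q +ₚ -ₚ r) ≈ eval l q - eval l r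
        eval-minus q r = begin
          eval l (q +ₚ -ₚ r)                           ≈⟨ solve 2 (λ x y → x := (x :+ y) :- y) refl _ (eval l r) ⟩
          (eval l (q +ₚ -ₚ r) + eval l r) - eval l r   ≈⟨ +-congʳ (eval-+ l (q +ₚ -ₚ r) r) ⟨
          eval l (q +ₚ -ₚ r +ₚ r) - eval l r
            ≈⟨ +-congʳ (eval-cong l (PS.solve 2 (λ q r → (q PS.:- r) PS.:+ r PS.:= q) P.refl q r)) ⟩
          eval l q - eval l r                          ∎

  -- Fermat's theorem and Euler's criterion

  one-power : ∀ n → 1# ^ n ≈ 1#
  one-power zero    = refl
  one-power (suc n) = trans (*-identityˡ _) (one-power n)

  leading-coef : ∀ t n → coef (X+ t ^ₚ n) n ≈ 1#
  leading-coef t zero    = refl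
  leading-coef t (suc n) = begin
    coef (X+ t *ₚ X+ t ^ₚ n) (suc n)                         ≈⟨ coef-X+* t (X+ t ^ₚ n) n ⟩
    t * coef (X+ t ^ₚ n) (suc n) + coef (X+ t ^ₚ n) n        ≈⟨ +-cong (*-congˡ (beyond (Deg-X+^ t n) (suc n) ℕₚ.≤-refl)) (leading-coef t n) ⟩
    t * 0# + 1#                                              ≈⟨ solve 1 (λ t → t :* con (+ 0) :+ con (+ 1) := con (+ 1)) refl t ⟩
    1#                                                       ∎

  eval-shift : ∀ l n q → eval l (shift n q) ≈ l ^ n * eval l q
  eval-shift l zero    q = sym (*-identityˡ _)
  eval-shift l (suc n) q = trans (+-identityˡ _) (trans (*-congˡ (eval-shift l n q)) (sym (*-assoc l _ _)))

  frobenius-1 : ∀ u → (u + 1#) ^ p ≈ u ^ p + 1#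
  frobenius-1 u = begin
    (u + 1#) ^ p                            ≈⟨ trans (eval-^ u (X+ 1#) p) (^-congˡ p (eval-X+ u 1#)) ⟨
    eval u (X+ 1# ^ₚ p)                     ≈⟨ eval-cong u (frobenius 1#) ⟩
    eval u (const (1# ^ p) +ₚ shift p q)    ≈⟨ eval-+ u (const (1# ^ p)) (shift p q) ⟩
    eval u (const (1# ^ p)) + eval u (shift p q)
      ≈⟨ +-cong (trans (eval-const u _) (one-power p)) (eval-shift u p q) ⟩
    1# + u ^ p * eval u q                   ≈⟨ +-congˡ (*-congˡ (trans (eval-cong u q≈1) (eval-const u 1#))) ⟩
    1# + u ^ p * 1#                         ≈⟨ solve 1 (λ x → con (+ 1) :+ x :* con (+ 1) := x :+ con (+ 1)) refl _ ⟩
    u ^ p + 1#                              ∎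
    where
    q : Poly
    q = drop p (X+ 1# ^ₚ p)
    q≈1 : q ≈ₚ const 1#
    q≈1 = coefwise λ where
      zero → trans (coef-drop p (X+ 1# ^ₚ p) 0)
        (trans (reflexive (≡.cong (coef (X+ 1# ^ₚ p)) (ℕₚ.+-identityʳ p))) (leading-coef 1# p))
      (suc i) → trans (coef-drop p (X+ 1# ^ₚ p) (suc i))
        (beyond (Deg-X+^ 1# p) (p ℕ.+ suc i) (ℕₚ.≤-trans (ℕ.s≤s (ℕₚ.m≤m+n p i)) (ℕₚ.≤-reflexive (≡.sym (ℕₚ.+-suc p i)))))

  -- Induction over the numerals, since the pth power respects adding 1.
  fermat : ∀ u → u ^ p ≈ u
  fermat u with n , e ← numeral u = trans (^-congˡ p e) (trans (go n) (sym e))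
    where
    go : ∀ n → (n · 1#) ^ p ≈ n · 1#
    go zero    = zero-power {n = p} (ℕ.s≤s ℕ.z≤n) refl
    go (suc n) = begin
      (suc n · 1#) ^ p      ≈⟨ ^-congˡ p (trans (1+× n 1#) (+-comm _ _)) ⟩
      (n · 1# + 1#) ^ p     ≈⟨ frobenius-1 (n · 1#) ⟩
      (n · 1#) ^ p + 1#     ≈⟨ +-congʳ (go n) ⟩
      n · 1# + 1#           ≈⟨ trans (1+× n 1#) (+-comm _ _) ⟨
      suc n · 1#            ∎

  half-power² : ∀ {u} → ¬ u ≈ 0# → u ^ h * u ^ h ≈ 1#
  half-power² {u} u≉0 = begin
    u ^ h * u ^ h                    ≈⟨ solve 1 (λ x → x := (x :- con (+ 1)) :+ con (+ 1)) refl _ ⟩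
    (u ^ h * u ^ h - 1#) + 1#        ≈⟨ +-congʳ (cancel u≉0 _ (begin
      u * (u ^ h * u ^ h - 1#)       ≈⟨ solve 2 (λ u x → u :* (x :- con (+ 1)) := u :* x :- u) refl u _ ⟩
      u * (u ^ h * u ^ h) - u        ≈⟨ +-congʳ (*-congˡ (^-homo-* u h h)) ⟨
      u ^ p - u                      ≈⟨ +-congʳ (fermat u) ⟩
      u - u                          ≈⟨ -‿inverseʳ u ⟩
      0#                             ∎)) ⟩
    0# + 1#                          ≈⟨ +-identityˡ 1# ⟩
    1#                               ∎

  ±1 : ∀ {x} → x * x ≈ 1# → x ≈ 1# ⊎ x ≈ - 1#
  ±1 {x} e with domain (x - 1#) (x + 1#) (trans
    (solve 1 (λ x → (x :- con (+ 1)) :* (x :+ con (+ 1)) := x :* x :- con (+ 1)) refl x) (trans (+-congʳ e) (-‿inverseʳ 1#)))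
  ... | inj₁ d = inj₁ (trans (solve 1 (λ x → x := (x :- con (+ 1)) :+ con (+ 1)) refl x) (trans (+-congʳ d) (+-identityˡ 1#)))
  ... | inj₂ d = inj₂ (trans (solve 1 (λ x → x := (x :+ con (+ 1)) :- con (+ 1)) refl x) (trans (+-congʳ d) (+-identityˡ _)))

  square : ℕ → Carrier
  square i = (i · 1#) * (i · 1#)

  squares : ℕ → List Carrier
  squares zero    = []
  squares (suc n) = square (suc n) ∷ squares n

  length-squares : ∀ n → length (squares n) ≡ n
  length-squares zero    = ≡.refl
  length-squares (suc n) = ≡.cong suc (length-squares n)

  All-squares : ∀ {P : Carrier → Set} n → (∀ i → 0 ℕ.< i → i ℕ.≤ n → P (square i)) → All P (squares n)
  All-squares zero    f = []
  All-squares (suc n) f = f (suc n) (ℕ.s≤s ℕ.z≤n) ℕₚ.≤-refl ∷ All-squares n (λ i 0<i i≤n → f i 0<i (ℕₚ.m≤n⇒m≤1+n i≤n))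

  squares-differ : ∀ i j → 0 ℕ.< j → j ℕ.< i → i ℕ.≤ h → ¬ square i ≈ square j
  squares-differ i j 0<j j<i i≤h e with domain ((i ℕ.∸ j) · 1#) ((i ℕ.+ j) · 1#) (begin
      ((i ℕ.∸ j) · 1#) * ((i ℕ.+ j) · 1#)
        ≈⟨ *-congˡ (trans (reflexive (≡.cong (λ k → (k ℕ.+ j) · 1#) (≡.sym i-eq))) (trans (×-homo-+ 1# (j ℕ.+ (i ℕ.∸ j)) j) (+-congʳ (×-homo-+ 1# j (i ℕ.∸ j))))) ⟩
      ((i ℕ.∸ j) · 1#) * ((j · 1# + (i ℕ.∸ j) · 1#) + j · 1#)
        ≈⟨ solve 2 (λ d j → d :* ((j :+ d) :+ j) := (j :+ d) :* (j :+ d) :- j :* j) refl ((i ℕ.∸ j) · 1#) (j · 1#) ⟩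
      (j · 1# + (i ℕ.∸ j) · 1#) * (j · 1# + (i ℕ.∸ j) · 1#) - square j
        ≈⟨ +-congʳ (*-cong i-sum i-sum) ⟨
      square i - square j    ≈⟨ +-congʳ e ⟩
      square j - square j    ≈⟨ -‿inverseʳ _ ⟩
      0#                     ∎)
    where
    i-eq : j ℕ.+ (i ℕ.∸ j) ≡ i
    i-eq = ℕₚ.m+[n∸m]≡n (ℕₚ.<⇒≤ j<i)
    i-sum : i · 1# ≈ j · 1# + (i ℕ.∸ j) · 1#
    i-sum = trans (reflexive (≡.cong (_· 1#) (≡.sym i-eq))) (×-homo-+ 1# j (i ℕ.∸ j))
  ... | inj₁ z = n·1≉0 (i ℕ.∸ j) (ℕₚ.m<n⇒0<n∸m j<i) (ℕₚ.≤-<-trans (ℕₚ.m∸n≤m i j) (ℕ.s≤s (ℕₚ.≤-trans i≤h (ℕₚ.m≤m+n h h)))) z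
  ... | inj₂ z = n·1≉0 (i ℕ.+ j) (ℕₚ.<-≤-trans 0<j (ℕₚ.m≤n+m j i))
                   (ℕ.s≤s (ℕₚ.+-mono-≤ i≤h (ℕₚ.<⇒≤ (ℕₚ.<-≤-trans j<i i≤h)))) z

  distinct-squares : ∀ n → n ℕ.≤ h → AllPairs (λ l m → ¬ l ≈ m) (squares n)
  distinct-squares zero    n≤h = []
  distinct-squares (suc n) n≤h =
    All-squares n (λ i 0<i i≤n → squares-differ (suc n) i 0<i (ℕ.s≤s i≤n) n≤h) ∷ distinct-squares n (ℕₚ.<⇒≤ n≤h)

  -- Otherwise u would be one root of xʰ - 1 too many, besides 1², …, h².
  nonsquare-half-power : ∀ u → (∀ z → ¬ z * z ≈ u) → u ^ h ≈ - 1#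
  nonsquare-half-power u nonsquare = [ (λ e → ⊥-elim (1≉0 (one-is-zero e))) , id ]′ (±1 (half-power² u≉0))
    where
    u≉0 : ¬ u ≈ 0#
    u≉0 e = nonsquare 0# (trans (zeroˡ 0#) (sym e))
    f : Poly
    f = X+ 0# ^ₚ h +ₚ const (- 1#)
    eval-f : ∀ l → l ^ h ≈ 1# → DivisibleAt l 1 f
    eval-f l e = quot l f , P.trans (root-factor l f (begin
        eval l f                                         ≈⟨ eval-+ l (X+ 0# ^ₚ h) (const (- 1#)) ⟩
        eval l (X+ 0# ^ₚ h) + eval l (const (- 1#))
          ≈⟨ +-cong (trans (eval-^ l (X+ 0#) h) (trans (^-congˡ h (trans (eval-X+ l 0#) (+-identityʳ l))) e)) (eval-const l _) ⟩
        1# - 1#                                          ≈⟨ -‿inverseʳ 1# ⟩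
        0#                                               ∎))
      (P.*-congʳ (P.sym (P.*-identityʳ (X+ (- l)))))
    one-is-zero : u ^ h ≈ 1# → 1# ≈ 0#
    one-is-zero e = begin
      1#                                                ≈⟨ trans (+-identityʳ _) (leading-coef 0# h) ⟨
      coef (X+ 0# ^ₚ h) h + 0#                          ≈⟨ +-congˡ (beyond (Deg-const (- 1#)) h h>0) ⟨
      coef (X+ 0# ^ₚ h) h + coef (const (- 1#)) h       ≈⟨ coef-+ (X+ 0# ^ₚ h) (const (- 1#)) h ⟨
      coef f h                                          ≈⟨ at (too-many-roots 1 (u ∷ squares h) f
        (All-squares h (λ i _ _ e′ → nonsquare (i · 1#) (sym e′)) ∷ distinct-squares h ℕₚ.≤-refl)
        (eval-f u e ∷ All-squares h (λ i 0<i i≤h → eval-f (square i)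
          (trans (^-distrib-* (i · 1#) (i · 1#) h) (half-power² (n·1≉0 i 0<i (ℕ.s≤s (ℕₚ.≤-trans i≤h (ℕₚ.m≤m+n h h))))))))
        (Small-mono (ℕₚ.≤-reflexive (≡.sym (≡.trans (ℕₚ.*-identityʳ (suc (length (squares h)))) (≡.cong suc (length-squares h)))))
          (Small-+ (Deg-X+^ 0# h) (Small-mono (ℕ.s≤s ℕ.z≤n) (Deg-const _))))) h ⟩
      0#                                                ∎

  ⌜_⌝ : ℕ → Carrier
  ⌜ n ⌝ = n · 1#

  ⌜⌝-+ : ∀ m n → ⌜ m ℕ.+ n ⌝ ≈ ⌜ m ⌝ + ⌜ n ⌝
  ⌜⌝-+ = ×-homo-+ 1#

  ⌜⌝-* : ∀ m n → ⌜ m ℕ.* n ⌝ ≈ ⌜ m ⌝ * ⌜ n ⌝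
  ⌜⌝-* = ×1-homo-*

  ⌜⌝-∸ : ∀ {m n} → m ℕ.≤ n → ⌜ n ⌝ ≈ ⌜ m ⌝ + ⌜ n ℕ.∸ m ⌝
  ⌜⌝-∸ {m} {n} m≤n = trans (reflexive (≡.cong ⌜_⌝ (≡.sym (ℕₚ.m+[n∸m]≡n m≤n)))) (⌜⌝-+ m (n ℕ.∸ m))

  +-cancelˡ : ∀ x {y z} → x + y ≈ x + z → y ≈ z
  +-cancelˡ x {y} {z} e = begin
    y              ≈⟨ solve 2 (λ x y → y := (x :+ y) :- x) refl x y ⟩
    (x + y) - x    ≈⟨ +-congʳ e ⟩
    (x + z) - x    ≈⟨ solve 2 (λ x y → (x :+ y) :- x := y) refl x z ⟩
    z              ∎

  ⌜⌝-distinct : ∀ {m n} → m ℕ.< n → n ℕ.< p → ¬ ⌜ m ⌝ ≈ ⌜ n ⌝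
  ⌜⌝-distinct {m} {n} m<n n<p e = n·1≉0 (n ℕ.∸ m) (ℕₚ.m<n⇒0<n∸m m<n) (ℕₚ.≤-<-trans (ℕₚ.m∸n≤m n m) n<p)
    (+-cancelˡ ⌜ m ⌝ (trans (sym (⌜⌝-∸ (ℕₚ.<⇒≤ m<n))) (trans (sym e) (sym (+-identityʳ _)))))

  ⌜⌝-injective : ∀ {m n} → m ℕ.< p → n ℕ.< p → ⌜ m ⌝ ≈ ⌜ n ⌝ → m ≡ n
  ⌜⌝-injective {m} {n} m<p n<p e with ℕₚ.<-cmp m n
  ... | tri< m<n _ _ = ⊥-elim (⌜⌝-distinct m<n n<p e)
  ... | tri≈ _ m≡n _ = m≡n
  ... | tri> _ _ n<m = ⊥-elim (⌜⌝-distinct n<m m<p (sym e))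

  ⟦⟧-zero : ∀ i → ⟦ i ⟧ℤ ≈ 0# → ℤ.∣ i ∣ ℕ.< p → i ≡ + 0
  ⟦⟧-zero (+ zero)  e lt = ≡.refl
  ⟦⟧-zero (+ suc n) e lt = ⊥-elim (n·1≉0 (suc n) (ℕ.s≤s ℕ.z≤n) lt e)
  ⟦⟧-zero -[1+ n ]  e lt = ⊥-elim (n·1≉0 (suc n) (ℕ.s≤s ℕ.z≤n) lt (begin
    suc n · 1#           ≈⟨ solve 1 (λ x → x := :- :- x) refl _ ⟩
    - ⟦ -[1+ n ] ⟧ℤ      ≈⟨ -‿cong e ⟩
    - 0#                 ≈⟨ solve 0 (:- con (+ 0) := con (+ 0)) refl ⟩
    0#                   ∎))

  ⟦⟧-injective : ∀ i j → ⟦ i ⟧ℤ ≈ ⟦ j ⟧ℤ → ℤ.∣ i ∣ ℕ.+ ℤ.∣ j ∣ ℕ.< p → i ≡ j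
  ⟦⟧-injective i j e lt = ℤₚ.i-j≡0⇒i≡j i j (⟦⟧-zero (i ℤ.- j)
    (trans (⟦+⟧ i (ℤ.- j)) (trans (+-cong e (⟦-⟧ j)) (-‿inverseʳ _)))
    (ℕₚ.≤-<-trans (ℤₚ.∣i-j∣≤∣i∣+∣j∣ i j) lt))

  *-nonzero : ∀ {x y} → ¬ x ≈ 0# → ¬ y ≈ 0# → ¬ x * y ≈ 0#
  *-nonzero x≉0 y≉0 e = [ x≉0 , y≉0 ]′ (domain _ _ e)

  -- This is xᵖ⁻², split so that x times it becomes xʰ xʰ.
  inv : Carrier → Carrier
  inv x = x ^ (h ℕ.∸ 1) * x ^ h

  *-inv : ∀ {x} → ¬ x ≈ 0# → x * inv x ≈ 1#
  *-inv {x} x≉0 = begin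
    x * (x ^ (h ℕ.∸ 1) * x ^ h)   ≈⟨ *-assoc _ _ _ ⟨
    x ^ suc (h ℕ.∸ 1) * x ^ h     ≡⟨ ≡.cong (λ k → x ^ k * x ^ h) (ℕₚ.m+[n∸m]≡n h>0) ⟩
    x ^ h * x ^ h                 ≈⟨ half-power² x≉0 ⟩
    1#                            ∎

  -- Points of the cubic and runs of equal quadratic character

  module Curve (a c : Carrier) (a≉0 : ¬ a ≈ 0#) (3<p : 3 ℕ.< p) where

    curve : Carrier → Carrier
    curve x = a * (x * x * x) + c * x

    curve-cong : ∀ {x y} → x ≈ y → curve x ≈ curve y
    curve-cong e = +-cong (*-congˡ (*-cong (*-cong e e) e)) (*-congˡ e)

    -- The negated goal in terms of the field: x is the abscissa of one point, y the lower edge of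
    -- the box, and 0 < i < p makes the two points distinct.
    NoPair : ℕ → Set
    NoPair H = ∀ x y i j₁ j₂ → 0 ℕ.< i → i ℕ.< p → i ℕ.< H → j₁ ℕ.< H → j₂ ℕ.< H →
      curve x ≈ y + ⌜ j₁ ⌝ → ¬ curve (x + ⌜ i ⌝) ≈ y + ⌜ j₂ ⌝

    φ : ℕ → Carrier
    φ m = curve ⌜ m ⌝

    -- The coefficient of y² in half of f(y + m) - f(y - m).
    slope : ℕ → Carrier
    slope m = ⌜ 3 ⌝ * a * ⌜ m ⌝

    slope≉0 : ∀ {m} → 0 ℕ.< m → m ℕ.< p → ¬ slope m ≈ 0#
    slope≉0 0<m m<p = *-nonzero (*-nonzero (n·1≉0 3 (ℕ.s≤s ℕ.z≤n) 3<p) a≉0) (n·1≉0 _ 0<m m<p)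

    module WithoutPairs (H : ℕ) (noPair : NoPair H) where

      -- The points with abscissae y - m and y + m differ vertically by 2 (3 a m y² + φ m).
      nonsquare : ∀ m s → 0 ℕ.< m → m ℕ.+ m ℕ.< p → m ℕ.+ m ℕ.< H → s ℕ.+ s ℕ.< H →
                  ∀ z → ¬ z * z ≈ slope m * (⌜ s ⌝ - φ m)
      nonsquare m s 0<m 2m<p 2m<H 2s<H z e =
        noPair (y - ⌜ m ⌝) (curve (y - ⌜ m ⌝)) (m ℕ.+ m) 0 (s ℕ.+ s) (ℕₚ.<-≤-trans 0<m (ℕₚ.m≤m+n m m)) 2m<p 2m<H
          (ℕₚ.≤-<-trans ℕ.z≤n 2m<H) 2s<H (sym (+-identityʳ _)) (begin
          curve (y - ⌜ m ⌝ + ⌜ m ℕ.+ m ⌝)   ≈⟨ curve-cong (trans (+-congˡ (⌜⌝-+ m m))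
                                                 (solve 2 (λ y m → y :- m :+ (m :+ m) := y :+ m) refl y ⌜ m ⌝)) ⟩
          curve (y + ⌜ m ⌝)
            ≈⟨ solve 4 (λ a c y m →
                 a :* ((y :+ m) :* (y :+ m) :* (y :+ m)) :+ c :* (y :+ m) :=
                 (a :* ((y :- m) :* (y :- m) :* (y :- m)) :+ c :* (y :- m)) :+
                 ((con (+ 3) :* a :* m :* (y :* y) :+ (a :* (m :* m :* m) :+ c :* m)) :+
                  (con (+ 3) :* a :* m :* (y :* y) :+ (a :* (m :* m :* m) :+ c :* m)))) refl a c y ⌜ m ⌝ ⟩
          curve (y - ⌜ m ⌝) + ((slope m * (y * y) + φ m) + (slope m * (y * y) + φ m))
            ≈⟨ +-congˡ (+-cong rise rise) ⟩
          curve (y - ⌜ m ⌝) + (⌜ s ⌝ + ⌜ s ⌝)   ≈⟨ +-congˡ (⌜⌝-+ s s) ⟨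
          curve (y - ⌜ m ⌝) + ⌜ s ℕ.+ s ⌝       ∎)
        where
        -- Dividing z² = 3am (s - f(m)) by 3am turns it into 3am y² = s - f(m).
        y = z * inv (slope m)
        sl≉0 = slope≉0 0<m (ℕₚ.≤-<-trans (ℕₚ.m≤m+n m m) 2m<p)
        rise : slope m * (y * y) + φ m ≈ ⌜ s ⌝
        rise = begin
          slope m * (y * y) + φ m
            ≈⟨ +-congʳ (solve 3 (λ k z i → k :* ((z :* i) :* (z :* i)) := (z :* z) :* i :* (k :* i)) refl (slope m) z (inv (slope m))) ⟩
          z * z * inv (slope m) * (slope m * inv (slope m)) + φ m
            ≈⟨ +-congʳ (*-cong (*-congʳ e) (*-inv sl≉0)) ⟩
          slope m * (⌜ s ⌝ - φ m) * inv (slope m) * 1# + φ m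
            ≈⟨ +-congʳ (solve 3 (λ k x i → k :* x :* i :* con (+ 1) := (k :* i) :* x) refl (slope m) (⌜ s ⌝ - φ m) (inv (slope m))) ⟩
          slope m * inv (slope m) * (⌜ s ⌝ - φ m) + φ m
            ≈⟨ +-congʳ (*-congʳ (*-inv sl≉0)) ⟩
          1# * (⌜ s ⌝ - φ m) + φ m
            ≈⟨ solve 2 (λ s f → con (+ 1) :* (s :- f) :+ f := s) refl ⌜ s ⌝ (φ m) ⟩
          ⌜ s ⌝ ∎

      sign : ℕ → Carrier
      sign m = - (slope m ^ h)

      -- By Euler's criterion the product with `slope m` has hth power -1, and `slope m ^ h` is its
      -- own inverse. The result depends on m alone.
      half-power : ∀ m s → 0 ℕ.< m → m ℕ.+ m ℕ.< p → m ℕ.+ m ℕ.< H → s ℕ.+ s ℕ.< H → (⌜ s ⌝ - φ m) ^ h ≈ sign m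
      half-power m s 0<m 2m<p 2m<H 2s<H = begin
        x ^ h                                      ≈⟨ *-identityˡ _ ⟨
        1# * x ^ h                                 ≈⟨ *-congʳ (half-power² sl≉0) ⟨
        slope m ^ h * slope m ^ h * x ^ h          ≈⟨ *-assoc _ _ _ ⟩
        slope m ^ h * (slope m ^ h * x ^ h)        ≈⟨ *-congˡ (^-distrib-* (slope m) x h) ⟨
        slope m ^ h * (slope m * x) ^ h            ≈⟨ *-congˡ (nonsquare-half-power _ (nonsquare m s 0<m 2m<p 2m<H 2s<H)) ⟩
        slope m ^ h * (- 1#)                       ≈⟨ solve 1 (λ y → y :* (:- con (+ 1)) := :- y) refl _ ⟩
        - (slope m ^ h)                            ∎
        where
        x = ⌜ s ⌝ - φ m
        sl≉0 = slope≉0 0<m (ℕₚ.≤-<-trans (ℕₚ.m≤m+n m m) 2m<p)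

      -- Otherwise f(m) - v = f(m′) - v′ is the lower edge of a box with the points of abscissae m
      -- and m′.
      rows-differ : ∀ {m m′} v v′ → m ℕ.< m′ → m′ ℕ.< p → m′ ℕ.< H → v ℕ.< H → v′ ℕ.< H →
                    ¬ ⌜ v ⌝ - φ m ≈ ⌜ v′ ⌝ - φ m′
      rows-differ {m} {m′} v v′ m<m′ m′<p m′<H v<H v′<H e =
        noPair ⌜ m ⌝ (φ m - ⌜ v ⌝) (m′ ℕ.∸ m) v v′ (ℕₚ.m<n⇒0<n∸m m<m′)
          (ℕₚ.≤-<-trans (ℕₚ.m∸n≤m m′ m) m′<p) (ℕₚ.≤-<-trans (ℕₚ.m∸n≤m m′ m) m′<H) v<H v′<H
          (solve 2 (λ x v → x := (x :- v) :+ v) refl (φ m) ⌜ v ⌝)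
          (begin
            curve (⌜ m ⌝ + ⌜ m′ ℕ.∸ m ⌝)                 ≈⟨ curve-cong (⌜⌝-∸ (ℕₚ.<⇒≤ m<m′)) ⟨
            φ m′                                         ≈⟨ solve 2 (λ x v → x := v :- (v :- x)) refl (φ m′) ⌜ v′ ⌝ ⟩
            ⌜ v′ ⌝ - (⌜ v′ ⌝ - φ m′)                     ≈⟨ +-congˡ (-‿cong e) ⟨
            ⌜ v′ ⌝ - (⌜ v ⌝ - φ m)                       ≈⟨ solve 3 (λ x v w → w :- (v :- x) := (x :- v) :+ w) refl (φ m) ⌜ v ⌝ ⌜ v′ ⌝ ⟩
            (φ m - ⌜ v ⌝) + ⌜ v′ ⌝                       ∎)

      rows-injective : ∀ {m m′ v v′} → m ℕ.< p → m ℕ.< H → m′ ℕ.< p → m′ ℕ.< H → v ℕ.< H → v′ ℕ.< H → v ℕ.< p → v′ ℕ.< p →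
                       ⌜ v ⌝ - φ m ≈ ⌜ v′ ⌝ - φ m′ → m ≡ m′ × v ≡ v′
      rows-injective {m} {m′} {v} {v′} m<p m<H m′<p m′<H v<H v′<H v<p v′<p e with ℕₚ.<-cmp m m′
      ... | tri< m<m′ _ _ = ⊥-elim (rows-differ v v′ m<m′ m′<p m′<H v<H v′<H e)
      ... | tri> _ _ m′<m = ⊥-elim (rows-differ v′ v m′<m m<p m<H v′<H v<H (sym e))
      ... | tri≈ _ ≡.refl _ = ≡.refl , ⌜⌝-injective v<p v′<p (begin
        ⌜ v ⌝                   ≈⟨ solve 2 (λ v f → v := (v :- f) :+ f) refl ⌜ v ⌝ (φ m) ⟩
        (⌜ v ⌝ - φ m) + φ m     ≈⟨ +-congʳ e ⟩
        (⌜ v′ ⌝ - φ m) + φ m    ≈⟨ solve 2 (λ v f → v := (v :- f) :+ f) refl ⌜ v′ ⌝ (φ m) ⟨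
        ⌜ v′ ⌝                  ∎)

      Triple : Set
      Triple = ℕ × ℕ × ℕ

      ratio : Triple → Carrier
      ratio (m , v , w) = (⌜ v ⌝ - φ m) * inv ⌜ w ⌝

      *-ratio : ∀ m v {w} → 0 ℕ.< w → w ℕ.< p → ⌜ w ⌝ * ratio (m , v , w) ≈ ⌜ v ⌝ - φ m
      *-ratio m v {w} 0<w w<p = begin
        ⌜ w ⌝ * ((⌜ v ⌝ - φ m) * inv ⌜ w ⌝)   ≈⟨ solve 3 (λ w x i → w :* (x :* i) := (w :* i) :* x) refl ⌜ w ⌝ (⌜ v ⌝ - φ m) (inv ⌜ w ⌝) ⟩
        ⌜ w ⌝ * inv ⌜ w ⌝ * (⌜ v ⌝ - φ m)     ≈⟨ *-congʳ (*-inv (n·1≉0 w 0<w w<p)) ⟩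
        1# * (⌜ v ⌝ - φ m)                    ≈⟨ *-identityˡ _ ⟩
        ⌜ v ⌝ - φ m                           ∎

      record Valid (k : ℕ) (x : Triple) : Set where
        constructor valid
        field
          0<m  : 0 ℕ.< proj₁ x
          2m<p : proj₁ x ℕ.+ proj₁ x ℕ.< p
          2m<H : proj₁ x ℕ.+ proj₁ x ℕ.< H
          0<w  : 0 ℕ.< proj₂ (proj₂ x)
          w<p  : proj₂ (proj₂ x) ℕ.< p
          -- Scaled by w, the run λ + 1, ..., λ + k ends at v + w k - f(m), and `half-power` asks
          -- for twice the offset v + w k to be below H.
          2s<H : let s = proj₁ (proj₂ x) ℕ.+ proj₂ (proj₂ x) ℕ.* k in s ℕ.+ s ℕ.< H

      tripleSign : Triple → Carrier
      tripleSign (m , v , w) = sign m * ⌜ w ⌝ ^ h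

      -- Multiplication by w gives v + w (i + 1) - f(m), whose hth power is `sign m`; wʰ is its own
      -- inverse.
      ratio-run : ∀ k x → Valid k x → ∀ i → i ℕ.< k → (ratio x + t i) ^ h ≈ tripleSign x
      ratio-run k x@(m , v , w) vx i i<k = begin
        (ratio x + t i) ^ h                              ≈⟨ *-identityˡ _ ⟨
        1# * (ratio x + t i) ^ h                         ≈⟨ *-congʳ (half-power² w≉0) ⟨
        ⌜ w ⌝ ^ h * ⌜ w ⌝ ^ h * (ratio x + t i) ^ h      ≈⟨ solve 2 (λ a b → a :* a :* b := a :* b :* a) refl _ _ ⟩
        ⌜ w ⌝ ^ h * (ratio x + t i) ^ h * ⌜ w ⌝ ^ h      ≈⟨ *-congʳ (^-distrib-* ⌜ w ⌝ _ h) ⟨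
        (⌜ w ⌝ * (ratio x + t i)) ^ h * ⌜ w ⌝ ^ h        ≈⟨ *-congʳ (^-congˡ h (begin
          ⌜ w ⌝ * (ratio x + t i)                ≈⟨ distribˡ _ _ _ ⟩
          ⌜ w ⌝ * ratio x + ⌜ w ⌝ * ⌜ suc i ⌝    ≈⟨ +-cong (*-ratio m v 0<w w<p) (sym (⌜⌝-* w (suc i))) ⟩
          ⌜ v ⌝ - φ m + ⌜ w ℕ.* suc i ⌝          ≈⟨ solve 3 (λ v f y → v :- f :+ y := v :+ y :- f) refl ⌜ v ⌝ (φ m) ⌜ w ℕ.* suc i ⌝ ⟩
          ⌜ v ⌝ + ⌜ w ℕ.* suc i ⌝ - φ m          ≈⟨ +-congʳ (⌜⌝-+ v (w ℕ.* suc i)) ⟨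
          ⌜ v ℕ.+ w ℕ.* suc i ⌝ - φ m            ∎)) ⟩
        (⌜ v ℕ.+ w ℕ.* suc i ⌝ - φ m) ^ h * ⌜ w ⌝ ^ h
          ≈⟨ *-congʳ (half-power m (v ℕ.+ w ℕ.* suc i) 0<m 2m<p 2m<H (ℕₚ.≤-<-trans (ℕₚ.+-mono-≤ below below) 2s<H)) ⟩
        sign m * ⌜ w ⌝ ^ h                               ∎
        where
        open Valid vx
        w≉0 = n·1≉0 w 0<w w<p
        below : v ℕ.+ w ℕ.* suc i ℕ.≤ v ℕ.+ w ℕ.* k
        below = ℕₚ.+-monoʳ-≤ v (ℕₚ.*-monoʳ-≤ w i<k)

      tripleSign-±1 : ∀ k x → Valid k x → tripleSign x ≈ 1# ⊎ tripleSign x ≈ - 1#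
      tripleSign-±1 k x@(m , v , w) vx = ±1 (begin
        (- s * y) * (- s * y)     ≈⟨ solve 2 (λ s y → (:- s :* y) :* (:- s :* y) := (s :* s) :* (y :* y)) refl s y ⟩
        (s * s) * (y * y)         ≈⟨ *-cong (half-power² (slope≉0 0<m (ℕₚ.≤-<-trans (ℕₚ.m≤m+n m m) 2m<p))) (half-power² (n·1≉0 w 0<w w<p)) ⟩
        1# * 1#                   ≈⟨ *-identityˡ 1# ⟩
        1#                        ∎)
        where
        open Valid vx
        s = slope m ^ h
        y = ⌜ w ⌝ ^ h

      -1≉0 : ¬ - 1# ≈ 0#
      -1≉0 e = 1≉0 (trans (solve 0 (con (+ 1) := :- :- con (+ 1)) refl) (trans (-‿cong e) (solve 0 (:- con (+ 0) := con (+ 0)) refl)))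

      -- Stepanov's bound is for a fixed value e of the run, so it is applied once for 1 and once
      -- for -1.
      few-triples : ∀ k M n → k ℕ.< p → M ℕ.≤ p → M ℕ.* suc (n ℕ.+ M ℕ.* k) ℕ.< dim n k → fullNormDegree k n ℕ.< p →
        ∀ xs → All (Valid k) xs → AllPairs (λ x y → ¬ ratio x ≈ ratio y) xs →
        length xs ℕ.* M ℕ.≤ (n ℕ.+ k ℕ.* suc h) ℕ.+ (n ℕ.+ k ℕ.* suc h)
      few-triples k M n k<p M≤p lt deg xs valids distinct =
        ≡.subst (ℕ._≤ (n ℕ.+ k ℕ.* suc h) ℕ.+ (n ℕ.+ k ℕ.* suc h))
          (≡.trans (≡.sym (ℕₚ.*-distribʳ-+ M (length (filter positive? xs)) _)) (≡.cong (ℕ._* M) (length-filter-¬ positive? xs)))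
          (ℕₚ.+-mono-≤
            (bound 1# 1≉0 (filter positive? xs)
              (All.zip (Allₚ.filter⁺ positive? valids , Allₚ.all-filter positive? xs))
              (AllPairsₚ.filter⁺ positive? distinct))
            (bound (- 1#) -1≉0 (filter (¬? ∘ positive?) xs)
              (All.zipWith (λ {x} (vx , s≉1) → vx , [ (λ s≈1 → ⊥-elim (s≉1 s≈1)) , id ]′ (tripleSign-±1 k x vx))
                (Allₚ.filter⁺ (¬? ∘ positive?) valids , Allₚ.all-filter (¬? ∘ positive?) xs))
              (AllPairsₚ.filter⁺ (¬? ∘ positive?) distinct)))
        where
        positive? : ∀ x → Dec (tripleSign x ≈ 1#)
        positive? x = tripleSign x ≈? 1#
        bound : ∀ e → ¬ e ≈ 0# → ∀ ys → All (λ x → Valid k x × tripleSign x ≈ e) ys →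
                AllPairs (λ x y → ¬ ratio x ≈ ratio y) ys → length ys ℕ.* M ℕ.≤ n ℕ.+ k ℕ.* suc h
        bound e e≉0 ys signs dist = ≡.subst (λ l → l ℕ.* M ℕ.≤ n ℕ.+ k ℕ.* suc h) (length-map ratio ys)
          (few-constant-runs e e≉0 k M n k<p M≤p lt deg (map ratio ys) (AllPairsₚ.map⁺ dist)
            (Allₚ.map⁺ (All.map (λ {x} (vx , s) i i<k → trans (ratio-run k x vx i i<k) s) signs)))

      -- Triples with distinct ratios

      module Parameters (A U k : ℕ) (ws : List ℕ) where

        -- Among J = 2A rows, A are bad or A are not. A good row loses at most 2A of its V = 4A
        -- columns for each w; in a bad row each column loses at most A of at least 4A denominators.
        -- R bounds sums of two products w v, and Z bounds the numerators in bad rows.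
        J V R Z : ℕ
        J = 2 ℕ.* A
        V = 4 ℕ.* A
        R = 4 ℕ.* (U ℕ.* V)
        Z = U ℕ.* V ℕ.+ R ℕ.+ (R ℕ.+ R)

        module Hypotheses (M n : ℕ) (k<p : k ℕ.< p) (M≤p : M ℕ.≤ p)
          (unknowns : M ℕ.* suc (n ℕ.+ M ℕ.* k) ℕ.< 2 ℕ.^ k ℕ.* suc n) (normDegree : 2 ℕ.^ k ℕ.* (n ℕ.+ k ℕ.+ 2) ℕ.≤ p)
          (coprimes : AllPairs Coprime ws) (ws-unique : Unique ws) (block : All (λ w → U ℕ.< w × w ℕ.≤ U ℕ.+ U) ws)
          (many-ws : V ℕ.≤ length ws) (V≤U : V ℕ.≤ U) (U<p : U ℕ.+ U ℕ.< p) (J<p : J ℕ.+ J ℕ.< p) (J<H : J ℕ.+ J ℕ.< H)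
          (run<H : (V ℕ.+ (U ℕ.+ U) ℕ.* k) ℕ.+ (V ℕ.+ (U ℕ.+ U) ℕ.* k) ℕ.< H)
          (Z<p : Z ℕ.* (U ℕ.* (U ℕ.+ U)) ℕ.+ Z ℕ.* (U ℕ.* (U ℕ.+ U)) ℕ.< p)
          (R<p : R ℕ.< p) (Z<2^A : Z ℕ.< 2 ℕ.^ suc A)
          (degree : (n ℕ.+ k ℕ.* suc h) ℕ.+ (n ℕ.+ k ℕ.* suc h) ℕ.< A ℕ.* V ℕ.* (2 ℕ.* A) ℕ.* M)
          where

          record InRange (x : Triple) : Set where
            constructor inRange
            field
              0<m  : 0 ℕ.< proj₁ x
              m≤J  : proj₁ x ℕ.≤ J
              v<V  : proj₁ (proj₂ x) ℕ.< V
              w∈ws : proj₂ (proj₂ x) ∈ ws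
            U<w : U ℕ.< proj₂ (proj₂ x)
            U<w = proj₁ (All.lookup block w∈ws)
            w≤2U : proj₂ (proj₂ x) ℕ.≤ U ℕ.+ U
            w≤2U = proj₂ (All.lookup block w∈ws)
            0<w : 0 ℕ.< proj₂ (proj₂ x)
            0<w = ℕₚ.≤-<-trans ℕ.z≤n U<w
            w<p : proj₂ (proj₂ x) ℕ.< p
            w<p = ℕₚ.≤-<-trans w≤2U U<p
            m<p : proj₁ x ℕ.< p
            m<p = ℕₚ.≤-<-trans (ℕₚ.≤-trans m≤J (ℕₚ.m≤m+n J J)) J<p
            m<H : proj₁ x ℕ.< H
            m<H = ℕₚ.≤-<-trans (ℕₚ.≤-trans m≤J (ℕₚ.m≤m+n J J)) J<H
            v<p : proj₁ (proj₂ x) ℕ.< p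
            v<p = ℕₚ.<-trans v<V (ℕₚ.≤-<-trans (ℕₚ.≤-trans V≤U (ℕₚ.m≤m+n U U)) U<p)
            v<H : proj₁ (proj₂ x) ℕ.< H
            v<H = ℕₚ.<-≤-trans v<V (ℕₚ.≤-trans (ℕₚ.m≤m+n V _) (ℕₚ.≤-trans (ℕₚ.m≤m+n _ _) (ℕₚ.<⇒≤ run<H)))

          valid-inRange : ∀ {x} → InRange x → Valid k x
          valid-inRange {m , v , w} r = valid 0<m (ℕₚ.≤-<-trans (ℕₚ.+-mono-≤ m≤J m≤J) J<p)
            (ℕₚ.≤-<-trans (ℕₚ.+-mono-≤ m≤J m≤J) J<H) 0<w w<p (ℕₚ.≤-<-trans (ℕₚ.+-mono-≤ s≤ s≤) run<H)
            where
            open InRange r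
            s≤ : v ℕ.+ w ℕ.* k ℕ.≤ V ℕ.+ (U ℕ.+ U) ℕ.* k
            s≤ = ℕₚ.+-mono-≤ (ℕₚ.<⇒≤ v<V) (ℕₚ.*-monoˡ-≤ k w≤2U)

          same-denominator : ∀ {m v w m′ v′ w′} → InRange (m , v , w) → InRange (m′ , v′ , w′) → w ≡ w′ →
                             ratio (m , v , w) ≈ ratio (m′ , v′ , w′) → m ≡ m′ × v ≡ v′
          same-denominator {m} {v} {w} {m′} {v′} r r′ ≡.refl e = rows-injective (m<p r) (m<H r) (m<p r′) (m<H r′) (v<H r) (v<H r′) (v<p r) (v<p r′)
            (trans (sym (*-ratio m v (0<w r) (w<p r))) (trans (*-congˡ e) (*-ratio m′ v′ (0<w r′) (w<p r′))))
            where open InRange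

          coprime-ws : ∀ {w w′} → w ∈ ws → w′ ∈ ws → w ≢ w′ → Coprime w w′
          coprime-ws = allPairs-lookup {R = Coprime} (λ {x} c → Coprimality.sym {x} c) coprimes

          -- Both cases end here. They discard values of v for fixed (m , w), or of w for fixed (m ,
          -- v), so they nest the components differently; `tr` restores the order.
          too-many-triples : ∀ {B : Set} (tr : B → Triple) (Q : B → Set) xs → Unique xs → All Q xs → (∀ x → Q x → InRange (tr x)) →
            (∀ x y → Q x → Q y → x ≢ y → ¬ ratio (tr x) ≈ ratio (tr y)) → A ℕ.* V ℕ.* (2 ℕ.* A) ℕ.≤ length xs → ⊥
          too-many-triples tr Q xs unique allQ range distinct many = ℕₚ.<⇒≱ degree
            (ℕₚ.≤-trans (ℕₚ.*-monoˡ-≤ M (≡.subst (A ℕ.* V ℕ.* (2 ℕ.* A) ℕ.≤_) (≡.sym (length-map tr xs)) many))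
              (few-triples k M n k<p M≤p (≡.subst (M ℕ.* suc (n ℕ.+ M ℕ.* k) ℕ.<_) (≡.sym (dim≡ n k)) unknowns)
                (ℕₚ.<-≤-trans (ℕₚ.m<m+n _ (ℕ.s≤s ℕ.z≤n)) (ℕₚ.≤-trans (fullNormDegree-bound k n) normDegree)) (map tr xs)
                (Allₚ.map⁺ (All.map (λ {x} q → valid-inRange (range x q)) allQ))
                (AllPairsₚ.map⁺ (allPairs-from-unique distinct unique allQ))))

          -- φ m is a fraction modulo p with denominator d < U and numerator r - R of absolute value at most R.
          Bad : ℕ → Set
          Bad m = Σ (Fin U) λ d → Σ (Fin (suc (R ℕ.+ R))) λ r → 0 ℕ.< toℕ d × ⌜ toℕ d ⌝ * φ m + ⌜ R ⌝ ≈ ⌜ toℕ r ⌝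

          bad? : ∀ m → Dec (Bad m)
          bad? m = any? λ d → any? λ r → (0 ℕ.<? toℕ d) ×-dec ((⌜ toℕ d ⌝ * φ m + ⌜ R ⌝) ≈? ⌜ toℕ r ⌝)

          rows : List ℕ
          rows = applyUpTo suc J

          rows-unique : Unique rows
          rows-unique = Uniqueₚ.applyUpTo⁺₁ suc J (λ i<j _ e → ℕₚ.<⇒≢ i<j (ℕₚ.suc-injective e))

          ∈rows : ∀ {m} → m ∈ rows → 0 ℕ.< m × m ℕ.≤ J
          ∈rows m∈ with i , i<J , ≡.refl ← ∈-applyUpTo⁻ suc m∈ = ℕ.s≤s ℕ.z≤n , i<J

          product≤R : ∀ {w v} → w ℕ.≤ U ℕ.+ U → v ℕ.≤ V → w ℕ.* v ℕ.≤ 2 ℕ.* (U ℕ.* V)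
          product≤R w≤ v≤ = ℕₚ.≤-trans (ℕₚ.*-mono-≤ w≤ v≤) (ℕₚ.≤-reflexive (lemma U V))
            where
            lemma : ∀ U V → (U ℕ.+ U) ℕ.* V ≡ 2 ℕ.* (U ℕ.* V)
            lemma = solve-∀

          sum≤R : ∀ {x y} → x ℕ.≤ 2 ℕ.* (U ℕ.* V) → y ℕ.≤ 2 ℕ.* (U ℕ.* V) → x ℕ.+ y ℕ.≤ R
          sum≤R x≤ y≤ = ℕₚ.≤-trans (ℕₚ.+-mono-≤ x≤ y≤) (ℕₚ.≤-reflexive (lemma (U ℕ.* V)))
            where
            lemma : ∀ x → 2 ℕ.* x ℕ.+ 2 ℕ.* x ≡ 4 ℕ.* x
            lemma = solve-∀

          cross : ∀ {m v w m′ v′ w′} → InRange (m , v , w) → InRange (m′ , v′ , w′) → ratio (m , v , w) ≈ ratio (m′ , v′ , w′) →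
                  ⌜ w′ ⌝ * (⌜ v ⌝ - φ m) ≈ ⌜ w ⌝ * (⌜ v′ ⌝ - φ m′)
          cross {m} {v} {w} {m′} {v′} {w′} r r′ e = begin
            ⌜ w′ ⌝ * (⌜ v ⌝ - φ m)                     ≈⟨ *-congˡ (*-ratio m v (0<w r) (w<p r)) ⟨
            ⌜ w′ ⌝ * (⌜ w ⌝ * ratio (m , v , w))       ≈⟨ *-congˡ (*-congˡ e) ⟩
            ⌜ w′ ⌝ * (⌜ w ⌝ * ratio (m′ , v′ , w′))    ≈⟨ solve 3 (λ a b x → a :* (b :* x) := b :* (a :* x)) refl ⌜ w′ ⌝ ⌜ w ⌝ (ratio (m′ , v′ , w′)) ⟩
            ⌜ w ⌝ * (⌜ w′ ⌝ * ratio (m′ , v′ , w′))    ≈⟨ *-congˡ (*-ratio m′ v′ (0<w r′) (w<p r′)) ⟩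
            ⌜ w ⌝ * (⌜ v′ ⌝ - φ m′)                    ∎
            where open InRange

          -- Two collisions of the row m with the row m′ give w₁ - w₂ as a denominator for φ m.
          no-second-denominator : ∀ {m v₁ v₂ w m′ v₁′ v₂′ w₁ w₂} → ¬ Bad m → InRange (m , v₁ , w) → InRange (m , v₂ , w) →
            InRange (m′ , v₁′ , w₁) → InRange (m′ , v₂′ , w₂) →
            ratio (m , v₁ , w) ≈ ratio (m′ , v₁′ , w₁) → ratio (m , v₂ , w) ≈ ratio (m′ , v₂′ , w₂) → ¬ w₂ ℕ.< w₁
          no-second-denominator {m} {v₁} {v₂} {w} {m′} {v₁′} {v₂′} {w₁} {w₂} good r₁ r₂ r₁′ r₂′ e₁ e₂ w₂<w₁ =
            good (fromℕ< d<U , fromℕ< {r} (ℕ.s≤s r≤2R) , ≡.subst (0 ℕ.<_) (≡.sym (Finₚ.toℕ-fromℕ< d<U)) (ℕₚ.m<n⇒0<n∸m w₂<w₁) ,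
              ≡.subst₂ (λ x y → ⌜ x ⌝ * φ m + ⌜ R ⌝ ≈ ⌜ y ⌝) (≡.sym (Finₚ.toℕ-fromℕ< d<U)) (≡.sym (Finₚ.toℕ-fromℕ< (ℕ.s≤s r≤2R))) relation)
            where
            open InRange
            d r plus minus : ℕ
            d = w₁ ℕ.∸ w₂
            -- The difference of the two cross-multiplied coincidences is (w₁ - w₂) φ m = `plus` -
            -- `minus`; adding R keeps the numerator a natural number.
            plus = w₁ ℕ.* v₁ ℕ.+ w ℕ.* v₂′
            minus = w ℕ.* v₁′ ℕ.+ w₂ ℕ.* v₂
            r = (plus ℕ.+ R) ℕ.∸ minus
            d<U : d ℕ.< U
            d<U = ℕₚ.≤-<-trans (ℕₚ.∸-monoˡ-≤ w₂ (w≤2U r₁′)) (ℕₚ.+-cancelʳ-< w₂ _ U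
              (≡.subst (ℕ._< U ℕ.+ w₂) (≡.sym (ℕₚ.m∸n+n≡m (w≤2U r₂′))) (ℕₚ.+-monoʳ-< U (U<w r₂′))))
            plus≤R : plus ℕ.≤ R
            plus≤R = sum≤R (product≤R (w≤2U r₁′) (ℕₚ.<⇒≤ (v<V r₁))) (product≤R (w≤2U r₁) (ℕₚ.<⇒≤ (v<V r₂′)))
            minus≤R : minus ℕ.≤ R
            minus≤R = sum≤R (product≤R (w≤2U r₁) (ℕₚ.<⇒≤ (v<V r₁′))) (product≤R (w≤2U r₂′) (ℕₚ.<⇒≤ (v<V r₂)))
            r≤2R : r ℕ.≤ R ℕ.+ R
            r≤2R = ℕₚ.≤-trans (ℕₚ.m∸n≤m _ minus) (ℕₚ.+-monoˡ-≤ R plus≤R)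
            relation : ⌜ d ⌝ * φ m + ⌜ R ⌝ ≈ ⌜ r ⌝
            relation = +-cancelˡ ⌜ minus ⌝ (trans (sym (begin
              ⌜ plus ℕ.+ R ⌝
                ≈⟨ trans (⌜⌝-+ plus R) (+-congʳ (trans (⌜⌝-+ (w₁ ℕ.* v₁) (w ℕ.* v₂′)) (+-cong (⌜⌝-* w₁ v₁) (⌜⌝-* w v₂′)))) ⟩
              ⌜ w₁ ⌝ * ⌜ v₁ ⌝ + ⌜ w ⌝ * ⌜ v₂′ ⌝ + ⌜ R ⌝
                ≈⟨ solve 7 (λ w₁ v₁ w v₂′ R f f′ → w₁ :* v₁ :+ w :* v₂′ :+ R :=
                     w₁ :* (v₁ :- f) :+ (w :* (v₂′ :- f′) :+ w :* f′) :+ w₁ :* f :+ R) refl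
                     ⌜ w₁ ⌝ ⌜ v₁ ⌝ ⌜ w ⌝ ⌜ v₂′ ⌝ ⌜ R ⌝ (φ m) (φ m′) ⟩
              ⌜ w₁ ⌝ * (⌜ v₁ ⌝ - φ m) + (⌜ w ⌝ * (⌜ v₂′ ⌝ - φ m′) + ⌜ w ⌝ * φ m′) + ⌜ w₁ ⌝ * φ m + ⌜ R ⌝
                ≈⟨ +-congʳ (+-cong (+-cong (cross r₁ r₁′ e₁) (+-congʳ (sym (cross r₂ r₂′ e₂)))) (*-congʳ (⌜⌝-∸ (ℕₚ.<⇒≤ w₂<w₁)))) ⟩
              ⌜ w ⌝ * (⌜ v₁′ ⌝ - φ m′) + (⌜ w₂ ⌝ * (⌜ v₂ ⌝ - φ m) + ⌜ w ⌝ * φ m′) + (⌜ w₂ ⌝ + ⌜ d ⌝) * φ m + ⌜ R ⌝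
                ≈⟨ solve 8 (λ w₂ v₂ w v₁′ R f f′ d →
                     w :* (v₁′ :- f′) :+ (w₂ :* (v₂ :- f) :+ w :* f′) :+ (w₂ :+ d) :* f :+ R :=
                     (w :* v₁′ :+ w₂ :* v₂) :+ (d :* f :+ R)) refl
                     ⌜ w₂ ⌝ ⌜ v₂ ⌝ ⌜ w ⌝ ⌜ v₁′ ⌝ ⌜ R ⌝ (φ m) (φ m′) ⌜ d ⌝ ⟩
              (⌜ w ⌝ * ⌜ v₁′ ⌝ + ⌜ w₂ ⌝ * ⌜ v₂ ⌝) + (⌜ d ⌝ * φ m + ⌜ R ⌝)
                ≈⟨ +-congʳ (trans (⌜⌝-+ (w ℕ.* v₁′) (w₂ ℕ.* v₂)) (+-cong (⌜⌝-* w v₁′) (⌜⌝-* w₂ v₂))) ⟨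
              ⌜ minus ⌝ + (⌜ d ⌝ * φ m + ⌜ R ⌝) ∎))
              (⌜⌝-∸ (ℕₚ.≤-trans minus≤R (ℕₚ.m≤n+m R plus))))

          -- Both sides being small, w′ (v₂ - v₁) = w (v₂′ - v₁′) holds over ℤ, and w is coprime to w′ and larger than v₂ - v₁.
          no-second-numerator : ∀ {m v₁ v₂ w m′ v₁′ v₂′ w′ w″} → InRange (m , v₁ , w) → InRange (m , v₂ , w) →
            InRange (m′ , v₁′ , w′) → InRange (m′ , v₂′ , w″) → w′ ≡ w″ → w′ ≢ w →
            ratio (m , v₁ , w) ≈ ratio (m′ , v₁′ , w′) → ratio (m , v₂ , w) ≈ ratio (m′ , v₂′ , w″) → ¬ v₁ ℕ.< v₂
          no-second-numerator {m} {v₁} {v₂} {w} {m′} {v₁′} {v₂′} {w′} r₁ r₂ r₁′ r₂′ ≡.refl w′≢w e₁ e₂ v₁<v₂ =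
            ℕₚ.<⇒≱ (ℕₚ.≤-<-trans (ℕₚ.m∸n≤m v₂ v₁) (ℕₚ.<-trans (v<V r₂) (ℕₚ.≤-<-trans V≤U (U<w r₂))))
              (∣⇒≤ {{ℕ.>-nonZero (ℕₚ.m<n⇒0<n∸m v₁<v₂)}} w∣gap)
            where
            open InRange
            gap : ℕ
            gap = v₂ ℕ.∸ v₁
            equal : w′ ℕ.* v₁ ℕ.+ w ℕ.* v₂′ ≡ w′ ℕ.* v₂ ℕ.+ w ℕ.* v₁′
            equal = ⌜⌝-injective
              (ℕₚ.≤-<-trans (sum≤R (product≤R (w≤2U r₁′) (ℕₚ.<⇒≤ (v<V r₁))) (product≤R (w≤2U r₁) (ℕₚ.<⇒≤ (v<V r₂′)))) R<p)
              (ℕₚ.≤-<-trans (sum≤R (product≤R (w≤2U r₁′) (ℕₚ.<⇒≤ (v<V r₂))) (product≤R (w≤2U r₁) (ℕₚ.<⇒≤ (v<V r₁′)))) R<p)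
              (begin
                ⌜ w′ ℕ.* v₁ ℕ.+ w ℕ.* v₂′ ⌝
                  ≈⟨ trans (⌜⌝-+ (w′ ℕ.* v₁) (w ℕ.* v₂′)) (+-cong (⌜⌝-* w′ v₁) (⌜⌝-* w v₂′)) ⟩
                ⌜ w′ ⌝ * ⌜ v₁ ⌝ + ⌜ w ⌝ * ⌜ v₂′ ⌝
                  ≈⟨ solve 6 (λ w′ v₁ w v₂′ f f′ → w′ :* v₁ :+ w :* v₂′ :=
                       w′ :* (v₁ :- f) :+ w :* (v₂′ :- f′) :+ (w′ :* f :+ w :* f′)) refl
                       ⌜ w′ ⌝ ⌜ v₁ ⌝ ⌜ w ⌝ ⌜ v₂′ ⌝ (φ m) (φ m′) ⟩
                ⌜ w′ ⌝ * (⌜ v₁ ⌝ - φ m) + ⌜ w ⌝ * (⌜ v₂′ ⌝ - φ m′) + (⌜ w′ ⌝ * φ m + ⌜ w ⌝ * φ m′)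
                  ≈⟨ +-congʳ (+-cong (cross r₁ r₁′ e₁) (sym (cross r₂ r₂′ e₂))) ⟩
                ⌜ w ⌝ * (⌜ v₁′ ⌝ - φ m′) + ⌜ w′ ⌝ * (⌜ v₂ ⌝ - φ m) + (⌜ w′ ⌝ * φ m + ⌜ w ⌝ * φ m′)
                  ≈⟨ solve 6 (λ w′ v₂ w v₁′ f f′ → w :* (v₁′ :- f′) :+ w′ :* (v₂ :- f) :+ (w′ :* f :+ w :* f′) :=
                       w′ :* v₂ :+ w :* v₁′) refl ⌜ w′ ⌝ ⌜ v₂ ⌝ ⌜ w ⌝ ⌜ v₁′ ⌝ (φ m) (φ m′) ⟩
                ⌜ w′ ⌝ * ⌜ v₂ ⌝ + ⌜ w ⌝ * ⌜ v₁′ ⌝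
                  ≈⟨ trans (⌜⌝-+ (w′ ℕ.* v₂) (w ℕ.* v₁′)) (+-cong (⌜⌝-* w′ v₂) (⌜⌝-* w v₁′)) ⟨
                ⌜ w′ ℕ.* v₂ ℕ.+ w ℕ.* v₁′ ⌝ ∎)
            lemma : ∀ a b c d → a ℕ.* (b ℕ.+ c) ℕ.+ d ≡ a ℕ.* b ℕ.+ (d ℕ.+ a ℕ.* c)
            lemma = solve-∀
            split : w ℕ.* v₂′ ≡ w ℕ.* v₁′ ℕ.+ w′ ℕ.* gap
            split = ℕₚ.+-cancelˡ-≡ (w′ ℕ.* v₁) _ _ (≡.trans equal
              (≡.trans (≡.cong (λ v → w′ ℕ.* v ℕ.+ w ℕ.* v₁′) (≡.sym (ℕₚ.m+[n∸m]≡n (ℕₚ.<⇒≤ v₁<v₂)))) (lemma w′ v₁ gap (w ℕ.* v₁′))))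
            w∣gap : w ∣ gap
            w∣gap = coprime-divisor {w} {w′} (coprime-ws (w∈ws r₁) (w∈ws r₁′) (λ e → w′≢w (≡.sym e)))
              (∣m+n∣m⇒∣n (≡.subst (w ∣_) split (m∣m*n v₂′)) (m∣m*n v₁′))

          columns : List ℕ
          columns = upTo V

          ∈columns : ∀ {v} → v ∈ columns → v ℕ.< V
          ∈columns = ∈-upTo⁻

          module GoodRows (gs : List ℕ) (gs-unique : Unique gs) (allGood : All (λ m → (0 ℕ.< m × m ℕ.≤ J) × ¬ Bad m) gs)
            (A≤gs : A ℕ.≤ length gs) (gs≤J : length gs ℕ.≤ J) where

            candidates : List Triple
            candidates = cartesianProduct gs (cartesianProduct columns ws)

            inRange-good : ∀ {m v w} → m ∈ gs → v ℕ.< V → w ∈ ws → InRange (m , v , w)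
            inRange-good m∈ v<V w∈ = inRange (proj₁ (proj₁ (All.lookup allGood m∈))) (proj₂ (proj₁ (All.lookup allGood m∈))) v<V w∈

            triple : (ℕ × ℕ) × ℕ → Triple
            triple ((m , w) , v) = m , v , w

            -- Equal denominators are left out: for them the disjointness of the intervals already
            -- gives distinct ratios.
            Collides : (ℕ × ℕ) × ℕ → Set
            Collides x@((m , w) , v) = Any (λ y → proj₂ (proj₂ y) ≢ w × ratio (triple x) ≈ ratio y) candidates

            collides? : ∀ x → Dec (Collides x)
            collides? x@((m , w) , v) = Any.any? (λ y → ¬? (proj₂ (proj₂ y) ℕ.≟ w) ×-dec (ratio (triple x) ≈? ratio y)) candidates

            Good : (ℕ × ℕ) × ℕ → Set
            Good x = (InRange (triple x) × triple x ∈ candidates) × ¬ Collides x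

            pool : List ((ℕ × ℕ) × ℕ)
            pool = cartesianProduct (cartesianProduct gs ws) columns

            pool-inRange : All (λ x → InRange (triple x) × triple x ∈ candidates) pool
            pool-inRange = All.tabulate λ x∈ →
              let mw∈ , v∈ = ∈-cartesianProduct⁻ (cartesianProduct gs ws) columns x∈
                  m∈ , w∈ = ∈-cartesianProduct⁻ gs ws mw∈
              in inRange-good m∈ (∈columns v∈) w∈ , ∈-cartesianProduct⁺ m∈ (∈-cartesianProduct⁺ v∈ w∈)

            distinct : ∀ x y → Good x → Good y → x ≢ y → ¬ ratio (triple x) ≈ ratio (triple y)
            distinct x@((m , w) , v) y@((m′ , w′) , v′) ((rx , _) , alone) ((ry , y∈) , _) x≢y e = by-denominator (w ℕ.≟ w′)
              where
              by-denominator : Dec (w ≡ w′) → ⊥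
              by-denominator (no  w≢w′) = alone (lose y∈ ((λ eq → w≢w′ (≡.sym eq)) , e))
              by-denominator (yes w≡w′) =
                let m≡m′ , v≡v′ = same-denominator rx ry w≡w′ e in x≢y (≡.cong₂ _,_ (≡.cong₂ _,_ m≡m′ w≡w′) v≡v′)

            -- A row m′ collides with at most one entry of the row (m , w).
            few-collisions : ∀ {m w} → m ∈ gs → w ∈ ws → length (filter (λ v → collides? ((m , w) , v)) columns) ℕ.≤ length gs
            few-collisions {m} {w} m∈ w∈ = functional-matching {K = K} _ gs
              (Uniqueₚ.filter⁺ (λ v → collides? ((m , w) , v)) (Uniqueₚ.upTo⁺ V))
              (All.zipWith (λ (v<V , col) → partner v<V col)
                (Allₚ.filter⁺ (λ v → collides? ((m , w) , v)) (All.tabulate ∈columns) , Allₚ.all-filter (λ v → collides? ((m , w) , v)) columns))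
              functional
              where
              -- Row m′ spoils column v. For given m′ there is one such v: as m is not bad, two
              -- coincidences have the same denominator, and then the same column.
              K : ℕ → ℕ → Set
              K m′ v = Σ ℕ λ v′ → Σ ℕ λ w′ → InRange (m , v , w) × InRange (m′ , v′ , w′) × w′ ≢ w × ratio (m , v , w) ≈ ratio (m′ , v′ , w′)
              partner : ∀ {v} → v ℕ.< V → Collides ((m , w) , v) → Any (λ m′ → K m′ v) gs
              partner v<V col =
                let (m′ , v′ , w′) , y∈ , w′≢w , e = find col
                    m′∈ , vw∈ = ∈-cartesianProduct⁻ gs (cartesianProduct columns ws) y∈
                    v′∈ , w′∈ = ∈-cartesianProduct⁻ columns ws vw∈
                in lose m′∈ (v′ , w′ , inRange-good m∈ v<V w∈ , inRange-good m′∈ (∈columns v′∈) w′∈ , w′≢w , e)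
              functional : ∀ m′ v₁ v₂ → K m′ v₁ → K m′ v₂ → v₁ ≡ v₂
              functional m′ v₁ v₂ (v₁′ , w₁ , r₁ , r₁′ , ne₁ , e₁) (v₂′ , w₂ , r₂ , r₂′ , ne₂ , e₂) =
                ℕₚ.≤-antisym
                  (ℕₚ.≮⇒≥ (no-second-numerator r₂ r₁ r₂′ r₁′ (≡.sym w₁≡w₂) ne₂ e₂ e₁))
                  (ℕₚ.≮⇒≥ (no-second-numerator r₁ r₂ r₁′ r₂′ w₁≡w₂ ne₁ e₁ e₂))
                where
                good = proj₂ (All.lookup allGood m∈)
                w₁≡w₂ : w₁ ≡ w₂
                w₁≡w₂ = ℕₚ.≤-antisym
                  (ℕₚ.≮⇒≥ (no-second-denominator good r₁ r₂ r₁′ r₂′ e₁ e₂))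
                  (ℕₚ.≮⇒≥ (no-second-denominator good r₂ r₁ r₂′ r₁′ e₂ e₁))

            count : A ℕ.* V ℕ.* (2 ℕ.* A) ℕ.≤ length (filter (¬? ∘ collides?) pool)
            count = ℕₚ.≤-trans (ℕₚ.*-monoˡ-≤ (2 ℕ.* A) (≡.subst (A ℕ.* V ℕ.≤_) (≡.sym (length-product gs ws)) (ℕₚ.*-mono-≤ A≤gs many-ws)))
              (length-filter-product (¬? ∘ collides?) (2 ℕ.* A) (cartesianProduct gs ws) columns (All.tabulate λ { {m , w} x∈ →
                let m∈ , w∈ = ∈-cartesianProduct⁻ gs ws x∈
                in ℕₚ.+-cancelˡ-≤ J _ _ (ℕₚ.≤-trans
                    (ℕₚ.≤-reflexive (≡.trans (≡.trans (lemma A) (≡.sym (length-upTo V)))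
                      (≡.sym (length-filter-¬ (λ v → collides? ((m , w) , v)) columns))))
                    (ℕₚ.+-monoˡ-≤ _ (ℕₚ.≤-trans (few-collisions m∈ w∈) gs≤J))) }))
              where
              lemma : ∀ A → 2 ℕ.* A ℕ.+ 2 ℕ.* A ≡ 4 ℕ.* A
              lemma = solve-∀

            impossible : ⊥
            impossible = too-many-triples triple Good (filter (¬? ∘ collides?) pool)
              (Uniqueₚ.filter⁺ (¬? ∘ collides?) (Uniqueₚ.cartesianProduct⁺ (Uniqueₚ.cartesianProduct⁺ gs-unique ws-unique) (Uniqueₚ.upTo⁺ V)))
              (All.zip (Allₚ.filter⁺ (¬? ∘ collides?) pool-inRange , Allₚ.all-filter (¬? ∘ collides?) pool))
              (λ x ((r , _) , _) → r) distinct count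

          module BadRows (bs : List ℕ) (bs-unique : Unique bs) (allBad : All (λ m → (0 ℕ.< m × m ℕ.≤ J) × Bad m) bs)
            (A≤bs : A ℕ.≤ length bs) where

            fractionOf : ∀ m → Dec (Bad m) → ℕ × ℕ
            fractionOf m (yes (d , r , _)) = toℕ d , toℕ r
            -- A dummy value, as every row in `bs` is bad.
            fractionOf m (no _)            = 1 , 0

            fraction : ℕ → ℕ × ℕ
            fraction m = fractionOf m (bad? m)

            den num : ℕ → ℕ
            den m = proj₁ (fraction m)
            num m = proj₂ (fraction m)

            IsFraction : ℕ → ℕ × ℕ → Set
            IsFraction m (d , r) = (0 ℕ.< d × d ℕ.< U × r ℕ.≤ R ℕ.+ R) × ⌜ d ⌝ * φ m + ⌜ R ⌝ ≈ ⌜ r ⌝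

            fractionOf-spec : ∀ m (b : Dec (Bad m)) → Bad m → IsFraction m (fractionOf m b)
            fractionOf-spec m (yes (d , r , 0<d , e)) _   = (0<d , Finₚ.toℕ<n d , ℕₚ.≤-pred (Finₚ.toℕ<n r)) , e
            fractionOf-spec m (no good)               bad = ⊥-elim (good bad)

            -- A small integer that represents d (v - φ m), given d φ m = r - R modulo p.
            numerator : ℕ → ℕ → ℤ
            numerator m v = + (den m ℕ.* v ℕ.+ R) ℤ.- + num m

            module Row {m : ℕ} (m∈ : m ∈ bs) where
              private
                spec : IsFraction m (fraction m)
                spec = fractionOf-spec m (bad? m) (proj₂ (All.lookup allBad m∈))
              0<m : 0 ℕ.< m
              0<m = proj₁ (proj₁ (All.lookup allBad m∈))
              m≤J : m ℕ.≤ J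
              m≤J = proj₂ (proj₁ (All.lookup allBad m∈))
              0<d : 0 ℕ.< den m
              0<d = proj₁ (proj₁ spec)
              d<U : den m ℕ.< U
              d<U = proj₁ (proj₂ (proj₁ spec))

              d≉0 : ¬ ⌜ den m ⌝ ≈ 0#
              d≉0 = n·1≉0 (den m) 0<d (ℕₚ.<-trans d<U (ℕₚ.≤-<-trans (ℕₚ.m≤m+n U U) U<p))

              numerator≈ : ∀ v → ⟦ numerator m v ⟧ℤ ≈ ⌜ den m ⌝ * (⌜ v ⌝ - φ m)
              numerator≈ v = begin
                ⟦ numerator m v ⟧ℤ                                    ≈⟨ trans (⟦+⟧ (+ (den m ℕ.* v ℕ.+ R)) (ℤ.- + num m)) (+-congˡ (⟦-⟧ (+ num m))) ⟩
                ⌜ den m ℕ.* v ℕ.+ R ⌝ - ⌜ num m ⌝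
                  ≈⟨ +-cong (trans (⌜⌝-+ (den m ℕ.* v) R) (+-congʳ (⌜⌝-* (den m) v))) (-‿cong (sym (proj₂ spec))) ⟩
                ⌜ den m ⌝ * ⌜ v ⌝ + ⌜ R ⌝ - (⌜ den m ⌝ * φ m + ⌜ R ⌝)
                  ≈⟨ solve 4 (λ d v R f → d :* v :+ R :- (d :* f :+ R) := d :* (v :- f)) refl ⌜ den m ⌝ ⌜ v ⌝ ⌜ R ⌝ (φ m) ⟩
                ⌜ den m ⌝ * (⌜ v ⌝ - φ m)                             ∎

              ∣numerator∣≤ : ∀ {v} → v ℕ.< V → ℤ.∣ numerator m v ∣ ℕ.≤ Z
              ∣numerator∣≤ {v} v<V = ℕₚ.≤-trans (ℤₚ.∣i-j∣≤∣i∣+∣j∣ (+ (den m ℕ.* v ℕ.+ R)) (+ num m))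
                (ℕₚ.+-mono-≤ (ℕₚ.+-monoˡ-≤ R (ℕₚ.*-mono-≤ (ℕₚ.<⇒≤ d<U) (ℕₚ.<⇒≤ v<V))) (proj₂ (proj₂ (proj₁ spec))))

              -- Needed because zero has a factor in common with every w > 1. A zero numerator would
              -- mean v = φ m, but (v - φ m)ʰ is the nonzero `sign m`.
              numerator≉0 : ∀ {v} → v ℕ.< V → ℤ.∣ numerator m v ∣ ≢ 0
              numerator≉0 {v} v<V e = power-nonzero sl≉0 h (begin
                slope m ^ h             ≈⟨ solve 1 (λ x → x := :- :- x) refl _ ⟩
                - sign m                ≈⟨ -‿cong (half-power m v 0<m 2m<p 2m<H 2v<H) ⟨
                - ((⌜ v ⌝ - φ m) ^ h)   ≈⟨ -‿cong (zero-power h>0 (cancel d≉0 _ (trans (sym (numerator≈ v))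
                                             (reflexive (≡.cong ⟦_⟧ℤ (ℤₚ.∣i∣≡0⇒i≡0 {numerator m v} e)))))) ⟩
                - 0#                    ≈⟨ solve 0 (:- con (+ 0) := con (+ 0)) refl ⟩
                0#                      ∎)
                where
                2m<p = ℕₚ.≤-<-trans (ℕₚ.+-mono-≤ m≤J m≤J) J<p
                2m<H = ℕₚ.≤-<-trans (ℕₚ.+-mono-≤ m≤J m≤J) J<H
                v≤ = ℕₚ.≤-trans (ℕₚ.<⇒≤ v<V) (ℕₚ.m≤m+n V ((U ℕ.+ U) ℕ.* k))
                2v<H = ℕₚ.≤-<-trans (ℕₚ.+-mono-≤ v≤ v≤) run<H
                sl≉0 = slope≉0 0<m (ℕₚ.≤-<-trans (ℕₚ.m≤m+n m m) 2m<p)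

            open Row

            triple : (ℕ × ℕ) × ℕ → Triple
            triple ((m , v) , w) = m , v , w

            reduced? : ∀ (x : (ℕ × ℕ) × ℕ) → Dec (Coprime (proj₂ x) ℤ.∣ numerator (proj₁ (proj₁ x)) (proj₂ (proj₁ x)) ∣)
            reduced? ((m , v) , w) = coprime? w ℤ.∣ numerator m v ∣

            Good : (ℕ × ℕ) × ℕ → Set
            Good x@((m , v) , w) = (m ∈ bs × v ℕ.< V × w ∈ ws) × Coprime w ℤ.∣ numerator m v ∣

            inRange-bad : ∀ x → Good x → InRange (triple x)
            inRange-bad ((m , v) , w) ((m∈ , v<V , w∈) , _) = inRange (0<m m∈) (m≤J m∈) v<V w∈

            -- A coincidence reads z d′ w′ = z′ d w over the integers, both sides being small. If w
            -- ≠ w′, then w is coprime to z and w′, hence divides d′, although d′ < U < w.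
            distinct : ∀ x y → Good x → Good y → x ≢ y → ¬ ratio (triple x) ≈ ratio (triple y)
            distinct x@((m , v) , w) y@((m′ , v′) , w′) gx@((m∈ , v<V , w∈) , cop) gy@((m′∈ , v′<V , w′∈) , _) x≢y e = by-denominator (w ℕ.≟ w′)
              where
              z z′ : ℤ
              z = numerator m v
              z′ = numerator m′ v′
              b : ∀ {m v w} m′ → m ∈ bs → v ℕ.< V → m′ ∈ bs → w ∈ ws → ℤ.∣ numerator m v ℤ.* + (den m′ ℕ.* w) ∣ ℕ.≤ Z ℕ.* (U ℕ.* (U ℕ.+ U))
              b {m} {v} {w} m′ m∈ v<V m′∈ w∈ = ℕₚ.≤-trans (ℕₚ.≤-reflexive (ℤₚ.abs-* (numerator m v) (+ (den m′ ℕ.* w))))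
                (ℕₚ.*-mono-≤ (∣numerator∣≤ m∈ v<V) (ℕₚ.*-mono-≤ (ℕₚ.<⇒≤ (d<U m′∈)) (proj₂ (All.lookup block w∈))))
              equal : z ℤ.* + (den m′ ℕ.* w′) ≡ z′ ℤ.* + (den m ℕ.* w)
              equal = ⟦⟧-injective _ _ (begin
                  ⟦ z ℤ.* + (den m′ ℕ.* w′) ⟧ℤ
                    ≈⟨ trans (⟦*⟧ z (+ (den m′ ℕ.* w′))) (*-cong (numerator≈ m∈ v) (⌜⌝-* (den m′) w′)) ⟩
                  ⌜ den m ⌝ * (⌜ v ⌝ - φ m) * (⌜ den m′ ⌝ * ⌜ w′ ⌝)
                    ≈⟨ solve 4 (λ d x d′ w′ → d :* x :* (d′ :* w′) := d :* d′ :* (w′ :* x)) refl ⌜ den m ⌝ (⌜ v ⌝ - φ m) ⌜ den m′ ⌝ ⌜ w′ ⌝ ⟩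
                  ⌜ den m ⌝ * ⌜ den m′ ⌝ * (⌜ w′ ⌝ * (⌜ v ⌝ - φ m))
                    ≈⟨ *-congˡ (cross (inRange-bad x gx) (inRange-bad y gy) e) ⟩
                  ⌜ den m ⌝ * ⌜ den m′ ⌝ * (⌜ w ⌝ * (⌜ v′ ⌝ - φ m′))
                    ≈⟨ solve 4 (λ d x d′ w → d :* d′ :* (w :* x) := d′ :* x :* (d :* w)) refl ⌜ den m ⌝ (⌜ v′ ⌝ - φ m′) ⌜ den m′ ⌝ ⌜ w ⌝ ⟩
                  ⌜ den m′ ⌝ * (⌜ v′ ⌝ - φ m′) * (⌜ den m ⌝ * ⌜ w ⌝)
                    ≈⟨ trans (⟦*⟧ z′ (+ (den m ℕ.* w))) (*-cong (numerator≈ m′∈ v′) (⌜⌝-* (den m) w)) ⟨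
                  ⟦ z′ ℤ.* + (den m ℕ.* w) ⟧ℤ ∎)
                (ℕₚ.≤-<-trans (ℕₚ.+-mono-≤ (b m′ m∈ v<V m′∈ w′∈) (b m m′∈ v′<V m∈ w∈)) Z<p)
              abs-equal : ℤ.∣ z ∣ ℕ.* (den m′ ℕ.* w′) ≡ ℤ.∣ z′ ∣ ℕ.* (den m ℕ.* w)
              abs-equal = ≡.trans (≡.sym (ℤₚ.abs-* z (+ (den m′ ℕ.* w′)))) (≡.trans (≡.cong ℤ.∣_∣ equal) (ℤₚ.abs-* z′ (+ (den m ℕ.* w))))
              by-denominator : Dec (w ≡ w′) → ⊥
              by-denominator (yes w≡w′) =
                let m≡m′ , v≡v′ = same-denominator (inRange-bad x gx) (inRange-bad y gy) w≡w′ e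
                in x≢y (≡.cong₂ _,_ (≡.cong₂ _,_ m≡m′ v≡v′) w≡w′)
              by-denominator (no  w≢w′) = ℕₚ.<⇒≱ (ℕₚ.<-trans (d<U m′∈) (InRange.U<w (inRange-bad x gx)))
                (∣⇒≤ {{ℕ.>-nonZero (0<d m′∈)}} (coprime-divisor {w} {w′} (coprime-ws w∈ w′∈ w≢w′) (≡.subst (w ∣_) (ℕₚ.*-comm (den m′) w′)
                  (coprime-divisor {w} {ℤ.∣ z ∣} cop (≡.subst (w ∣_) (≡.sym abs-equal) (∣-trans (n∣m*n (den m)) (n∣m*n ℤ.∣ z′ ∣)))))))

            -- A nonzero integer below 2^(A + 1) shares factors with at most A pairwise coprime
            -- numbers.
            few-unreduced : ∀ {m v} → m ∈ bs → v ℕ.< V → length (filter (¬? ∘ (λ w → reduced? ((m , v) , w))) ws) ℕ.≤ A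
            few-unreduced {m} {v} m∈ v<V = go ℤ.∣ numerator m v ∣ ≡.refl
              where
              red? : ∀ w → Dec (Coprime w ℤ.∣ numerator m v ∣)
              red? w = reduced? ((m , v) , w)
              go : ∀ N → ℤ.∣ numerator m v ∣ ≡ N → length (filter (¬? ∘ red?) ws) ℕ.≤ A
              go zero    e = ⊥-elim (numerator≉0 m∈ v<V e)
              go (suc N) e = ℕₚ.≮⇒≥ λ lt → ℕₚ.<⇒≱ Z<2^A (ℕₚ.≤-trans (ℕₚ.^-monoʳ-≤ 2 lt) (ℕₚ.≤-trans
                (few-common-factors N (filter (¬? ∘ red?) ws) (AllPairsₚ.filter⁺ {R = Coprime} (¬? ∘ red?) coprimes)
                  (≡.subst (λ i → All (λ w → ¬ Coprime w i) (filter (¬? ∘ red?) ws)) e (Allₚ.all-filter (¬? ∘ red?) ws)))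
                (≡.subst (ℕ._≤ Z) e (∣numerator∣≤ m∈ v<V))))

            pool : List ((ℕ × ℕ) × ℕ)
            pool = cartesianProduct (cartesianProduct bs columns) ws

            pool-∈ : All (λ x → proj₁ (proj₁ x) ∈ bs × proj₂ (proj₁ x) ℕ.< V × proj₂ x ∈ ws) pool
            pool-∈ = All.tabulate λ x∈ →
              let mv∈ , w∈ = ∈-cartesianProduct⁻ (cartesianProduct bs columns) ws x∈
                  m∈ , v∈ = ∈-cartesianProduct⁻ bs columns mv∈
              in m∈ , ∈columns v∈ , w∈

            count : A ℕ.* V ℕ.* (2 ℕ.* A) ℕ.≤ length (filter reduced? pool)
            count = ℕₚ.≤-trans (ℕₚ.*-monoˡ-≤ (2 ℕ.* A) (≡.subst (A ℕ.* V ℕ.≤_) (≡.sym (length-product bs columns))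
                (ℕₚ.*-mono-≤ A≤bs (ℕₚ.≤-reflexive (≡.sym (length-upTo V))))))
              (length-filter-product reduced? (2 ℕ.* A) (cartesianProduct bs columns) ws (All.tabulate λ { {m , v} x∈ →
                let m∈ , v∈ = ∈-cartesianProduct⁻ bs columns x∈
                in ℕₚ.+-cancelʳ-≤ A _ _ (ℕₚ.≤-trans (≡.subst (2 ℕ.* A ℕ.+ A ℕ.≤_) (lemma A) (ℕₚ.m≤m+n _ A)) (ℕₚ.≤-trans many-ws
                    (ℕₚ.≤-trans (ℕₚ.≤-reflexive (≡.sym (length-filter-¬ (λ w → reduced? ((m , v) , w)) ws)))
                      (ℕₚ.+-monoʳ-≤ _ (few-unreduced m∈ (∈columns v∈)))))) }))
              where
              lemma : ∀ A → 2 ℕ.* A ℕ.+ A ℕ.+ A ≡ 4 ℕ.* A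
              lemma = solve-∀

            impossible : ⊥
            impossible = too-many-triples triple Good (filter reduced? pool)
              (Uniqueₚ.filter⁺ reduced? (Uniqueₚ.cartesianProduct⁺ (Uniqueₚ.cartesianProduct⁺ bs-unique (Uniqueₚ.upTo⁺ V)) ws-unique))
              (All.zip (Allₚ.filter⁺ reduced? pool-∈ , Allₚ.all-filter reduced? pool))
              inRange-bad distinct count

          contradiction : ⊥
          contradiction = by-badness (A ℕ.≤? length (filter bad? rows))
            where
            total : length (filter bad? rows) ℕ.+ length (filter (¬? ∘ bad?) rows) ≡ J
            total = ≡.trans (length-filter-¬ bad? rows) (length-applyUpTo suc J)
            by-badness : Dec (A ℕ.≤ length (filter bad? rows)) → ⊥
            by-badness (yes many) = BadRows.impossible (filter bad? rows) (Uniqueₚ.filter⁺ bad? rows-unique)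
              (All.zip (Allₚ.filter⁺ bad? (All.tabulate ∈rows) , Allₚ.all-filter bad? rows)) many
            by-badness (no few) = GoodRows.impossible (filter (¬? ∘ bad?) rows) (Uniqueₚ.filter⁺ (¬? ∘ bad?) rows-unique)
              (All.zip (Allₚ.filter⁺ (¬? ∘ bad?) (All.tabulate ∈rows) , Allₚ.all-filter (¬? ∘ bad?) rows))
              (ℕₚ.+-cancelˡ-≤ A _ _ (ℕₚ.≤-trans (ℕₚ.≤-reflexive (≡.trans (≡.cong (A ℕ.+_) (≡.sym (ℕₚ.+-identityʳ A))) (≡.sym total)))
                (ℕₚ.+-monoˡ-≤ _ (ℕₚ.<⇒≤ (ℕₚ.≰⇒> few)))))
              (ℕₚ.≤-trans (ℕₚ.m≤n+m _ _) (ℕₚ.≤-reflexive total))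

-- Residues modulo p

two-members : ∀ {A : Set} {x y : A} {xs} → x ≢ y → x ∈ xs → y ∈ xs → 2 ℕ.≤ length xs
two-members x≢y (here ≡.refl) (here ≡.refl) = ⊥-elim (x≢y ≡.refl)
two-members x≢y (here ≡.refl) (there {xs = _ ∷ _} _) = ℕ.s≤s (ℕ.s≤s ℕ.z≤n)
two-members x≢y (there {xs = _ ∷ _} _) _ = ℕ.s≤s (ℕ.s≤s ℕ.z≤n)

module Residues (h : ℕ) (p-prime : Prime (suc (h ℕ.+ h))) (h>0 : 0 ℕ.< h) where

  p : ℕ
  p = suc (h ℕ.+ h)

  open Quotient ℤₚ.+-*-commutativeRing (+ p) public using (_~_; _by_; ~-refl; ~-sym; ~-trans; ~-+; ~-*; ~-neg; lift) renaming (quotient to 𝔽)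
  open Solve ℤₚ.+-*-commutativeRing
  open IntegerMultiples 𝔽 using (_·_; ⟦_⟧ℤ) public

  ∣⇒~0 : ∀ x → p ∣ ℤ.∣ x ∣ → x ~ + 0
  ∣⇒~0 x d with Signed.divides q e ← Signed.∣ᵤ⇒∣ {+ p} {x} d =
    q by ≡.trans e (≡.trans (ℤₚ.*-comm q (+ p)) (≡.sym (ℤₚ.+-identityˡ _)))

  ~0⇒∣ : ∀ x → x ~ + 0 → p ∣ ℤ.∣ x ∣
  ~0⇒∣ x (r by e) = ≡.subst (p ∣_) (≡.sym (≡.trans (≡.cong ℤ.∣_∣ (≡.trans e (ℤₚ.+-identityˡ (+ p ℤ.* r)))) (ℤₚ.abs-* (+ p) r))) (m∣m*n ℤ.∣ r ∣)

  ~⇒-~0 : ∀ {x y} → x ~ y → x ℤ.- y ~ + 0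
  ~⇒-~0 {x} {y} e = ~-trans (~-+ e (~-refl {ℤ.- y})) (lift (ℤₚ.+-inverseʳ y))

  -~0⇒~ : ∀ {x y} → x ℤ.- y ~ + 0 → x ~ y
  -~0⇒~ {x} {y} e = ~-trans (lift (solve 2 (λ x y → x := (x :- y) :+ y) ≡.refl x y))
    (~-trans (~-+ e (~-refl {y})) (lift (ℤₚ.+-identityˡ y)))

  domain : ∀ x y → x ℤ.* y ~ + 0 → x ~ + 0 ⊎ y ~ + 0
  domain x y e with euclidsLemma ℤ.∣ x ∣ ℤ.∣ y ∣ p-prime (≡.subst (p ∣_) (ℤₚ.abs-* x y) (~0⇒∣ (x ℤ.* y) e))
  ... | inj₁ d = inj₁ (∣⇒~0 x d)
  ... | inj₂ d = inj₂ (∣⇒~0 y d)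

  ·1≡+ : ∀ n → n · (+ 1) ≡ + n
  ·1≡+ zero          = ≡.refl
  ·1≡+ (suc zero)    = ≡.refl
  ·1≡+ (suc (suc n)) = ≡.trans (≡.cong (ℤ._+ + 1) (·1≡+ (suc n))) (≡.cong +_ (ℕₚ.+-comm (suc n) 1))

  p·1≈0 : p · (+ 1) ~ + 0
  p·1≈0 = ≡.subst (_~ + 0) (≡.sym (·1≡+ p)) (∣⇒~0 (+ p) (divides 1 (≡.sym (ℕₚ.*-identityˡ p))))

  small-nonzero : ∀ n → 0 ℕ.< n → n ℕ.< p → ¬ + n ~ + 0
  small-nonzero n 0<n n<p e = ℕₚ.<⇒≱ n<p (∣⇒≤ {{ℕ.>-nonZero 0<n}} (~0⇒∣ (+ n) e))

  n·1≉0 : ∀ n → 0 ℕ.< n → n ℕ.< p → ¬ n · (+ 1) ~ + 0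
  n·1≉0 n 0<n n<p e = small-nonzero n 0<n n<p (≡.subst (_~ + 0) (·1≡+ n) e)

  small-equal : ∀ {m n} → m ℕ.< p → n ℕ.< p → + m ~ + n → m ≡ n
  small-equal {m} {n} m<p n<p e = ℤₚ.+-injective (ℤₚ.i-j≡0⇒i≡j (+ m) (+ n) (ℤₚ.∣i∣≡0⇒i≡0 (zero-of _ (~0⇒∣ _ (~⇒-~0 e)) small)))
    where
    small : ℤ.∣ + m ℤ.- + n ∣ ℕ.< p
    small = ≡.subst (ℕ._< p) (≡.sym (≡.cong ℤ.∣_∣ (ℤₚ.m-n≡m⊖n m n)))
      (ℕₚ.≤-<-trans (ℤₚ.∣m⊝n∣≤m⊔n m n) (ℕₚ.⊔-lub m<p n<p))
    zero-of : ∀ k → p ∣ k → k ℕ.< p → k ≡ 0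
    zero-of zero    d lt = ≡.refl
    zero-of (suc k) d lt = ⊥-elim (ℕₚ.<⇒≱ lt (∣⇒≤ d))

  rep : ℤ → Fin p
  rep x = fromℕ< (n%ℕd<d x p)

  toℕ-rep : ∀ x → toℕ (rep x) ≡ x %ℕ p
  toℕ-rep x = Finₚ.toℕ-fromℕ< (n%ℕd<d x p)

  rep~ : ∀ x → x ~ + toℕ (rep x)
  rep~ x = (x /ℕ p) by ≡.trans (a≡a%ℕn+[a/ℕn]*n x p) (≡.cong₂ ℤ._+_ (≡.cong +_ (≡.sym (toℕ-rep x))) (ℤₚ.*-comm (x /ℕ p) (+ p)))

  rep-injective : ∀ {x y} → rep x ≡ rep y → x ~ y
  rep-injective {x} {y} e = ~-trans (rep~ x) (~-trans (lift (≡.cong (λ i → + toℕ i) e)) (~-sym (rep~ y)))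

  rep-cong : ∀ {x y} → x ~ y → rep x ≡ rep y
  rep-cong {x} {y} e = Finₚ.toℕ-injective (small-equal (Finₚ.toℕ<n (rep x)) (Finₚ.toℕ<n (rep y))
    (~-trans (~-sym (rep~ x)) (~-trans e (rep~ y))))

  emb : Fin p → ℤ
  emb i = + toℕ i

  emb-injective : ∀ {i j} → emb i ~ emb j → i ≡ j
  emb-injective {i} {j} e = Finₚ.toℕ-injective (small-equal (Finₚ.toℕ<n i) (Finₚ.toℕ<n j) e)

  numeral : ∀ x → Σ ℕ λ n → x ~ n · (+ 1)
  numeral x = toℕ (rep x) , ~-trans (rep~ x) (lift (≡.sym (·1≡+ (toℕ (rep x)))))

  _~?_ : ∀ x y → Dec (x ~ y)
  x ~? y = map′ (λ d → -~0⇒~ (∣⇒~0 (x ℤ.- y) d)) (λ e → ~0⇒∣ (x ℤ.- y) (~⇒-~0 e)) (p ∣? ℤ.∣ x ℤ.- y ∣)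

  rem-cong : ∀ {x y} → x ~ y → x %ℕ p ≡ y %ℕ p
  rem-cong {x} {y} e = ≡.trans (≡.sym (toℕ-rep x)) (≡.trans (≡.cong toℕ (rep-cong e)) (toℕ-rep y))

  ^3 : ∀ x → x ℤ.^ 3 ≡ x ℤ.* x ℤ.* x
  ^3 = solve 1 (λ x → x :* (x :* (x :* con (+ 1))) := x :* x :* x) ≡.refl

  module _ (a c : ℤ) where

    cubic : ℤ → ℤ
    cubic x = a ℤ.* (x ℤ.* x ℤ.* x) ℤ.+ c ℤ.* x

    inCubic : ∀ x → InCubic (h ℕ.+ h) a c (rep x , rep (cubic x))
    inCubic x = ≡.trans (toℕ-rep (cubic x)) (rem-cong
      (~-trans (~-+ (~-* (~-refl {a}) (~-* (~-* (rep~ x) (rep~ x)) (rep~ x))) (~-* (~-refl {c}) (rep~ x)))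
        (lift (≡.cong (λ y → a ℤ.* y ℤ.+ c ℤ.* + toℕ (rep x)) (≡.sym (^3 (+ toℕ (rep x))))))))

    -- A box begins at X + 1, so its corner is one less than its first abscissa or ordinate.
    start : ℤ → ℕ
    start x = (x ℤ.- + 1) %ℕ p

    inInterval : ∀ {H} x j → j ℕ.< H → ∀ u → u ~ x ℤ.+ j · (+ 1) → InInterval (h ℕ.+ h) (+ start x) H (rep u)
    inInterval x j j<H u e = fromℕ< j<H , ≡.trans (toℕ-rep u) (rem-cong (~-trans e
      (~-trans (lift (≡.trans (≡.cong (λ k → x ℤ.+ k) (·1≡+ j)) (solve 2 (λ x j → x :+ j := (x :- con (+ 1)) :+ (con (+ 1) :+ j)) ≡.refl x (+ j))))
      (~-trans (~-+ (rep~ (x ℤ.- + 1)) ~-refl)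
        (lift (≡.cong₂ (λ s k → + s ℤ.+ + suc k) (toℕ-rep (x ℤ.- + 1)) (≡.sym (Finₚ.toℕ-fromℕ< j<H))))))))

    two-points : ∀ H x y i j₁ j₂ → 0 ℕ.< i → i ℕ.< p → i ℕ.< H → j₁ ℕ.< H → j₂ ℕ.< H →
      cubic x ~ y ℤ.+ j₁ · (+ 1) → cubic (x ℤ.+ i · (+ 1)) ~ y ℤ.+ j₂ · (+ 1) →
      2 ℕ.≤ cubicBoxCount p a c (+ start x) (+ start y) H
    two-points H x y i j₁ j₂ 0<i i<p i<H j₁<H j₂<H e₁ e₂ =
      two-members different
        (member x 0 (ℕₚ.<-trans 0<i i<H) j₁ j₁<H (lift (≡.sym (ℤₚ.+-identityʳ x))) e₁)
        (member (x ℤ.+ i · (+ 1)) i i<H j₂ j₂<H ~-refl e₂)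
      where
      member : ∀ u i → i ℕ.< H → ∀ j → j ℕ.< H → u ~ x ℤ.+ i · (+ 1) → cubic u ~ y ℤ.+ j · (+ 1) →
               (rep u , rep (cubic u)) ∈ filter (inCubicBox? (h ℕ.+ h) a c (+ start x) (+ start y) H) (cartesianProduct (allFin p) (allFin p))
      member u i i<H j j<H eu ev = ∈-filter⁺ (inCubicBox? (h ℕ.+ h) a c (+ start x) (+ start y) H)
        (∈-cartesianProduct⁺ (∈-allFin (rep u)) (∈-allFin (rep (cubic u))))
        (inCubic u , inInterval x i i<H u eu , inInterval y j j<H (cubic u) ev)
      different : (rep x , rep (cubic x)) ≢ (rep (x ℤ.+ i · (+ 1)) , rep (cubic (x ℤ.+ i · (+ 1))))
      different e = n·1≉0 i 0<i i<p (~-trans (lift (solve 2 (λ x i → i := (x :+ i) :- x) ≡.refl x (i · (+ 1))))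
        (~⇒-~0 {x ℤ.+ i · (+ 1)} {x} (~-sym (rep-injective {x} {x ℤ.+ i · (+ 1)} (≡.cong proj₁ e)))))

    start<p : ∀ x → start x ℕ.< p
    start<p x = n%ℕd<d (x ℤ.- + 1) p

-- Choice of the parameters

open import Data.Nat using (_+_; _*_; _^_; _≤_; _<_; z≤n; s≤s)

odd-prime : ∀ p → Prime p → 3 < p → Σ ℕ λ h → 0 < h × p ≡ suc (h + h)
odd-prime p p-prime 3<p with p % 2 | m≡m%n+[m/n]*n p 2 | m%n<n p 2
... | suc (suc _) | _ | s≤s (s≤s ())
... | 0 | e | _ with prime⇒irreducible p-prime (divides (p / 2) e)
...   | inj₂ ≡.refl = ⊥-elim (ℕₚ.<⇒≱ 3<p (s≤s (s≤s z≤n)))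
odd-prime p p-prime 3<p | 1 | e | _ = p / 2 , positive (p / 2) e , ≡.trans e (lemma (p / 2))
  where
  lemma : ∀ q → 1 + q * 2 ≡ suc (q + q)
  lemma = solve-∀
  positive : ∀ q → p ≡ 1 + q * 2 → 0 < q
  positive zero    e = ⊥-elim (ℕₚ.<⇒≱ 3<p (≡.subst (_≤ 3) (≡.sym e) (s≤s z≤n)))
  positive (suc q) e = s≤s z≤n

n<2^n : ∀ n → n < 2 ^ n
n<2^n zero    = s≤s z≤n
n<2^n (suc n) = ℕₚ.≤-trans (s≤s (n<2^n n)) (ℕₚ.+-mono-≤ (ℕₚ.m^n>0 2 n) (ℕₚ.≤-reflexive (≡.sym (ℕₚ.+-identityʳ _))))

-- From 4 on, consecutive cubes have ratio at most 125/64 < 2.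
cube≤2^ : ∀ z → (4 + z) * (4 + z) * (4 + z) ≤ 64 * 2 ^ (3 + z)
cube≤2^ zero    = ℕₚ.m≤m+n 64 448
cube≤2^ (suc z) = ℕₚ.≤-trans
  (≡.subst ((4 + suc z) * (4 + suc z) * (4 + suc z) ≤_) (expand z) (ℕₚ.m≤m+n _ (z * z * z + 9 * (z * z) + 21 * z + 3)))
  (ℕₚ.≤-trans (ℕₚ.*-monoʳ-≤ 2 (cube≤2^ z)) (ℕₚ.≤-reflexive (double (2 ^ (3 + z)))))
  where
  expand : ∀ z → (4 + suc z) * (4 + suc z) * (4 + suc z) + (z * z * z + 9 * (z * z) + 21 * z + 3) ≡ 2 * ((4 + z) * (4 + z) * (4 + z))
  expand = solve-∀
  double : ∀ x → 2 * (64 * x) ≡ 64 * (2 * x)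
  double = solve-∀

-- Chain: 64 c (y + 1)² ≤ (y + 1)³ ≤ 64 · 2ʸ.
quadratic≤2^ : ∀ c y → 3 + 64 * c ≤ y → c * (suc y * suc y) ≤ 2 ^ y
quadratic≤2^ c y le = ≡.subst (λ y → c * (suc y * suc y) ≤ 2 ^ y) (ℕₚ.m+[n∸m]≡n (ℕₚ.≤-trans (ℕₚ.m≤m+n 3 _) le))
  (ℕₚ.*-cancelˡ-≤ 64 (ℕₚ.≤-trans
    (ℕₚ.≤-trans (ℕₚ.≤-reflexive (rearrange c (4 + z)))
      (ℕₚ.*-monoʳ-≤ ((4 + z) * (4 + z)) (ℕₚ.≤-trans (ℕₚ.+-cancelˡ-≤ 3 _ z (≡.subst (3 + 64 * c ≤_) (≡.sym z-eq) le)) (ℕₚ.m≤n+m z 4))))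
    (cube≤2^ z)))
  where
  z = y ℕ.∸ 3
  z-eq : 3 + z ≡ y
  z-eq = ℕₚ.m+[n∸m]≡n (ℕₚ.≤-trans (ℕₚ.m≤m+n 3 _) le)
  rearrange : ∀ c s → 64 * (c * (s * s)) ≡ s * s * (64 * c)
  rearrange = solve-∀

integer-log : ∀ b p → 2 ≤ b → 0 < p → Σ ℕ λ y → b ^ y ≤ p × p < b ^ suc y
integer-log b p 2≤b 0<p = go p (ℕₚ.<-≤-trans (n<2^n p) (ℕₚ.≤-trans (ℕₚ.^-monoʳ-≤ 2 (ℕₚ.n≤1+n p)) (ℕₚ.^-monoˡ-≤ (suc p) 2≤b)))
  where
  go : ∀ m → p < b ^ suc m → Σ ℕ λ y → b ^ y ≤ p × p < b ^ suc y
  go zero    lt = 0 , 0<p , lt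
  go (suc m) lt with b ^ suc m ℕ.≤? p
  ... | yes le = suc m , le , lt
  ... | no  gt = go m (ℕₚ.≰⇒> gt)

^-cancelˡ-≤ : ∀ n .{{_ : ℕ.NonZero n}} a b → a ^ n ≤ b ^ n → a ≤ b
^-cancelˡ-≤ n a b le = ℕₚ.≮⇒≥ λ lt → ℕₚ.<⇒≱ (ℕₚ.^-monoˡ-< n lt) le

-- The exponents: with Z = 2^y, Q = Z^j and p between Q⁶ and 2^(6j) Q⁶, runs of length k ~ 3 j y are
-- considered, M = 2^(k-1) = Q³ / Z, and the box sizes A, U are Q times a small power of Z.
module Sizes (j y p H h : ℕ) (p≡ : p ≡ suc (h + h)) (8≤j : 8 ≤ j)
  (lower : (2 ^ (6 * j)) ^ y ≤ p) (upper : p < (2 ^ (6 * j)) ^ suc y)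
  (slack : 208 * 2 ^ (6 * j) * ((3 * j + 2) * (3 * j + 2)) * (suc y * suc y) ≤ 2 ^ y)
  (box : (2 ^ y) ^ (j + 4) ≤ H) where

  Z Q E X k′ k M A n i : ℕ
  Z = 2 ^ y
  Q = Z ^ j
  E = 2 ^ (6 * j)
  X = (3 * j + 2) * (3 * j + 2) * (suc y * suc y)
  k′ = (3 * j ℕ.∸ 1) * y
  k = suc k′
  M = 2 ^ k′
  A = Z * Q
  n = M * k
  i = (j + 2) * y

  -- A common bound for the logarithmic quantities k and i. Its square X lets the single hypothesis
  -- `slack` cover terms linear and quadratic in them.
  t : ℕ
  t = (3 * j + 2) * suc y

  X≡t² : X ≡ t * t
  X≡t² = lemma (3 * j + 2) (suc y)
    where
    lemma : ∀ s u → s * s * (u * u) ≡ s * u * (s * u)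
    lemma = solve-∀

  0<t : 0 < t
  0<t = ℕₚ.*-mono-≤ (ℕₚ.≤-trans (s≤s z≤n) (ℕₚ.m≤n+m 2 (3 * j))) (s≤s (z≤n {y}))

  0<E : 0 < E
  0<E = ℕₚ.m^n>0 2 (6 * j)

  t≤X : t ≤ X
  t≤X = ≡.subst (t ≤_) (≡.sym X≡t²) (ℕₚ.m≤m*n t t {{ℕ.>-nonZero 0<t}})

  0<X : 0 < X
  0<X = ℕₚ.<-≤-trans 0<t t≤X

  absorb : ∀ x → x ≤ 208 * X → x * E ≤ Z
  absorb x le = ℕₚ.≤-trans (ℕₚ.*-monoˡ-≤ E le) (≡.subst (_≤ Z) (lemma E (3 * j + 2) (suc y)) slack)
    where
    lemma : ∀ e s u → 208 * e * (s * s) * (u * u) ≡ 208 * (s * s * (u * u)) * e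
    lemma = solve-∀

  absorb′ : ∀ x → x ≤ 208 * X → x ≤ Z
  absorb′ x le = ℕₚ.≤-trans (ℕₚ.m≤m*n x E {{ℕ.>-nonZero 0<E}}) (absorb x le)

  multiple : ∀ {x} c d → x ≤ t → c + d ≡ 208 → c * x ≤ 208 * X
  multiple c d x≤t e = ℕₚ.*-mono-≤ (≡.subst (c ≤_) e (ℕₚ.m≤m+n c d)) (ℕₚ.≤-trans x≤t t≤X)

  k≤t : k ≤ t
  k≤t = ℕₚ.≤-trans (s≤s (ℕₚ.*-monoˡ-≤ y (ℕₚ.m∸n≤m (3 * j) 1)))
    (≡.subst (suc (3 * j * y) ≤_) (lemma (3 * j) y) (s≤s (ℕₚ.m≤m+n _ _)))
    where
    lemma : ∀ s y → suc (s * y + (s + 2 * y + 1)) ≡ (s + 2) * suc y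
    lemma = solve-∀

  i≤t : i ≤ t
  i≤t = ℕₚ.*-mono-≤ (ℕₚ.+-monoˡ-≤ 2 (ℕₚ.m≤n*m j 3)) (ℕₚ.n≤1+n y)

  208≤Z : 208 ≤ Z
  208≤Z = absorb′ 208 (ℕₚ.≤-trans (ℕₚ.≤-reflexive (≡.sym (ℕₚ.*-identityʳ 208))) (ℕₚ.*-monoʳ-≤ 208 0<X))

  -- For the numerical constants that a factor Z has to absorb; d is the complement to 208, so that
  -- the comparison is a computation.
  c≤Z : ∀ c d → c + d ≡ 208 → c ≤ Z
  c≤Z c d e = ℕₚ.≤-trans (≡.subst (c ≤_) e (ℕₚ.m≤m+n c d)) 208≤Z

  8kE≤Z : 8 * k * E ≤ Z
  8kE≤Z = absorb (8 * k) (multiple 8 200 k≤t ≡.refl)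

  8k≤Z : 8 * k ≤ Z
  8k≤Z = absorb′ (8 * k) (multiple 8 200 k≤t ≡.refl)

  4i²<Z : 4 * (i * i) + 1 < Z
  4i²<Z = absorb′ _ (ℕₚ.≤-trans
    (s≤s (ℕₚ.+-mono-≤ (ℕₚ.*-monoʳ-≤ 4 (≡.subst (i * i ≤_) (≡.sym X≡t²) (ℕₚ.*-mono-≤ i≤t i≤t))) 0<X))
    (ℕₚ.≤-trans (ℕₚ.+-monoˡ-≤ (4 * X + X) 0<X) (ℕₚ.≤-trans (ℕₚ.≤-reflexive (lemma X)) (ℕₚ.*-monoˡ-≤ X (ℕₚ.m≤m+n 6 202)))))
    where
    lemma : ∀ x → x + (4 * x + x) ≡ 6 * x
    lemma = solve-∀

  exponent≤Z : y * (4 + 2 * j) ≤ Z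
  exponent≤Z = absorb′ _ (ℕₚ.≤-trans (ℕₚ.≤-reflexive (lemma y j)) (multiple 2 206 i≤t ≡.refl))
    where
    lemma : ∀ y j → y * (4 + 2 * j) ≡ 2 * ((j + 2) * y)
    lemma = solve-∀

  0<Z : 0 < Z
  0<Z = ℕₚ.m^n>0 2 y

  -- The purpose of j ≥ 8: the integers compared in bad rows are of size 104 Z⁷ Q⁴ and have to stay
  -- within Q⁵.
  Z⁸≤Q : Z * Z * Z * Z * Z * Z * Z * Z ≤ Q
  Z⁸≤Q = ≡.subst (_≤ Q) (lemma Z) (ℕₚ.^-monoʳ-≤ Z {{ℕ.>-nonZero 0<Z}} 8≤j)
    where
    lemma : ∀ z → z * (z * (z * (z * (z * (z * (z * (z * 1))))))) ≡ z * z * z * z * z * z * z * z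
    lemma = solve-∀

  grow : ∀ {x} z → 0 < z → x ≤ x * z
  grow {x} z 0<z = ℕₚ.m≤m*n x z {{ℕ.>-nonZero 0<z}}

  Z²≤Q : Z * Z ≤ Q
  Z²≤Q = ℕₚ.≤-trans (grow Z 0<Z) (ℕₚ.≤-trans (grow Z 0<Z) (ℕₚ.≤-trans (grow Z 0<Z) (ℕₚ.≤-trans (grow Z 0<Z)
    (ℕₚ.≤-trans (grow Z 0<Z) (ℕₚ.≤-trans (grow Z 0<Z) Z⁸≤Q)))))

  Z≤Q : Z ≤ Q
  Z≤Q = ℕₚ.≤-trans (grow Z 0<Z) Z²≤Q

  0<Q : 0 < Q
  0<Q = ℕₚ.<-≤-trans 0<Z Z≤Q

  Q⁵ Q⁶ : ℕ
  Q⁵ = Q * Q * Q * Q * Q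
  Q⁶ = Q⁵ * Q

  Q^6≡ : (2 ^ (6 * j)) ^ y ≡ Q⁶
  Q^6≡ = ≡.trans (ℕₚ.^-*-assoc 2 (6 * j) y) (≡.trans (≡.cong (2 ^_) (exponents j y))
    (≡.trans (≡.sym (ℕₚ.^-*-assoc 2 (y * j) 6)) (≡.trans (≡.cong (_^ 6) (≡.sym (ℕₚ.^-*-assoc 2 y j))) (lemma Q))))
    where
    exponents : ∀ j y → 6 * j * y ≡ y * j * 6
    exponents = solve-∀
    lemma : ∀ q → q * (q * (q * (q * (q * (q * 1))))) ≡ q * q * q * q * q * q
    lemma = solve-∀

  Q⁶≤p : Q⁶ ≤ p
  Q⁶≤p = ≡.subst (_≤ p) Q^6≡ lower

  p<EQ⁶ : p < E * Q⁶
  p<EQ⁶ = ≡.subst (λ x → p < E * x) Q^6≡ upper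

  below-p : ∀ {x} → x ≤ Q⁵ → x < p
  below-p le = ℕₚ.≤-<-trans le (ℕₚ.<-≤-trans (ℕₚ.m<m*n Q⁵ Q {{ℕ.>-nonZero 0<Q⁵}} (ℕₚ.≤-trans (c≤Z 2 206 ≡.refl) Z≤Q)) Q⁶≤p)
    where
    0<Q⁵ : 0 < Q⁵
    0<Q⁵ = ℕₚ.*-mono-≤ (ℕₚ.*-mono-≤ (ℕₚ.*-mono-≤ (ℕₚ.*-mono-≤ 0<Q 0<Q) 0<Q) 0<Q) 0<Q

  Q≤Q⁵ : Q ≤ Q⁵
  Q≤Q⁵ = ℕₚ.≤-trans (grow Q 0<Q) (ℕₚ.≤-trans (grow Q 0<Q) (ℕₚ.≤-trans (grow Q 0<Q) (grow Q 0<Q)))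

  Q²≤Q⁵ : Q * Q ≤ Q⁵
  Q²≤Q⁵ = ℕₚ.≤-trans (grow Q 0<Q) (ℕₚ.≤-trans (grow Q 0<Q) (grow Q 0<Q))

  Q³≤Q⁵ : Q * Q * Q ≤ Q⁵
  Q³≤Q⁵ = ℕₚ.≤-trans (grow Q 0<Q) (grow Q 0<Q)

  -- Q³ is about √p; M falls short of it by a factor Z, which `normDegree` spends on the logarithmic
  -- k.
  MZ≡Q³ : M * Z ≡ Q * Q * Q
  MZ≡Q³ = ≡.trans (≡.sym (ℕₚ.^-distribˡ-+-* 2 k′ y)) (≡.trans (≡.cong (2 ^_) exponents)
    (≡.trans (≡.sym (ℕₚ.^-*-assoc 2 (y * j) 3)) (≡.trans (≡.cong (_^ 3) (≡.sym (ℕₚ.^-*-assoc 2 y j))) (lemma Q))))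
    where
    lemma : ∀ q → q * (q * (q * 1)) ≡ q * q * q
    lemma = solve-∀
    1≤3j : 1 ≤ 3 * j
    1≤3j = ℕₚ.≤-trans (ℕₚ.≤-trans (s≤s z≤n) 8≤j) (ℕₚ.m≤n*m j 3)
    comm : ∀ j y → 3 * j * y ≡ y * j * 3
    comm = solve-∀
    exponents : k′ + y ≡ y * j * 3
    exponents = ≡.trans (ℕₚ.+-comm k′ y) (≡.trans (≡.cong (_* y) (ℕₚ.m+[n∸m]≡n 1≤3j)) (comm j y))

  0<M : 0 < M
  0<M = ℕₚ.m^n>0 2 k′

  M≤Q³ : M ≤ Q * Q * Q
  M≤Q³ = ≡.subst (M ≤_) MZ≡Q³ (grow Z 0<Z)

  k<p : k < p
  k<p = below-p (ℕₚ.≤-trans (ℕₚ.m≤n*m k 8) (ℕₚ.≤-trans 8k≤Z (ℕₚ.≤-trans Z≤Q Q≤Q⁵)))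

  M≤p : M ≤ p
  M≤p = ℕₚ.<⇒≤ (below-p (ℕₚ.≤-trans M≤Q³ Q³≤Q⁵))

  -- With n = M k and 2ᵏ = 2M the sides are M (2Mk + 1) and 2M (Mk + 1), which differ by M.
  unknowns : M * suc (n + M * k) < 2 ^ k * suc n
  unknowns = ≡.subst (M * suc (n + M * k) <_) (lemma M k) (ℕₚ.m<m+n _ 0<M)
    where
    lemma : ∀ M k → M * suc (M * k + M * k) + M ≡ (M + (M + 0)) * suc (M * k)
    lemma = solve-∀

  -- As n + k + 2 ≤ 4Mk, the left side is at most 8 k M² ≤ (M Z)² = Q⁶.
  normDegree : 2 ^ k * (n + k + 2) ≤ p
  normDegree = ℕₚ.≤-trans (ℕₚ.*-monoʳ-≤ (2 ^ k) (ℕₚ.+-mono-≤ (ℕₚ.+-monoʳ-≤ n (ℕₚ.m≤n*m k M {{ℕ.>-nonZero 0<M}})) (ℕₚ.*-monoʳ-≤ 2 (ℕₚ.*-mono-≤ 0<M (s≤s (z≤n {k′}))))))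
    (ℕₚ.≤-trans (ℕₚ.≤-reflexive (lemma M k)) (ℕₚ.≤-trans (ℕₚ.*-monoʳ-≤ (M * M) (ℕₚ.≤-trans 8k≤Z (grow Z 0<Z)))
      (ℕₚ.≤-trans (ℕₚ.≤-reflexive (≡.trans (lemma₂ M Z) (≡.trans (≡.cong₂ _*_ MZ≡Q³ MZ≡Q³) (lemma₃ Q)))) Q⁶≤p)))
    where
    lemma : ∀ M k → (M + (M + 0)) * (M * k + M * k + 2 * (M * k)) ≡ M * M * (8 * k)
    lemma = solve-∀
    lemma₂ : ∀ M Z → M * M * (Z * Z) ≡ M * Z * (M * Z)
    lemma₂ = solve-∀
    lemma₃ : ∀ q → q * q * q * (q * q * q) ≡ q * q * q * q * q * q
    lemma₃ = solve-∀

  2^i≡ : 2 ^ i ≡ Z * Z * Q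
  2^i≡ = ≡.trans (≡.cong (2 ^_) (ℕₚ.*-comm (j + 2) y)) (≡.trans (≡.sym (ℕₚ.^-*-assoc 2 y (j + 2)))
    (≡.trans (ℕₚ.^-distribˡ-+-* Z j 2) (lemma Z Q)))
    where
    lemma : ∀ z q → q * (z * (z * 1)) ≡ z * z * q
    lemma = solve-∀

  -- Here 2ⁱ = Z² Q = Z A, and the factor Z pays for 4 i².
  block-size : i * (i * (4 * A)) + 1 < 2 ^ i
  block-size = ≡.subst (i * (i * (4 * A)) + 1 <_) (≡.sym (≡.trans 2^i≡ (ℕₚ.*-assoc Z Z Q))) (ℕₚ.≤-<-trans
    (≡.subst₂ _≤_ (lemma₁ i A) (lemma₂ (4 * (i * i)) A) (ℕₚ.+-monoʳ-≤ (4 * (i * i) * A) 0<A))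
    (ℕₚ.*-monoˡ-< A {{ℕ.>-nonZero 0<A}} 4i²<Z))
    where
    0<A : 0 < A
    0<A = ℕₚ.*-mono-≤ 0<Z 0<Q
    lemma₁ : ∀ i A → 4 * (i * i) * A + 1 ≡ i * (i * (4 * A)) + 1
    lemma₁ = solve-∀
    lemma₂ : ∀ x A → x * A + A ≡ (x + 1) * A
    lemma₂ = solve-∀

  Z⁴Q≤H : Z * Z * Z * Z * Q ≤ H
  Z⁴Q≤H = ≡.subst (_≤ H) (≡.trans (ℕₚ.^-distribˡ-+-* Z j 4) (lemma Z Q)) box
    where
    lemma : ∀ z q → q * (z * (z * (z * (z * 1)))) ≡ z * z * z * z * q
    lemma = solve-∀

  J : ℕ
  J = 2 * A

  2J≤ : J + J ≤ Z * Z * Q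
  2J≤ = ℕₚ.≤-trans (ℕₚ.≤-reflexive (lemma Z Q)) (ℕₚ.*-monoˡ-≤ Q (ℕₚ.*-monoˡ-≤ Z (c≤Z 4 204 ≡.refl)))
    where
    lemma : ∀ z q → 2 * (z * q) + 2 * (z * q) ≡ 4 * z * q
    lemma = solve-∀

  Z²Q<p : Z * Z * Q < p
  Z²Q<p = below-p (ℕₚ.≤-trans (ℕₚ.*-monoˡ-≤ Q Z²≤Q) Q²≤Q⁵)

  2Z³Q<H : 2 * (Z * Z * Z * Q) < H
  2Z³Q<H = ℕₚ.<-≤-trans (ℕₚ.*-monoˡ-< (Z * Z * Z * Q) {{ℕ.>-nonZero (ℕₚ.*-mono-≤ (ℕₚ.*-mono-≤ (ℕₚ.*-mono-≤ 0<Z 0<Z) 0<Z) 0<Q)}} (c≤Z 3 205 ≡.refl))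
    (ℕₚ.≤-trans (ℕₚ.≤-reflexive (lemma Z Q)) Z⁴Q≤H)
    where
    lemma : ∀ z q → z * (z * z * z * q) ≡ z * z * z * z * q
    lemma = solve-∀

  module WithBlock (U : ℕ) (2U≤ : U + U ≤ 2 ^ i) where

    V R : ℕ
    V = 4 * A
    R = 4 * (U * V)

    2U≤Z²Q : U + U ≤ Z * Z * Q
    2U≤Z²Q = ≡.subst (U + U ≤_) 2^i≡ 2U≤

    U≤Z²Q : U ≤ Z * Z * Q
    U≤Z²Q = ℕₚ.≤-trans (ℕₚ.m≤m+n U U) 2U≤Z²Q

    U<p : U + U < p
    U<p = ℕₚ.≤-<-trans 2U≤Z²Q Z²Q<p

    J<p : J + J < p
    J<p = ℕₚ.≤-<-trans 2J≤ Z²Q<p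

    J<H : J + J < H
    J<H = ℕₚ.≤-<-trans (ℕₚ.≤-trans 2J≤ (ℕₚ.≤-trans (ℕₚ.*-monoˡ-≤ Q (grow {Z * Z} Z 0<Z)) (ℕₚ.m≤n*m (Z * Z * Z * Q) 2))) 2Z³Q<H

    -- Steps are at most 2U ≤ Z² Q and k ≤ Z / 8, so either summand of the doubled bound is at most
    -- Z³ Q; the exponent j + 4 in `box` leaves one more factor Z.
    run<H : (V + (U + U) * k) + (V + (U + U) * k) < H
    run<H = ℕₚ.≤-<-trans (ℕₚ.≤-trans
        (ℕₚ.≤-reflexive (lemma₁ V ((U + U) * k)))
        (ℕₚ.+-mono-≤ {2 * V} {Z * Z * Z * Q}
          (ℕₚ.≤-trans (ℕₚ.≤-reflexive (lemma₂ Z Q)) (ℕₚ.≤-trans (ℕₚ.*-monoˡ-≤ Q (ℕₚ.*-monoˡ-≤ Z (c≤Z 8 200 ≡.refl))) (ℕₚ.*-monoˡ-≤ Q (grow {Z * Z} Z 0<Z))))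
          (ℕₚ.≤-trans (ℕₚ.*-monoʳ-≤ 2 (ℕₚ.*-monoˡ-≤ k 2U≤Z²Q)) (ℕₚ.≤-trans (ℕₚ.≤-reflexive (lemma₃ Z Q k))
            (ℕₚ.≤-trans (ℕₚ.*-monoʳ-≤ (Z * Z * Q) (ℕₚ.≤-trans (ℕₚ.*-monoˡ-≤ k (ℕₚ.m≤m+n 2 6)) 8k≤Z)) (ℕₚ.≤-reflexive (lemma₄ Z Q)))))))
      (≡.subst (_< H) (lemma₅ (Z * Z * Z * Q)) 2Z³Q<H)
      where
      lemma₁ : ∀ v w → (v + w) + (v + w) ≡ 2 * v + 2 * w
      lemma₁ = solve-∀
      lemma₂ : ∀ z q → 2 * (4 * (z * q)) ≡ 8 * z * q
      lemma₂ = solve-∀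
      lemma₃ : ∀ z q k → 2 * (z * z * q * k) ≡ z * z * q * (2 * k)
      lemma₃ = solve-∀
      lemma₄ : ∀ z q → z * z * q * z ≡ z * z * z * q
      lemma₄ = solve-∀
      lemma₅ : ∀ x → 2 * x ≡ x + x
      lemma₅ = solve-∀

    UV≤ : U * V ≤ 4 * (Z * Z * Z * Q * Q)
    UV≤ = ℕₚ.≤-trans (ℕₚ.*-monoˡ-≤ V U≤Z²Q) (ℕₚ.≤-reflexive (lemma Z Q))
      where
      lemma : ∀ z q → z * z * q * (4 * (z * q)) ≡ 4 * (z * z * z * q * q)
      lemma = solve-∀

    Zsum : ℕ
    Zsum = U * V + R + (R + R)

    Zsum≤ : Zsum ≤ 52 * (Z * Z * Z * Q * Q)
    Zsum≤ = ℕₚ.≤-trans (ℕₚ.≤-reflexive (lemma₁ (U * V))) (ℕₚ.≤-trans (ℕₚ.*-monoʳ-≤ 13 UV≤) (ℕₚ.≤-reflexive (lemma₂ (Z * Z * Z * Q * Q))))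
      where
      lemma₁ : ∀ x → x + 4 * x + (4 * x + 4 * x) ≡ 13 * x
      lemma₁ = solve-∀
      lemma₂ : ∀ x → 13 * (4 * x) ≡ 52 * x
      lemma₂ = solve-∀

    R<p : R < p
    R<p = below-p (ℕₚ.≤-trans (ℕₚ.*-monoʳ-≤ 4 UV≤) (ℕₚ.≤-trans (ℕₚ.≤-reflexive (lemma₁ (Z * Z * Z * Q * Q)))
      (ℕₚ.≤-trans (ℕₚ.*-monoˡ-≤ (Z * Z * Z * Q * Q) (c≤Z 16 192 ≡.refl))
      (ℕₚ.≤-trans (ℕₚ.≤-reflexive (lemma₂ Z Q)) (ℕₚ.≤-trans (ℕₚ.*-monoˡ-≤ (Q * Q) (ℕₚ.*-mono-≤ Z²≤Q Z²≤Q)) (ℕₚ.≤-trans (ℕₚ.≤-reflexive (lemma₃ Q)) (grow Q 0<Q)))))))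
      where
      lemma₁ : ∀ x → 4 * (4 * x) ≡ 16 * x
      lemma₁ = solve-∀
      lemma₂ : ∀ z q → z * (z * z * z * q * q) ≡ z * z * (z * z) * (q * q)
      lemma₂ = solve-∀
      lemma₃ : ∀ q → q * q * (q * q) ≡ q * q * q * q
      lemma₃ = solve-∀

    Z<p : Zsum * (U * (U + U)) + Zsum * (U * (U + U)) < p
    Z<p = below-p (ℕₚ.≤-trans (ℕₚ.≤-reflexive (lemma₀ (Zsum * (U * (U + U)))))
      (ℕₚ.≤-trans (ℕₚ.*-monoʳ-≤ 2 (ℕₚ.*-mono-≤ Zsum≤ (ℕₚ.*-mono-≤ U≤Z²Q 2U≤Z²Q)))
      (ℕₚ.≤-trans (ℕₚ.≤-reflexive (lemma₁ Z Q)) (ℕₚ.≤-trans (ℕₚ.*-monoˡ-≤ _ (c≤Z 104 104 ≡.refl))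
      (ℕₚ.≤-trans (ℕₚ.≤-reflexive (lemma₂ Z Q)) (ℕₚ.≤-trans (ℕₚ.*-monoˡ-≤ (Q * Q * Q * Q) Z⁸≤Q) (ℕₚ.≤-reflexive (lemma₃ Q))))))))
      where
      lemma₀ : ∀ x → x + x ≡ 2 * x
      lemma₀ = solve-∀
      lemma₁ : ∀ z q → 2 * (52 * (z * z * z * q * q) * (z * z * q * (z * z * q))) ≡ 104 * (z * z * z * z * z * z * z * (q * q * q * q))
      lemma₁ = solve-∀
      lemma₂ : ∀ z q → z * (z * z * z * z * z * z * z * (q * q * q * q)) ≡ z * z * z * z * z * z * z * z * (q * q * q * q)
      lemma₂ = solve-∀
      lemma₃ : ∀ q → q * (q * q * q * q) ≡ q * q * q * q * q
      lemma₃ = solve-∀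

    Z<2^A : Zsum < 2 ^ suc A
    Z<2^A = ℕₚ.≤-<-trans (ℕₚ.≤-trans Zsum≤ (ℕₚ.≤-trans (ℕₚ.*-monoˡ-≤ (Z * Z * Z * Q * Q) (c≤Z 52 156 ≡.refl))
        (ℕₚ.≤-reflexive power)))
      (ℕₚ.^-monoʳ-< 2 (s≤s (s≤s z≤n)) (s≤s (ℕₚ.≤-trans exponent≤Z (grow Q 0<Q))))
      where
      lemma : ∀ z q → z * (z * (z * (z * 1))) * (q * (q * 1)) ≡ z * (z * z * z * q * q)
      lemma = solve-∀
      power : Z * (Z * Z * Z * Q * Q) ≡ 2 ^ (y * (4 + 2 * j))
      power = ≡.trans (≡.sym (lemma Z Q)) (≡.trans (≡.cong (Z ^ 4 *_) (≡.trans (ℕₚ.^-*-assoc Z j 2) (≡.cong (Z ^_) (ℕₚ.*-comm j 2))))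
        (≡.trans (≡.sym (ℕₚ.^-distribˡ-+-* Z 4 (2 * j))) (ℕₚ.^-*-assoc 2 y (4 + 2 * j))))

    -- The decisive comparison: the left side is at most 4 k p < 4 k E Q⁶, the right side is 8 (Z
    -- Q)³ Q³ / Z = 8 Z² Q⁶.
    degree : (n + k * suc h) + (n + k * suc h) < A * V * (2 * A) * M
    degree = ℕₚ.≤-<-trans
      (ℕₚ.≤-trans (ℕₚ.+-mono-≤ half half) (ℕₚ.≤-reflexive (lemma₁ k p)))
      (ℕₚ.<-≤-trans (ℕₚ.*-monoʳ-< (4 * k) p<EQ⁶)
        (ℕₚ.≤-trans (ℕₚ.≤-reflexive (lemma₂ k E Q⁶))
        (ℕₚ.≤-trans (ℕₚ.*-monoˡ-≤ Q⁶ (ℕₚ.≤-trans (ℕₚ.*-monoˡ-≤ E (ℕₚ.*-monoˡ-≤ k (ℕₚ.m≤m+n 4 4))) (ℕₚ.≤-trans 8kE≤Z (ℕₚ.≤-trans (grow Z 0<Z) (ℕₚ.m≤n*m (Z * Z) 8)))))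
        (ℕₚ.≤-reflexive (≡.trans (lemma₃ Z Q) (≡.trans (≡.cong (8 * (Z * Z) * (Q * Q * Q) *_) (≡.sym MZ≡Q³)) (lemma₄ Z Q M)))))))
      where
      half : n + k * suc h ≤ 2 * k * p
      half = ℕₚ.≤-trans (ℕₚ.+-mono-≤ (ℕₚ.≤-trans (ℕₚ.*-monoˡ-≤ k M≤p) (ℕₚ.≤-reflexive (ℕₚ.*-comm p k)))
        (ℕₚ.*-monoʳ-≤ k (≡.subst (suc h ≤_) (≡.sym p≡) (s≤s (ℕₚ.m≤m+n h h))))) (ℕₚ.≤-reflexive (lemma k p))
        where
        lemma : ∀ k p → k * p + k * p ≡ 2 * k * p
        lemma = solve-∀
      lemma₁ : ∀ k p → 2 * k * p + 2 * k * p ≡ 4 * k * p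
      lemma₁ = solve-∀
      lemma₂ : ∀ k e q → 4 * k * (e * q) ≡ 4 * k * e * q
      lemma₂ = solve-∀
      lemma₃ : ∀ z q → 8 * (z * z) * (q * q * q * q * q * q) ≡ 8 * (z * z) * (q * q * q) * (q * q * q)
      lemma₃ = solve-∀
      lemma₄ : ∀ z q m → 8 * (z * z) * (q * q * q) * (m * z) ≡ z * q * (4 * (z * q)) * (2 * (z * q)) * m
      lemma₄ = solve-∀

module AtPrime (h : ℕ) (p-prime : Prime (suc (h + h))) (h>0 : 0 < h) (3<p : 3 < suc (h + h))
  (a c : ℤ) (a-unit : gcd a (+ suc (h + h)) ≡ + 1) (H : ℕ) where

  open Residues h p-prime h>0

  Goal : Set
  Goal = Σ ℕ λ X → Σ ℕ λ Y → X < p × Y < p × 2 ≤ cubicBoxCount p a c (+ X) (+ Y) H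

  a≉0 : ¬ a ~ + 0
  a≉0 e = ℕₚ.<⇒≢ (ℕₚ.<-trans (s≤s (s≤s z≤n)) 3<p)
    (≡.sym (∣1⇒≡1 (≡.subst (p ∣_) (ℤₚ.+-injective a-unit) (gcd-greatest (~0⇒∣ a e) ∣-refl))))

  open OverPrimeField 𝔽 domain h h>0 p·1≈0 n·1≉0 rep (λ {x} {y} → rep-injective {x} {y}) emb (λ {i} {j} → emb-injective {i} {j}) numeral _~?_
    using (module Curve)
  open Curve a c a≉0 3<p using (NoPair; module WithoutPairs)

  -- Disposes of the primes below the constant C, where H ≥ C exceeds p: a box covers all residues,
  -- and the points with abscissae 0 and 1 serve.
  whole-plane : p < H → Goal
  whole-plane p<H = start a c (+ 0) , start a c (+ 0) , start<p a c (+ 0) , start<p a c (+ 0) ,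
    two-points a c H (+ 0) (+ 0) 1 (residue (+ 0)) (residue u) (s≤s z≤n) (ℕₚ.<-trans (s≤s (s≤s z≤n)) 3<p)
      (ℕₚ.<-trans (ℕₚ.<-trans (s≤s (s≤s z≤n)) 3<p) p<H) (small (+ 0)) (small u) (is-residue (+ 0)) (is-residue u)
    where
    u : ℤ
    u = + 0 ℤ.+ 1 · (+ 1)
    residue : ℤ → ℕ
    residue x = toℕ (rep (cubic a c x))
    small : ∀ x → residue x < H
    small x = ℕₚ.<-trans (Finₚ.toℕ<n (rep (cubic a c x))) p<H
    is-residue : ∀ x → cubic a c x ~ + 0 ℤ.+ residue x · (+ 1)
    is-residue x = ~-trans (rep~ (cubic a c x)) (lift (≡.sym (≡.trans (ℤₚ.+-identityˡ (residue x · (+ 1))) (·1≡+ (residue x)))))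

  -- There are only p² corners and each count is decidable, so a refutation yields actual X and Y.
  search : (NoPair H → ⊥) → Goal
  search impossible = go (Finₚ.any? (λ X → Finₚ.any? (λ Y → 2 ℕ.≤? cubicBoxCount p a c (+ toℕ X) (+ toℕ Y) H)))
    where
    go : Dec (Σ (Fin p) λ X → Σ (Fin p) λ Y → 2 ≤ cubicBoxCount p a c (+ toℕ X) (+ toℕ Y) H) → Goal
    go (yes (X , Y , found)) = toℕ X , toℕ Y , Finₚ.toℕ<n X , Finₚ.toℕ<n Y , found
    go (no none) = ⊥-elim (impossible λ x y i j₁ j₂ 0<i i<p i<H j₁<H j₂<H e₁ e₂ → none
      (fromℕ< (start<p a c x) , fromℕ< (start<p a c y) ,
       ≡.subst₂ (λ X Y → 2 ≤ cubicBoxCount p a c (+ X) (+ Y) H)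
       (≡.sym (Finₚ.toℕ-fromℕ< (start<p a c x))) (≡.sym (Finₚ.toℕ-fromℕ< (start<p a c y)))
       (two-points a c H x y i j₁ j₂ 0<i i<p i<H j₁<H j₂<H e₁ e₂)))

  module _ (j y : ℕ) (8≤j : 8 ≤ j) (lower : (2 ^ (6 * j)) ^ y ≤ p) (upper : p < (2 ^ (6 * j)) ^ suc y)
    (slack : 208 * 2 ^ (6 * j) * ((3 * j + 2) * (3 * j + 2)) * (suc y * suc y) ≤ 2 ^ y)
    (box : (2 ^ y) ^ (j + 4) ≤ H) where

    private
      module S = Sizes j y p H h ≡.refl 8≤j lower upper slack box

    no-pair-impossible : NoPair H → ⊥
    no-pair-impossible noPair = go (pairwise-coprime-block S.i (4 * S.A) S.block-size)
      where
      go : (Σ ℕ λ U → Σ (List ℕ) λ ws → U + U ≤ 2 ^ S.i × 4 * S.A ≤ U × 4 * S.A ≤ length ws × AllPairs Coprime ws × Unique ws ×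
            All (λ w → U < w × w ≤ U + U) ws) → ⊥
      go (U , ws , 2U≤ , 4A≤U , many , coprimes , unique , block) =
        WithoutPairs.Parameters.Hypotheses.contradiction H noPair S.A U S.k ws S.M S.n S.k<p S.M≤p S.unknowns S.normDegree coprimes unique block many 4A≤U
          (S.WithBlock.U<p U 2U≤) (S.WithBlock.J<p U 2U≤) (S.WithBlock.J<H U 2U≤) (S.WithBlock.run<H U 2U≤) (S.WithBlock.Z<p U 2U≤)
          (S.WithBlock.R<p U 2U≤) (S.WithBlock.Z<2^A U 2U≤) (S.WithBlock.degree U 2U≤)

module Threshold (d : ℕ) where

  -- From p ≥ bʸ = Z^(6j), the required side Z^(j + 4) is at most p^(1/6 + 2/(3j)), which for j = 8d
  -- is p^(1/6 + 1/(12d)). The threshold y₀ is what `quadratic≤2^` demands for `slack`, and p ≥ C =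
  -- b^y₀ ensures y ≥ y₀.
  j b s c₀ y₀ C : ℕ
  j = 8 * d
  b = 2 ^ (6 * j)
  s = 3 * j + 2
  c₀ = 208 * b * (s * s)
  y₀ = 3 + 64 * c₀
  C = b ^ y₀

  0<b : 0 < b
  0<b = ℕₚ.m^n>0 2 (6 * j)

  0<C : 0 < C
  0<C = ℕₚ.m^n>0 b {{ℕ.>-nonZero 0<b}} y₀

  module _ (1≤d : 1 ≤ d) where

    instance
      6d≢0 : ℕ.NonZero (6 * d)
      6d≢0 = ℕ.>-nonZero (ℕₚ.≤-trans 1≤d (ℕₚ.m≤n*m d 6))

    8≤j : 8 ≤ j
    8≤j = ℕₚ.*-monoʳ-≤ 8 1≤d

    2≤b : 2 ≤ b
    2≤b = ℕₚ.^-monoʳ-≤ 2 {1} (ℕₚ.≤-trans (ℕₚ.≤-trans (s≤s z≤n) 8≤j) (ℕₚ.m≤n*m j 6))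

    C≤H : ∀ p e H → 0 < p → C ^ (6 * d) * p ^ e ≤ H ^ (6 * d) → C ≤ H
    C≤H p e H 0<p le = ^-cancelˡ-≤ (6 * d) C H
      (ℕₚ.≤-trans (ℕₚ.m≤m*n (C ^ (6 * d)) (p ^ e) {{ℕ.>-nonZero (ℕₚ.m^n>0 p {{ℕ.>-nonZero 0<p}} e)}}) le)

    large-exponent : ∀ {p y} → C ≤ p → p < b ^ suc y → y₀ ≤ y
    large-exponent {p} {y} C≤p p<b^ = ℕₚ.≮⇒≥ λ y<y₀ →
      ℕₚ.<⇒≱ p<b^ (ℕₚ.≤-trans (ℕₚ.^-monoʳ-≤ b {{ℕ.>-nonZero 0<b}} y<y₀) C≤p)

    box-bound : ∀ n → 1 ≤ n → ∀ p y H → b ^ y ≤ p → C ^ (6 * d) * p ^ (d + 6 * n) ≤ H ^ (6 * d) → (2 ^ y) ^ (j + 4) ≤ H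
    box-bound n 1≤n p y H b^y≤p le = ^-cancelˡ-≤ (6 * d) _ H (begin
      ((2 ^ y) ^ (j + 4)) ^ (6 * d)    ≡⟨ ≡.cong (_^ (6 * d)) (ℕₚ.^-*-assoc 2 y (j + 4)) ⟩
      (2 ^ (y * (j + 4))) ^ (6 * d)    ≡⟨ ℕₚ.^-*-assoc 2 (y * (j + 4)) (6 * d) ⟩
      2 ^ (y * (j + 4) * (6 * d))      ≤⟨ ℕₚ.^-monoʳ-≤ 2 exponents ⟩
      2 ^ (6 * j * y * (d + 6 * n))    ≡⟨ ℕₚ.^-*-assoc 2 (6 * j * y) (d + 6 * n) ⟨
      (2 ^ (6 * j * y)) ^ (d + 6 * n)  ≡⟨ ≡.cong (_^ (d + 6 * n)) (ℕₚ.^-*-assoc 2 (6 * j) y) ⟨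
      (b ^ y) ^ (d + 6 * n)            ≤⟨ ℕₚ.^-monoˡ-≤ (d + 6 * n) b^y≤p ⟩
      p ^ (d + 6 * n)                  ≤⟨ ℕₚ.m≤n*m (p ^ (d + 6 * n)) (C ^ (6 * d)) {{ℕ.>-nonZero (ℕₚ.m^n>0 C {{ℕ.>-nonZero 0<C}} (6 * d))}} ⟩
      C ^ (6 * d) * p ^ (d + 6 * n)    ≤⟨ le ⟩
      H ^ (6 * d)                      ∎)
      where
      open ℕₚ.≤-Reasoning
      lemma₁ : ∀ d y → y * (8 * d + 4) * (6 * d) ≡ 48 * (d * d * y) + 24 * (d * y)
      lemma₁ = solve-∀
      lemma₂ : ∀ d y n → 6 * (8 * d) * y * (d + 6 * n) ≡ 48 * (d * d * y) + 288 * (n * (d * y))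
      lemma₂ = solve-∀
      exponents : y * (j + 4) * (6 * d) ≤ 6 * j * y * (d + 6 * n)
      exponents = ≡.subst₂ _≤_ (≡.sym (lemma₁ d y)) (≡.sym (lemma₂ d y n))
        (ℕₚ.+-monoʳ-≤ (48 * (d * d * y)) (ℕₚ.*-mono-≤ (ℕₚ.m≤m+n 24 264) (ℕₚ.m≤n*m (d * y) n {{ℕ.>-nonZero 1≤n}})))

    two-points-in-box : ∀ n → 1 ≤ n → ∀ p → Prime p → 3 < p → (a c : ℤ) → gcd a (+ p) ≡ + 1 → ∀ H →
      C ^ (6 * d) * p ^ (d + 6 * n) ≤ H ^ (6 * d) →
      Σ ℕ λ X → Σ ℕ λ Y → X < p × Y < p × 2 ≤ cubicBoxCount p a c (+ X) (+ Y) H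
    two-points-in-box n 1≤n p p-prime 3<p a c unit H le = go (odd-prime p p-prime 3<p) (C ℕ.≤? p)
      where
      go : (Σ ℕ λ h → 0 < h × p ≡ suc (h + h)) → Dec (C ≤ p) →
           Σ ℕ λ X → Σ ℕ λ Y → X < p × Y < p × 2 ≤ cubicBoxCount p a c (+ X) (+ Y) H
      go (h , h>0 , ≡.refl) (no C≰p) = AtPrime.whole-plane h p-prime h>0 3<p a c unit H
        (ℕₚ.<-≤-trans (ℕₚ.≰⇒> C≰p) (C≤H p (d + 6 * n) H (s≤s z≤n) le))
      go (h , h>0 , ≡.refl) (yes C≤p) = from-log (integer-log b p 2≤b (s≤s z≤n))
        where
        from-log : (Σ ℕ λ y → b ^ y ≤ p × p < b ^ suc y) →
                   Σ ℕ λ X → Σ ℕ λ Y → X < p × Y < p × 2 ≤ cubicBoxCount p a c (+ X) (+ Y) H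
        from-log (y , lower , upper) = AtPrime.search h p-prime h>0 3<p a c unit H
          (AtPrime.no-pair-impossible h p-prime h>0 3<p a c unit H j y 8≤j lower upper
            (quadratic≤2^ c₀ y (large-exponent C≤p upper)) (box-bound n 1≤n p y H lower le))

theorem2 : (n d : ℕ) → 1 ≤ n → 1 ≤ d →
    Σ ℕ λ C → 1 ≤ C ×
    ((p : ℕ) → Prime p → 3 < p →
    (a c : ℤ) → gcd a (+ p) ≡ + 1 →
    (H : ℕ) → 1 ≤ H →
    (C ^ (6 * d)) * (p ^ (d + 6 * n)) ≤ H ^ (6 * d) →
    Σ ℕ λ X → Σ ℕ λ Y → X < p × Y < p ×
    2 ≤ cubicBoxCount p a c (+ X) (+ Y) H)
theorem2 n d 1≤n 1≤d = Threshold.C d , Threshold.0<C d ,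
  λ p p-prime 3<p a c unit H _ → Threshold.two-points-in-box d 1≤d n 1≤n p p-prime 3<p a c unit H
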